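{- For any set $S$ of positive integers of asymptotic density zero, the set $\mathcal{U}\cup S$ is not a union of finitely many infinite arithmetic progressions $\{m_ih+a_i : h=0,1,2,\dots\}$ (with $m_i,a_i$ positive integers) and a set of asymptotic density zero.
   Context: $\mathcal{U}$ denotes the set of positive odd integers $n$ that cannot be written as $n=p+2^k$ with $p$ a prime and $k$ a positive integer. A set $A$ of positive integers has asymptotic density $\delta$ if $|A\cap[1,x]|/x\to\delta$ as $x\to\infty$. -}

module Defs where

open import Level using (0ℓ)
open import Data.Nat using (ℕ; zero; suc; _+_; _*_; _^_; _≤_; _%_)
open import Data.Nat.Primality using (Prime)
open import Data.Product using (Σ; ∃; _×_; _,_)
open import Data.Sum using (_⊎_)
open import Data.List using (List; length)
open import Data.List.Relation.Unary.All using (All)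
open import Data.List.Relation.Unary.Any using (Any)
open import Data.List.Relation.Unary.Unique.Propositional using (Unique)
open import Relation.Nullary using (¬_)
open import Relation.Unary using (Pred)
open import Relation.Binary.PropositionalEquality using (_≡_)

𝒰 : Pred ℕ 0ℓ
𝒰 n = (1 ≤ n) × (n % 2 ≡ 1) ×
      ¬ (Σ ℕ λ p → Σ ℕ λ k → Prime p × (1 ≤ k) × (n ≡ p + 2 ^ k))

-- Asymptotic density zero: |A ∩ [1,x]| / x → 0, i.e. for every k ≥ 1,
-- eventually |A ∩ [1,x]| ≤ x / k.  Since A need not be decidable, the
-- cardinality bound is phrased as: every duplicate-free list of elements
-- of A ∩ [1,x] has length ℓ with k * ℓ ≤ x.
DensityZero : Pred ℕ 0ℓ → Set
DensityZero A =
  ∀ (k : ℕ) → 1 ≤ k → Σ ℕ λ X → ∀ (x : ℕ) → X ≤ x →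
    ∀ (l : List ℕ) → Unique l → All (λ n → (1 ≤ n) × (n ≤ x) × A n) l →
    k * length l ≤ x

InAP : ℕ × ℕ → ℕ → Set
InAP (m , a) n = Σ ℕ λ h → n ≡ m * h + a

ValidAP : ℕ × ℕ → Set
ValidAP (m , a) = (1 ≤ m) × (1 ≤ a)

IsAPUnionPlus : Pred ℕ 0ℓ → List (ℕ × ℕ) → Pred ℕ 0ℓ → Set
IsAPUnionPlus A ps Z =
  ∀ (n : ℕ) → (A n → (Any (λ mp → InAP mp n) ps ⊎ Z n))
            × ((Any (λ mp → InAP mp n) ps ⊎ Z n) → A n)

_∪ₚ_ : Pred ℕ 0ℓ → Pred ℕ 0ℓ → Pred ℕ 0ℓ
(A ∪ₚ B) n = A n ⊎ B n

{-# OPTIONS --safe #-}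

-- If 𝒰 ∪ S were such a union, it would be, up to density zero, a union of residue classes modulo a fixed
-- even M₀. By Romanoff's theorem (a positive proportion of the integers have the form p + 2ᵏ), the progressions
-- cannot meet every odd class, since representable numbers in a progression belong to S. So in some odd class
-- c₀ mod M₀ almost every number is of the form p + 2ᵏ. For distinct primes q pick a prime p_q for which 2 has
-- order q; then p_q > 2q. Inside c₀ mod M₀, choose a class modulo M = M₀ ∏ p_q, prescribing a power of 2 as
-- residue modulo each p_q greedily: up to O(1) primes each, the exponents k that can still occur have
-- proportion at most ∏ (1 − 1/q). As ∏ (1 − 1/q)(1 + 1/p_q) → 0, the sieve bound for primes in a residue class
-- shows that at most half of the members of the chosen class are representable, a contradiction.

module Submission where

open import Defs
open import Level using (0ℓ)
open import Data.Nat using (ℕ; _≤_)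
open import Data.Product using (Σ; _×_)
open import Data.List using (List)
open import Data.List.Relation.Unary.All using (All)
open import Relation.Nullary using (¬_)
open import Relation.Unary using (Pred)

open import Data.Empty using (⊥)
open import Data.Integer using (ℤ; 0ℤ; 1ℤ) renaming (+_ to pos; ∣_∣ to abs)
import Data.Integer as ℤ
import Data.Integer.Properties as ℤ
import Data.Integer.Tactic.RingSolver as ℤ-Solver
open import Data.List using ([]; _∷_; length; map; filter)
open import Data.List.Membership.Propositional using (_∈_)
open import Data.List.Relation.Unary.All as All using ([]; _∷_)
import Data.List.Relation.Unary.All.Properties as All
open import Data.List.Relation.Unary.AllPairs using (AllPairs; []; _∷_)
import Data.List.Relation.Unary.AllPairs.Properties as AllPairs
open import Data.List.Relation.Unary.Any as Any using (Any; here; there)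
open import Data.List.Relation.Unary.Unique.Propositional using (Unique)
open import Data.Nat
open import Data.Nat.Combinatorics using (_C_; nCk+nC[k+1]≡[n+1]C[k+1]; k>n⇒nCk≡0; nCn≡1)
open import Data.Nat.Coprimality using (Coprime; coprime-Bézout; coprime-divisor)
open import Data.Nat.Divisibility
open import Data.Nat.DivMod
open import Data.Nat.GCD using (module Bézout)
open import Data.Nat.Induction using (<-rec)
open import Data.Nat.ListAction using (product)
open import Data.Nat.Primality
  using (Prime; prime[2]; prime?; prime⇒nonTrivial; prime⇒irreducible; euclidsLemma; ¬prime[0]; ¬prime[1]; ¬prime⇒composite)
open import Data.Nat.Properties
open import Data.Nat.Tactic.RingSolver using (solve-∀)
open import Data.Product using (∃; _,_; proj₁; proj₂)
open import Data.Sum using (_⊎_; inj₁; inj₂; [_,_]′)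
open import Function using (_∘_; id)
open import Relation.Binary.PropositionalEquality using (_≡_; _≢_; refl; sym; trans; cong; cong₂; subst; subst₂)
open import Relation.Nullary using (Dec; yes; no; contradiction; ¬?; _×-dec_; _⊎-dec_)
open import Relation.Nullary.Decidable using (map′; from-yes)

open ≤-Reasoning

-- Finite sums and congruences

-- The factor 2 in p_q > 2q carries the argument. A prime dividing M is lost for sieving the class,
-- so p_q costs a factor 1 + 1/p_q, while its congruence saves only 1 - 1/q on the exponents. From
-- p_q > q alone one gets ∏ (1 - 1/q)(1 + 1/q), which stays away from zero; with p_q > 2q the
-- factors are about 1 - 1/(2q), and the product vanishes because the sum of 1/q diverges. All upper
-- bounds come from one sieve, which tests the unsifted set against a single explicit combination of
-- nearly orthogonal functions, so that no weights have to be optimised. For Romanoff's theorem it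
-- removes two classes modulo each prime, and one needs that ∏ (1 + 1/p) over p ∣ 2ⁿ - 1 is bounded
-- on average over n. Everything is stated in natural numbers with cleared denominators: ∏ (1 + 1/p)
-- appears as a product of the p + 1 compared with a product of the p, and sums of 1/m are scaled
-- and rounded down.

∑ : ℕ → (ℕ → ℕ) → ℕ
∑ zero    f = 0
∑ (suc n) f = ∑ n f + f n

∑-cong : ∀ n {f g : ℕ → ℕ} → (∀ i → i < n → f i ≡ g i) → ∑ n f ≡ ∑ n g
∑-cong zero    e = refl
∑-cong (suc n) e = cong₂ _+_ (∑-cong n λ i i<n → e i (m<n⇒m<1+n i<n)) (e n ≤-refl)

∑-mono : ∀ n {f g : ℕ → ℕ} → (∀ i → i < n → f i ≤ g i) → ∑ n f ≤ ∑ n g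
∑-mono zero    e = z≤n
∑-mono (suc n) e = +-mono-≤ (∑-mono n λ i i<n → e i (m<n⇒m<1+n i<n)) (e n ≤-refl)

∑-+ : ∀ n (f g : ℕ → ℕ) → ∑ n (λ i → f i + g i) ≡ ∑ n f + ∑ n g
∑-+ zero    f g = refl
∑-+ (suc n) f g = trans (cong (_+ (f n + g n)) (∑-+ n f g)) (eq (∑ n f) (∑ n g) (f n) (g n))
  where
  eq : ∀ a b c d → (a + b) + (c + d) ≡ (a + c) + (b + d)
  eq = solve-∀

∑-*ˡ : ∀ n c (f : ℕ → ℕ) → ∑ n (λ i → c * f i) ≡ c * ∑ n f
∑-*ˡ zero    c f = sym (*-zeroʳ c)
∑-*ˡ (suc n) c f = trans (cong (_+ c * f n) (∑-*ˡ n c f)) (sym (*-distribˡ-+ c (∑ n f) (f n)))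

∑-*ʳ : ∀ n c (f : ℕ → ℕ) → ∑ n (λ i → f i * c) ≡ ∑ n f * c
∑-*ʳ n c f = trans (∑-cong n λ i _ → *-comm (f i) c) (trans (∑-*ˡ n c f) (*-comm c (∑ n f)))

∑-const : ∀ n c → ∑ n (λ _ → c) ≡ n * c
∑-const zero    c = refl
∑-const (suc n) c = trans (cong (_+ c) (∑-const n c)) (+-comm (n * c) c)

∑-≤const : ∀ n {f : ℕ → ℕ} c → (∀ i → i < n → f i ≤ c) → ∑ n f ≤ n * c
∑-≤const n c e = ≤-trans (∑-mono n e) (≤-reflexive (∑-const n c))

∑-swap : ∀ m n (f : ℕ → ℕ → ℕ) → ∑ m (λ i → ∑ n (f i)) ≡ ∑ n (λ j → ∑ m (λ i → f i j))
∑-swap zero    n f = sym (trans (∑-const n 0) (*-zeroʳ n))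
∑-swap (suc m) n f = trans (cong (_+ ∑ n (f m)) (∑-swap m n f)) (sym (∑-+ n (λ j → ∑ m (λ i → f i j)) (f m)))

∑-split : ∀ m n (f : ℕ → ℕ) → ∑ (m + n) f ≡ ∑ m f + ∑ n (λ i → f (m + i))
∑-split m zero    f = trans (cong (λ k → ∑ k f) (+-identityʳ m)) (sym (+-identityʳ _))
∑-split m (suc n) f = trans (cong (λ k → ∑ k f) (+-suc m n))
  (trans (cong (_+ f (m + n)) (∑-split m n f)) (+-assoc (∑ m f) _ _))

∑-blocks : ∀ m n (f : ℕ → ℕ) → ∑ (m * n) f ≡ ∑ m (λ i → ∑ n (λ j → f (i * n + j)))
∑-blocks zero    n f = refl
∑-blocks (suc m) n f = trans (cong (λ k → ∑ k f) (+-comm n (m * n)))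
  (trans (∑-split (m * n) n f) (cong (_+ ∑ n (λ j → f (m * n + j))) (∑-blocks m n f)))

∑-monoˡ : ∀ {m n} (f : ℕ → ℕ) → m ≤ n → ∑ m f ≤ ∑ n f
∑-monoˡ {m} {n} f m≤n = begin
  ∑ m f  ≤⟨ m≤m+n _ _ ⟩
  ∑ m f + ∑ (n ∸ m) (λ i → f (m + i))  ≡⟨ ∑-split m (n ∸ m) f ⟨
  ∑ (m + (n ∸ m)) f  ≡⟨ cong (λ k → ∑ k f) (m+[n∸m]≡n m≤n) ⟩
  ∑ n f  ∎

term≤∑ : ∀ n (f : ℕ → ℕ) i → i < n → f i ≤ ∑ n f
term≤∑ (suc n) f i i<1+n with m<1+n⇒m<n∨m≡n i<1+n
... | inj₁ i<n  = ≤-trans (term≤∑ n f i i<n) (m≤m+n _ _)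
... | inj₂ refl = m≤n+m _ _

∑-zero : ∀ n {f : ℕ → ℕ} → (∀ i → i < n → f i ≡ 0) → ∑ n f ≡ 0
∑-zero n e = trans (∑-cong n e) (trans (∑-const n 0) (*-zeroʳ n))

⟦_⟧ : ∀ {P : Set} → Dec P → ℕ
⟦ yes _ ⟧ = 1
⟦ no  _ ⟧ = 0

⟦⟧-yes : ∀ {P : Set} (d : Dec P) → P → ⟦ d ⟧ ≡ 1
⟦⟧-yes (yes _) p = refl
⟦⟧-yes (no ¬p) p = contradiction p ¬p

⟦⟧-no : ∀ {P : Set} (d : Dec P) → ¬ P → ⟦ d ⟧ ≡ 0
⟦⟧-no (yes p) ¬p = contradiction p ¬p
⟦⟧-no (no _)  ¬p = refl

⟦⟧≤1 : ∀ {P : Set} (d : Dec P) → ⟦ d ⟧ ≤ 1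
⟦⟧≤1 (yes _) = ≤-refl
⟦⟧≤1 (no _)  = z≤n

⟦⟧-bound : ∀ {P : Set} (d : Dec P) {x} → (P → 1 ≤ x) → ⟦ d ⟧ ≤ x
⟦⟧-bound (yes p) h = h p
⟦⟧-bound (no _)  h = z≤n

⟦⟧-mono : ∀ {P Q : Set} (d : Dec P) (e : Dec Q) → (P → Q) → ⟦ d ⟧ ≤ ⟦ e ⟧
⟦⟧-mono d e h = ⟦⟧-bound d λ p → ≤-reflexive (sym (⟦⟧-yes e (h p)))

⟦⟧-cong : ∀ {P Q : Set} (d : Dec P) (e : Dec Q) → (P → Q) → (Q → P) → ⟦ d ⟧ ≡ ⟦ e ⟧
⟦⟧-cong d e f g = ≤-antisym (⟦⟧-mono d e f) (⟦⟧-mono e d g)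

∑-unique : ∀ n {P : ℕ → Set} (P? : ∀ i → Dec (P i)) → (∀ i j → i < n → j < n → P i → P j → i ≡ j) →
  ∑ n (λ i → ⟦ P? i ⟧) ≤ 1
∑-unique zero    P? u = z≤n
∑-unique (suc n) P? u with P? n
... | no _  = ≤-trans (≤-reflexive (+-identityʳ _))
                (∑-unique n P? λ i j i<n j<n → u i j (m<n⇒m<1+n i<n) (m<n⇒m<1+n j<n))
... | yes p = ≤-reflexive (cong (_+ 1) (∑-zero n λ i i<n →
                ⟦⟧-no (P? i) λ q → <⇒≢ i<n (u i n (m<n⇒m<1+n i<n) ≤-refl q p)))

-- Multiples of `p` are added on both sides, so that congruences in ℕ compose without subtraction
-- and without knowing which side is larger. Divisibility of a difference is recovered by `cong-∸`
-- where it is needed.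
record Cong (p a b : ℕ) : Set where
  constructor congruent
  field
    x y : ℕ
    eq  : a + p * x ≡ b + p * y

cong-refl : ∀ {p a} → Cong p a a
cong-refl = congruent 0 0 refl

cong-reflexive : ∀ {p a b} → a ≡ b → Cong p a b
cong-reflexive refl = cong-refl

cong-sym : ∀ {p a b} → Cong p a b → Cong p b a
cong-sym (congruent x y e) = congruent y x (sym e)

cong-trans : ∀ {p a b c} → Cong p a b → Cong p b c → Cong p a c
cong-trans {p} {a} {b} {c} (congruent x y e) (congruent z w f) = congruent (x + z) (w + y) (begin-equality
  a + p * (x + z)  ≡⟨ eq₁ a p x z ⟩
  (a + p * x) + p * z  ≡⟨ cong (_+ p * z) e ⟩
  (b + p * y) + p * z  ≡⟨ eq₂ b p y z ⟩
  (b + p * z) + p * y  ≡⟨ cong (_+ p * y) f ⟩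
  (c + p * w) + p * y  ≡⟨ eq₁ c p w y ⟨
  c + p * (w + y)  ∎)
  where
  eq₁ : ∀ a p x z → a + p * (x + z) ≡ (a + p * x) + p * z
  eq₁ = solve-∀
  eq₂ : ∀ b p y z → (b + p * y) + p * z ≡ (b + p * z) + p * y
  eq₂ = solve-∀

cong-+ : ∀ {p a b c d} → Cong p a b → Cong p c d → Cong p (a + c) (b + d)
cong-+ {p} {a} {b} {c} {d} (congruent x y e) (congruent z w f) = congruent (x + z) (y + w)
  (trans (eq a c p x z) (trans (cong₂ _+_ e f) (sym (eq b d p y w))))
  where
  eq : ∀ a c p x z → (a + c) + p * (x + z) ≡ (a + p * x) + (c + p * z)
  eq = solve-∀

cong-*ˡ : ∀ {p a b} c → Cong p a b → Cong p (c * a) (c * b)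
cong-*ˡ {p} {a} {b} c (congruent x y e) = congruent (c * x) (c * y)
  (trans (eq c a p x) (trans (cong (c *_) e) (sym (eq c b p y))))
  where
  eq : ∀ c a p x → c * a + p * (c * x) ≡ c * (a + p * x)
  eq = solve-∀

cong-* : ∀ {p a b c d} → Cong p a b → Cong p c d → Cong p (a * c) (b * d)
cong-* {p} {a} {b} {c} {d} e f = cong-trans (subst₂ (Cong p) (*-comm c a) (*-comm c b) (cong-*ˡ c e)) (cong-*ˡ b f)

cong-+-cancelˡ : ∀ {p a b} c → Cong p (c + a) (c + b) → Cong p a b
cong-+-cancelˡ {p} {a} {b} c (congruent x y e) = congruent x y
  (+-cancelˡ-≡ c _ _ (trans (sym (+-assoc c a (p * x))) (trans e (+-assoc c b (p * y)))))

cong-∣ : ∀ {p q a b} → p ∣ q → Cong q a b → Cong p a b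
cong-∣ {p} {q} {a} {b} (divides k refl) (congruent x y e) = congruent (k * x) (k * y)
  (trans (cong (a +_) (eq p k x)) (trans e (cong (b +_) (sym (eq p k y)))))
  where
  eq : ∀ p k x → p * (k * x) ≡ (k * p) * x
  eq = solve-∀

∣⇒cong0 : ∀ {p a} → p ∣ a → Cong p a 0
∣⇒cong0 {p} {a} (divides k e) = congruent 0 k (trans (cong (a +_) (*-zeroʳ p)) (trans (+-identityʳ a) (trans e (*-comm k p))))

cong0⇒∣ : ∀ {p a} → Cong p a 0 → p ∣ a
cong0⇒∣ {p} {a} (congruent x y e) = ∣m+n∣m⇒∣n (subst (p ∣_) (trans (sym e) (+-comm a (p * x))) (m∣m*n y)) (m∣m*n x)

cong-p* : ∀ {p} a k → Cong p (a + p * k) a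
cong-p* {p} a k = congruent 0 k (trans (cong (a + p * k +_) (*-zeroʳ p)) (+-identityʳ _))

cong⇒∣ : ∀ {p a b} → Cong p (a + b) a → p ∣ b
cong⇒∣ {p} {a} {b} e = cong0⇒∣ (cong-+-cancelˡ a (cong-trans e (cong-reflexive (sym (+-identityʳ a)))))

cong-∸ : ∀ {p a b} → b ≤ a → Cong p a b → p ∣ a ∸ b
cong-∸ {p} {a} {b} b≤a e = cong⇒∣ (subst (λ z → Cong p z b) (sym (m+[n∸m]≡n b≤a)) e)

∸-cong : ∀ {p a b} → b ≤ a → p ∣ a ∸ b → Cong p a b
∸-cong {p} {a} {b} b≤a d = subst₂ (Cong p) (m+[n∸m]≡n b≤a) (+-identityʳ b)
  (cong-+ (cong-refl {a = b}) (∣⇒cong0 d))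

cong? : ∀ p a b → Dec (Cong p a b)
cong? p a b with ≤-total b a
... | inj₁ b≤a = map′ (∸-cong b≤a) (cong-∸ b≤a) (p ∣? (a ∸ b))
... | inj₂ a≤b = map′ (cong-sym ∘ ∸-cong a≤b) (cong-∸ a≤b ∘ cong-sym) (p ∣? (b ∸ a))

cong-< : ∀ {p a b} → a < p → b < p → Cong p a b → a ≡ b
cong-< {p} a<p b<p e = [ (λ b≤a → lemma a<p b≤a e) , (λ a≤b → sym (lemma b<p a≤b (cong-sym e))) ]′ (≤-total _ _)
  where
  lemma : ∀ {a b} → a < p → b ≤ a → Cong p a b → a ≡ b
  lemma {a} {b} a<p b≤a e = ≤-antisym (m∸n≡0⇒m≤n (small (a ∸ b) (≤-<-trans (m∸n≤m a b) a<p) (cong-∸ b≤a e))) b≤a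
    where
    small : ∀ k → k < p → p ∣ k → k ≡ 0
    small zero    _   _ = refl
    small (suc k) k<p d = contradiction d (>⇒∤ k<p)

cong-% : ∀ a p .{{_ : NonZero p}} → Cong p a (a % p)
cong-% a p = congruent 0 (a / p) (trans (cong (a +_) (*-zeroʳ p)) (trans (+-identityʳ a)
  (trans (m≡m%n+[m/n]*n a p) (cong (a % p +_) (*-comm (a / p) p)))))

cong-cancel-* : ∀ {p m} i j → Coprime p m → Cong p (m * i) (m * j) → Cong p i j
cong-cancel-* {p} {m} i j cop e with ≤-total j i
... | inj₁ j≤i = ∸-cong j≤i (coprime-divisor cop (subst (p ∣_) (sym (*-distribˡ-∸ m i j)) (cong-∸ (*-monoʳ-≤ m j≤i) e)))
... | inj₂ i≤j = cong-sym (∸-cong i≤j (coprime-divisor cop (subst (p ∣_) (sym (*-distribˡ-∸ m j i)) (cong-∸ (*-monoʳ-≤ m i≤j) (cong-sym e)))))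

inverse-mod : ∀ {m p} → Coprime m p → Σ ℕ λ u → Cong p (m * u) 1
inverse-mod {m} {p} cop with coprime-Bézout cop
... | Bézout.+- x y e = x , congruent 0 y (trans (cong (m * x +_) (*-zeroʳ p)) (trans (+-identityʳ _)
        (trans (*-comm m x) (trans (sym e) (cong suc (*-comm y p))))))
-- Here 1 + x m = y p, so x (p − 1) · m ≡ 1; the multiple of p added on the left avoids subtraction.
... | Bézout.-+ x y e with p
...   | zero   = contradiction (trans e (*-zeroʳ y)) λ ()
...   | suc p′ = x * p′ , congruent 1 (y * p′) (begin-equality
        m * (x * p′) + suc p′ * 1  ≡⟨ eq m x p′ ⟩
        1 + (1 + x * m) * p′  ≡⟨ cong (λ z → 1 + z * p′) e ⟩
        1 + (y * suc p′) * p′  ≡⟨ eq₂ y p′ ⟩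
        1 + suc p′ * (y * p′)  ∎)
  where
  eq : ∀ m x p′ → m * (x * p′) + suc p′ * 1 ≡ 1 + (1 + x * m) * p′
  eq = solve-∀
  eq₂ : ∀ y p′ → 1 + (y * suc p′) * p′ ≡ 1 + suc p′ * (y * p′)
  eq₂ = solve-∀

solve-mod : ∀ {m p} .{{_ : NonZero p}} → Coprime m p → ∀ c a → Σ ℕ λ t → t < p × Cong p (c + m * t) a
solve-mod {m} {p@(suc p′)} cop c a with inverse-mod cop
... | u , eu = v % p , m%n<n v p , cong-trans (cong-+ (cong-refl {a = c}) (cong-*ˡ m (cong-sym (cong-% v p))))
     (cong-trans (cong-+ (cong-refl {a = c}) mv) (congruent 0 c (eq c a p′)))
  where
  -- Modulo p = 1 + p′ the number `p′ * c` is -c.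
  v = u * (a + p′ * c)
  mv : Cong p (m * v) (a + p′ * c)
  mv = cong-trans (cong-reflexive (sym (*-assoc m u (a + p′ * c))))
        (subst (Cong p (m * u * (a + p′ * c))) (*-identityˡ _) (cong-* eu cong-refl))
  eq : ∀ c a p′ → (c + (a + p′ * c)) + suc p′ * 0 ≡ a + suc p′ * c
  eq = solve-∀

-- An upper bound sieve

∑ℤ : ℕ → (ℕ → ℤ) → ℤ
∑ℤ zero    f = 0ℤ
∑ℤ (suc n) f = ∑ℤ n f ℤ.+ f n

∑ℤ-cong : ∀ n {f g : ℕ → ℤ} → (∀ i → f i ≡ g i) → ∑ℤ n f ≡ ∑ℤ n g
∑ℤ-cong zero    e = refl
∑ℤ-cong (suc n) e = cong₂ ℤ._+_ (∑ℤ-cong n e) (e n)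

∑ℤ-mono : ∀ n {f g : ℕ → ℤ} → (∀ i → f i ℤ.≤ g i) → ∑ℤ n f ℤ.≤ ∑ℤ n g
∑ℤ-mono zero    e = ℤ.≤-refl
∑ℤ-mono (suc n) e = ℤ.+-mono-≤ (∑ℤ-mono n e) (e n)

∑ℤ-+ : ∀ n (f g : ℕ → ℤ) → ∑ℤ n (λ i → f i ℤ.+ g i) ≡ ∑ℤ n f ℤ.+ ∑ℤ n g
∑ℤ-+ zero    f g = refl
∑ℤ-+ (suc n) f g = trans (cong (ℤ._+ (f n ℤ.+ g n)) (∑ℤ-+ n f g)) (eq (∑ℤ n f) (∑ℤ n g) (f n) (g n))
  where
  eq : ∀ a b c d → (a ℤ.+ b) ℤ.+ (c ℤ.+ d) ≡ (a ℤ.+ c) ℤ.+ (b ℤ.+ d)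
  eq = ℤ-Solver.solve-∀

∑ℤ-*ˡ : ∀ n c (f : ℕ → ℤ) → ∑ℤ n (λ i → c ℤ.* f i) ≡ c ℤ.* ∑ℤ n f
∑ℤ-*ˡ zero    c f = sym (ℤ.*-zeroʳ c)
∑ℤ-*ˡ (suc n) c f = trans (cong (ℤ._+ c ℤ.* f n) (∑ℤ-*ˡ n c f)) (sym (ℤ.*-distribˡ-+ c (∑ℤ n f) (f n)))

∑ℤ-zero : ∀ n → ∑ℤ n (λ _ → 0ℤ) ≡ 0ℤ
∑ℤ-zero zero    = refl
∑ℤ-zero (suc n) = trans (ℤ.+-identityʳ _) (∑ℤ-zero n)

∑ℤ-swap : ∀ m n (f : ℕ → ℕ → ℤ) → ∑ℤ m (λ i → ∑ℤ n (f i)) ≡ ∑ℤ n (λ j → ∑ℤ m (λ i → f i j))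
∑ℤ-swap zero    n f = sym (∑ℤ-zero n)
∑ℤ-swap (suc m) n f = trans (cong (ℤ._+ ∑ℤ n (f m)) (∑ℤ-swap m n f)) (sym (∑ℤ-+ n (λ j → ∑ℤ m (λ i → f i j)) (f m)))

∑ℤ-split : ∀ m n (f : ℕ → ℤ) → ∑ℤ (m + n) f ≡ ∑ℤ m f ℤ.+ ∑ℤ n (λ i → f (m + i))
∑ℤ-split m zero    f = trans (cong (λ k → ∑ℤ k f) (+-identityʳ m)) (sym (ℤ.+-identityʳ _))
∑ℤ-split m (suc n) f = trans (cong (λ k → ∑ℤ k f) (+-suc m n))
  (trans (cong (ℤ._+ f (m + n)) (∑ℤ-split m n f)) (ℤ.+-assoc (∑ℤ m f) _ _))

∑ℤ-blocks : ∀ m n (f : ℕ → ℤ) → ∑ℤ (m * n) f ≡ ∑ℤ m (λ i → ∑ℤ n (λ j → f (i * n + j)))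
∑ℤ-blocks zero    n f = refl
∑ℤ-blocks (suc m) n f = trans (cong (λ k → ∑ℤ k f) (+-comm n (m * n)))
  (trans (∑ℤ-split (m * n) n f) (cong (ℤ._+ ∑ℤ n (λ j → f (m * n + j))) (∑ℤ-blocks m n f)))

∑ℤ-pos : ∀ n (f : ℕ → ℕ) → ∑ℤ n (λ i → pos (f i)) ≡ pos (∑ n f)
∑ℤ-pos zero    f = refl
∑ℤ-pos (suc n) f = cong (ℤ._+ pos (f n)) (∑ℤ-pos n f)

∣∑ℤ∣≤ : ∀ n {f : ℕ → ℤ} {B} → (∀ i → abs (f i) ≤ B) → abs (∑ℤ n f) ≤ n * B
∣∑ℤ∣≤ zero    h = z≤n
∣∑ℤ∣≤ (suc n) {f} {B} h = begin
  abs (∑ℤ n f ℤ.+ f n)  ≤⟨ ℤ.∣i+j∣≤∣i∣+∣j∣ (∑ℤ n f) (f n) ⟩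
  abs (∑ℤ n f) + abs (f n)  ≤⟨ +-mono-≤ (∣∑ℤ∣≤ n h) (h n) ⟩
  n * B + B  ≡⟨ +-comm (n * B) B ⟩
  suc n * B  ∎

i≤+∣i∣ : ∀ i → i ℤ.≤ pos (abs i)
i≤+∣i∣ (pos n)      = ℤ.≤-refl
i≤+∣i∣ ℤ.-[1+ n ] = ℤ.-≤+

Periodic : ∀ {A : Set} → ℕ → (ℕ → A) → Set
Periodic m f = ∀ n → f (n + m) ≡ f n

periodic-* : ∀ {A : Set} {m} {f : ℕ → A} → Periodic m f → ∀ k n → f (k * m + n) ≡ f n
periodic-* per zero    n = refl
periodic-* {m = m} {f} per (suc k) n = trans (cong f (eq m (k * m) n)) (trans (per (k * m + n)) (periodic-* per k n))
  where
  eq : ∀ m k n → m + k + n ≡ k + n + m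
  eq = solve-∀

periodic-multiple : ∀ {A : Set} {m} {f : ℕ → A} → Periodic m f → ∀ k → Periodic (k * m) f
periodic-multiple {f = f} per k n = trans (cong f (+-comm n _)) (periodic-* per k n)

∑ℤ-periodic : ∀ {m} {f : ℕ → ℤ} → Periodic m f → ∀ k r →
  ∑ℤ (k * m + r) f ≡ pos k ℤ.* ∑ℤ m f ℤ.+ ∑ℤ r f
∑ℤ-periodic {m} {f} per k r = trans (∑ℤ-split (k * m) r f) (cong₂ ℤ._+_
  (trans (∑ℤ-blocks k m f) (trans (∑ℤ-cong k λ i → ∑ℤ-cong m (periodic-* per i)) (const k (∑ℤ m f))))
  (∑ℤ-cong r (periodic-* per k)))
  where
  const : ∀ k c → ∑ℤ k (λ _ → c) ≡ pos k ℤ.* c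
  const zero    c = refl
  const (suc k) c = trans (cong (ℤ._+ c) (const k c)) (trans (ℤ.+-comm (pos k ℤ.* c) c) (sym (ℤ.suc-* (pos k) c)))

-- Group n < p * m by residue modulo m: `f` is constant on each group, and `g` has the same sum on
-- each. In this form the Chinese remainder theorem enters the sieve.
∑ℤ-product : ∀ {m p} {f g : ℕ → ℤ} {c} → Periodic m f → (∀ j → ∑ℤ p (λ i → g (i * m + j)) ≡ c) →
  ∑ℤ (p * m) (λ n → f n ℤ.* g n) ≡ ∑ℤ m f ℤ.* c
∑ℤ-product {m} {p} {f} {g} {c} per h =
  trans (∑ℤ-blocks p m _)
  (trans (∑ℤ-swap p m _)
  (trans (∑ℤ-cong m λ j → trans (∑ℤ-cong p λ i → cong (ℤ._* g (i * m + j)) (periodic-* per i j))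
                          (trans (∑ℤ-*ˡ p (f j) _) (trans (cong (f j ℤ.*_) (h j)) (ℤ.*-comm (f j) c))))
  (trans (∑ℤ-*ˡ m c f) (ℤ.*-comm c _))))

coprime-* : ∀ {a b c} → Coprime a c → Coprime b c → Coprime (a * b) c
coprime-* {a} {b} {c} ac bc {d} (d∣ab , d∣c) = bc (coprime-divisor (λ (e∣d , e∣a) → ac (e∣a , ∣-trans e∣d d∣c)) d∣ab , d∣c)

infixl 7 _÷_
-- The value 0 at divisor 0 keeps `*-÷-≤` true and spares recursions over lists any evidence that
-- the entries are nonzero.
_÷_ : ℕ → ℕ → ℕ
D ÷ zero    = zero
D ÷ (suc p) = D / suc p

*-÷-≤ : ∀ p D → p * (D ÷ p) ≤ D
*-÷-≤ zero    D = z≤n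
*-÷-≤ (suc p) D = ≤-trans (≤-reflexive (*-comm (suc p) (D / suc p))) (m/n*n≤m D (suc p))

-- G w ps D is product ps times the sum, over the squarefree d ≤ D with all prime factors in ps,
-- of ∏_{p ∣ d} w p / p.
G : (ℕ → ℕ) → List ℕ → ℕ → ℕ
G w []       zero    = 0
G w []       (suc D) = 1
G w (p ∷ ps) D       = p * G w ps D + w p * G w ps (D ÷ p)

-- `δ` is the indicator of `w` residue classes modulo `p`, those to be sieved out. Its mean is
-- prescribed along every step `m` prime to p, because the sieve meets it on progressions whose step
-- is a product of other primes. Beyond `δ≤1`, the field `δ≤w` says that δ vanishes when w = 0; this
-- gives the bound p * w for ∣ψ∣.
record Local (p w : ℕ) (δ : ℕ → ℕ) : Set where
  field
    δ-periodic : Periodic p δ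
    δ≤1        : ∀ n → δ n ≤ 1
    δ≤w        : ∀ n → δ n ≤ w
    δ-mean     : ∀ m → Coprime m p → ∀ j → ∑ p (λ i → δ (i * m + j)) ≡ w

module LocalFunction {p w δ} (p≥1 : 1 ≤ p) (L : Local p w δ) where
  open Local L

  -- The indicator recentred to mean zero and scaled by -p. Its negative values are the reason for
  -- sums over ℤ.
  ψ : ℕ → ℤ
  ψ n = pos w ℤ.- pos p ℤ.* pos (δ n)

  ψ-periodic : Periodic p ψ
  ψ-periodic n = cong (λ z → pos w ℤ.- pos p ℤ.* pos z) (δ-periodic n)

  w≤p : w ≤ p
  w≤p = ≤-trans (≤-reflexive (sym (δ-mean 1 (λ (d∣1 , _) → ∣1⇒≡1 d∣1) 0)))
          (≤-trans (∑-≤const p 1 λ i _ → δ≤1 _) (≤-reflexive (*-identityʳ p)))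

  ∣ψ∣≤ : ∀ n → abs (ψ n) ≤ p * w
  ∣ψ∣≤ n with δ n | δ≤1 n | δ≤w n
  ... | zero  | _ | _   = begin
    abs (pos w ℤ.- pos p ℤ.* 0ℤ)  ≡⟨ cong abs (trans (cong (λ z → pos w ℤ.- z) (ℤ.*-zeroʳ (pos p))) (ℤ.+-identityʳ (pos w))) ⟩
    w  ≤⟨ ≤-trans (≤-reflexive (sym (*-identityˡ w))) (*-monoˡ-≤ w p≥1) ⟩
    p * w  ∎
  ... | suc zero | _ | 1≤w = begin
    abs (pos w ℤ.- pos p ℤ.* 1ℤ)  ≡⟨ cong (λ z → abs (pos w ℤ.- z)) (ℤ.*-identityʳ (pos p)) ⟩
    abs (pos w ℤ.- pos p)  ≡⟨ cong abs (ℤ.m-n≡m⊖n w p) ⟩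
    abs (w ℤ.⊖ p)  ≤⟨ ℤ.∣m⊝n∣≤m⊔n w p ⟩
    w ⊔ p  ≡⟨ m≤n⇒m⊔n≡n w≤p ⟩
    p  ≤⟨ ≤-trans (≤-reflexive (sym (*-identityʳ p))) (*-monoʳ-≤ p 1≤w) ⟩
    p * w  ∎
  ... | suc (suc _) | s≤s () | _

  ψ-mean : ∀ m → Coprime m p → ∀ j → ∑ℤ p (λ i → ψ (i * m + j)) ≡ 0ℤ
  ψ-mean m cop j =
    trans (∑ℤ-cong p λ i → eq (pos w) (pos p) (pos (δ (i * m + j))))
    (trans (∑ℤ-+ p (λ _ → pos w) (λ i → ℤ.- (pos p) ℤ.* pos (δ (i * m + j))))
    (trans (cong₂ ℤ._+_
      (trans (∑ℤ-pos p (λ _ → w)) (trans (cong pos (∑-const p w)) (ℤ.pos-* p w)))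
      (trans (∑ℤ-*ˡ p (ℤ.- (pos p)) _) (cong (ℤ.- (pos p) ℤ.*_) (trans (∑ℤ-pos p _) (cong pos (δ-mean m cop j))))))
    (eq₂ (pos p) (pos w))))
    where
    eq : ∀ w p d → w ℤ.- p ℤ.* d ≡ w ℤ.+ (ℤ.- p) ℤ.* d
    eq = ℤ-Solver.solve-∀
    eq₂ : ∀ p w → p ℤ.* w ℤ.+ (ℤ.- p) ℤ.* w ≡ 0ℤ
    eq₂ = ℤ-Solver.solve-∀

  -- As δ is 0 or 1, ψ² = wψ + p(p - w)δ, and the first term has mean zero.
  ψ-square : ∀ m → Coprime m p → ∀ j → ∑ℤ p (λ i → ψ (i * m + j) ℤ.* ψ (i * m + j)) ≡ pos (p * (w * (p ∸ w)))
  ψ-square m cop j =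
    trans (∑ℤ-cong p λ i → pointwise (i * m + j))
    (trans (∑ℤ-+ p (λ i → pos w ℤ.* ψ (i * m + j)) (λ i → pos p ℤ.* pos (p ∸ w) ℤ.* pos (δ (i * m + j))))
    (trans (cong₂ ℤ._+_ (trans (∑ℤ-*ˡ p (pos w) _) (trans (cong (pos w ℤ.*_) (ψ-mean m cop j)) (ℤ.*-zeroʳ (pos w))))
                        (trans (∑ℤ-*ˡ p (pos p ℤ.* pos (p ∸ w)) _)
                          (cong (pos p ℤ.* pos (p ∸ w) ℤ.*_) (trans (∑ℤ-pos p _) (cong pos (δ-mean m cop j))))))
    (trans (ℤ.+-identityˡ _) (trans (cong (ℤ._* pos w) (sym (ℤ.pos-* p (p ∸ w))))
      (trans (sym (ℤ.pos-* (p * (p ∸ w)) w)) (cong pos (eq p (p ∸ w) w)))))))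
    where
    eq : ∀ p u w → p * u * w ≡ p * (w * u)
    eq = solve-∀
    p-w : pos (p ∸ w) ≡ pos p ℤ.- pos w
    p-w = trans (sym (ℤ.⊖-≥ w≤p)) (sym (ℤ.m-n≡m⊖n p w))
    01-valued : ∀ (p w : ℤ) d → d ≤ 1 → (w ℤ.- p ℤ.* pos d) ℤ.* (w ℤ.- p ℤ.* pos d)
      ≡ w ℤ.* (w ℤ.- p ℤ.* pos d) ℤ.+ p ℤ.* (p ℤ.- w) ℤ.* pos d
    01-valued p w zero          _ = e₀ p w
      where
      e₀ : ∀ p w → (w ℤ.- p ℤ.* 0ℤ) ℤ.* (w ℤ.- p ℤ.* 0ℤ) ≡ w ℤ.* (w ℤ.- p ℤ.* 0ℤ) ℤ.+ p ℤ.* (p ℤ.- w) ℤ.* 0ℤ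
      e₀ = ℤ-Solver.solve-∀
    01-valued p w (suc zero)    _ = e₁ p w
      where
      e₁ : ∀ p w → (w ℤ.- p ℤ.* 1ℤ) ℤ.* (w ℤ.- p ℤ.* 1ℤ) ≡ w ℤ.* (w ℤ.- p ℤ.* 1ℤ) ℤ.+ p ℤ.* (p ℤ.- w) ℤ.* 1ℤ
      e₁ = ℤ-Solver.solve-∀
    01-valued p w (suc (suc _)) (s≤s ())
    pointwise : ∀ n → ψ n ℤ.* ψ n ≡ pos w ℤ.* ψ n ℤ.+ pos p ℤ.* pos (p ∸ w) ℤ.* pos (δ n)
    pointwise n = trans (01-valued (pos p) (pos w) (δ n) (δ≤1 n))
      (cong (λ z → pos w ℤ.* ψ n ℤ.+ pos p ℤ.* z ℤ.* pos (δ n)) (sym p-w))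

∑ℤ-partial : ∀ {m} {f : ℕ → ℤ} {B} → 1 ≤ m → Periodic m f → (∀ n → abs (f n) ≤ B) → ∀ N →
  Σ ℕ λ k → Σ ℤ λ e → k * m ≤ N × abs e ≤ m * B × ∑ℤ N f ≡ pos k ℤ.* ∑ℤ m f ℤ.+ e
∑ℤ-partial {m@(suc _)} {f} {B} _ per bd N = N / m , ∑ℤ (N % m) f , m/n*n≤m N m ,
  ≤-trans (∣∑ℤ∣≤ (N % m) bd) (*-monoˡ-≤ B (m%n≤n N m)) ,
  trans (cong (λ z → ∑ℤ z f) (trans (m≡m%n+[m/n]*n N m) (+-comm (N % m) _))) (∑ℤ-periodic per (N / m) (N % m))

All-coprime-* : ∀ {a b qs} → All (Coprime a) qs → All (Coprime b) qs → All (Coprime (a * b)) qs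
All-coprime-* []                 []       = []
All-coprime-* {a} {b} {q ∷ qs} (x ∷ xs) (y ∷ ys) = coprime-* {a} {b} {q} x y ∷ All-coprime-* xs ys

module Sieve (w : ℕ → ℕ) (δ : ℕ → ℕ → ℕ) where

  ψ : ℕ → ℕ → ℤ
  ψ p n = pos (w p) ℤ.- pos p ℤ.* pos (δ p n)

  -- `product ps` times the sum of ∏_{p ∣ d} ψ p n / p over the squarefree d ≤ D composed of primes
  -- in ps: the recursion of `G` with ψ p n in place of w p. The two agree where no δ p is 1.
  F : List ℕ → ℕ → ℕ → ℤ
  F []       zero    n = 0ℤ
  F []       (suc D) n = 1ℤ
  F (p ∷ ps) D       n = pos p ℤ.* F ps D n ℤ.+ ψ p n ℤ.* F ps (D ÷ p) n

  -- The error budget. Each prime of d multiplies the period by p and the sup norm by p * w p,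
  -- whence the coefficient p * p * w p.
  σ : List ℕ → ℕ → ℕ
  σ []       zero    = 0
  σ []       (suc D) = 1
  σ (p ∷ ps) D       = p * σ ps D + p * p * w p * σ ps (D ÷ p)

  Admissible : ℕ → Set
  Admissible p = 1 ≤ p × Local p (w p) (δ p)

  X : ℕ → (ℕ → ℤ) → List ℕ → ℕ → ℕ → ℤ
  X N f ps D E = ∑ℤ N (λ n → f n ℤ.* (F ps D n ℤ.* F ps E n))

  X-step : ∀ N f p ps D E → X N f (p ∷ ps) D E ≡
    pos (p * p) ℤ.* X N f ps D E
    ℤ.+ pos p ℤ.* X N (λ n → f n ℤ.* ψ p n) ps D (E ÷ p)
    ℤ.+ pos p ℤ.* X N (λ n → f n ℤ.* ψ p n) ps (D ÷ p) E
    ℤ.+ X N (λ n → f n ℤ.* (ψ p n ℤ.* ψ p n)) ps (D ÷ p) (E ÷ p)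
  X-step N f p ps D E =
    trans (∑ℤ-cong N λ n → trans (eq (pos p) (f n) (ψ p n) (F ps D n) (F ps (D ÷ p) n) (F ps E n) (F ps (E ÷ p) n))
            (cong (λ z → z ℤ.* t₁ n ℤ.+ pos p ℤ.* t₂ n ℤ.+ pos p ℤ.* t₃ n ℤ.+ t₄ n) (sym (ℤ.pos-* p p))))
    (trans (∑ℤ-+ N _ t₄) (cong (ℤ._+ ∑ℤ N t₄)
    (trans (∑ℤ-+ N _ (λ n → pos p ℤ.* t₃ n)) (cong₂ ℤ._+_
    (trans (∑ℤ-+ N (λ n → pos (p * p) ℤ.* t₁ n) (λ n → pos p ℤ.* t₂ n))
       (cong₂ ℤ._+_ (∑ℤ-*ˡ N (pos (p * p)) t₁) (∑ℤ-*ˡ N (pos p) t₂)))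
    (∑ℤ-*ˡ N (pos p) t₃)))))
    where
    t₁ t₂ t₃ t₄ : ℕ → ℤ
    t₁ n = f n ℤ.* (F ps D n ℤ.* F ps E n)
    t₂ n = (f n ℤ.* ψ p n) ℤ.* (F ps D n ℤ.* F ps (E ÷ p) n)
    t₃ n = (f n ℤ.* ψ p n) ℤ.* (F ps (D ÷ p) n ℤ.* F ps E n)
    t₄ n = (f n ℤ.* (ψ p n ℤ.* ψ p n)) ℤ.* (F ps (D ÷ p) n ℤ.* F ps (E ÷ p) n)
    eq : ∀ p f s a a′ b b′ → f ℤ.* ((p ℤ.* a ℤ.+ s ℤ.* a′) ℤ.* (p ℤ.* b ℤ.+ s ℤ.* b′)) ≡
      (p ℤ.* p) ℤ.* (f ℤ.* (a ℤ.* b)) ℤ.+ p ℤ.* ((f ℤ.* s) ℤ.* (a ℤ.* b′))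
      ℤ.+ p ℤ.* ((f ℤ.* s) ℤ.* (a′ ℤ.* b)) ℤ.+ (f ℤ.* (s ℤ.* s)) ℤ.* (a′ ℤ.* b′)
    eq = ℤ-Solver.solve-∀

  -- The invariant of the recursion: `f` collects the factors ψ and ψ² of the primes already removed
  -- from the list, so its period stays coprime to the remaining ones.
  record Test (m B : ℕ) (ps : List ℕ) (f : ℕ → ℤ) : Set where
    constructor test
    field
      m≥1      : 1 ≤ m
      periodic : Periodic m f
      bounded  : ∀ n → abs (f n) ≤ B
      coprime  : All (Coprime m) ps

  Test-tail : ∀ {m B p ps f} → Test m B (p ∷ ps) f → Test m B ps f
  Test-tail (test m≥1 per bd (_ ∷ cop)) = test m≥1 per bd cop

  module _ {p m B ps f} (adm : Admissible p) (p-coprime : All (Coprime p) ps) (T : Test m B (p ∷ ps) f) where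
    open Test T
    open LocalFunction (proj₁ adm) (proj₂ adm) using (ψ-periodic; ψ-mean; ψ-square; ∣ψ∣≤; w≤p)

    private
      m⊥p : Coprime m p
      m⊥p = All.head coprime

      pm-coprime : All (Coprime (p * m)) ps
      pm-coprime = All-coprime-* p-coprime (All.tail coprime)

      pm≥1 : 1 ≤ p * m
      pm≥1 = *-mono-≤ (proj₁ adm) m≥1

      f-periodic : Periodic (p * m) f
      f-periodic = periodic-multiple periodic p

      ψ-per : Periodic (p * m) (ψ p)
      ψ-per = subst (λ z → Periodic z (ψ p)) (*-comm m p) (periodic-multiple ψ-periodic m)

    Test-ψ : Test (p * m) (B * (p * w p)) ps (λ n → f n ℤ.* ψ p n)
    Test-ψ = test pm≥1 (λ n → cong₂ ℤ._*_ (f-periodic n) (ψ-per n))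
      (λ n → ≤-trans (≤-reflexive (ℤ.abs-* (f n) (ψ p n))) (*-mono-≤ (bounded n) (∣ψ∣≤ n))) pm-coprime

    Test-ψψ : Test (p * m) (B * ((p * w p) * (p * w p))) ps (λ n → f n ℤ.* (ψ p n ℤ.* ψ p n))
    Test-ψψ = test pm≥1 (λ n → cong₂ ℤ._*_ (f-periodic n) (cong₂ ℤ._*_ (ψ-per n) (ψ-per n)))
      (λ n → ≤-trans (≤-reflexive (trans (ℤ.abs-* (f n) (ψ p n ℤ.* ψ p n)) (cong (abs (f n) *_) (ℤ.abs-* (ψ p n) (ψ p n)))))
               (*-mono-≤ (bounded n) (*-mono-≤ (∣ψ∣≤ n) (∣ψ∣≤ n)))) pm-coprime

    mean-ψ : ∑ℤ (p * m) (λ n → f n ℤ.* ψ p n) ≡ 0ℤ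
    mean-ψ = trans (∑ℤ-product {p = p} periodic (ψ-mean m m⊥p)) (ℤ.*-zeroʳ (∑ℤ m f))

    mean-ψψ : ∑ℤ (p * m) (λ n → f n ℤ.* (ψ p n ℤ.* ψ p n)) ≡ ∑ℤ m f ℤ.* pos (p * (w p * (p ∸ w p)))
    mean-ψψ = ∑ℤ-product {p = p} periodic (ψ-square m m⊥p)

  -- Mean zero is inherited: a factor ψ or ψ² of a new prime multiplies the mean by a constant. So
  -- nothing but incomplete periods is left at the end of the recursion, at most `m * B` for each
  -- pair of divisors.
  mean-zero-bound : ∀ {ps} → AllPairs Coprime ps → All Admissible ps → ∀ {m B f} N D E →
    Test m B ps f → ∑ℤ m f ≡ 0ℤ → abs (X N f ps D E) ≤ m * B * (σ ps D * σ ps E)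
  mean-zero-bound {[]} [] [] {m} {B} {f} N D E T mean with ∑ℤ-partial (Test.m≥1 T) (Test.periodic T) (Test.bounded T) N
  ... | k , e , _ , e≤ , eq = base D E
    where
    ∑f : ∑ℤ N f ≡ e
    ∑f = trans eq (trans (cong (λ z → pos k ℤ.* z ℤ.+ e) mean) (trans (cong (ℤ._+ e) (ℤ.*-zeroʳ (pos k))) (ℤ.+-identityˡ e)))
    vanish : ∀ (g : ℕ → ℤ) → (∀ n → g n ≡ 0ℤ) → abs (∑ℤ N g) ≤ 0
    vanish g g≡0 = ≤-reflexive (cong abs (trans (∑ℤ-cong N g≡0) (∑ℤ-zero N)))
    base : ∀ D E → abs (X N f [] D E) ≤ m * B * (σ [] D * σ [] E)
    base zero    E       = ≤-trans (vanish _ λ n → trans (cong (f n ℤ.*_) (ℤ.*-zeroˡ (F [] E n))) (ℤ.*-zeroʳ (f n))) z≤n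
    base (suc D) zero    = ≤-trans (vanish _ λ n → ℤ.*-zeroʳ (f n)) z≤n
    base (suc D) (suc E) = begin
      abs (X N f [] (suc D) (suc E))  ≡⟨ cong abs (∑ℤ-cong N λ n → ℤ.*-identityʳ (f n)) ⟩
      abs (∑ℤ N f)  ≡⟨ cong abs ∑f ⟩
      abs e  ≤⟨ e≤ ⟩
      m * B  ≡⟨ *-identityʳ (m * B) ⟨
      m * B * 1  ∎
  mean-zero-bound {p ∷ ps} (p⊥ps ∷ cop) (adm ∷ adms) {m} {B} {f} N D E T mean = begin
    abs (X N f (p ∷ ps) D E)
      ≡⟨ cong abs (X-step N f p ps D E) ⟩
    abs (pos (p * p) ℤ.* x₁ ℤ.+ pos p ℤ.* x₂ ℤ.+ pos p ℤ.* x₃ ℤ.+ x₄)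
      ≤⟨ triangle (pos (p * p) ℤ.* x₁) (pos p ℤ.* x₂) (pos p ℤ.* x₃) x₄ ⟩
    abs (pos (p * p) ℤ.* x₁) + abs (pos p ℤ.* x₂) + abs (pos p ℤ.* x₃) + abs x₄
      ≡⟨ cong (_+ abs x₄) (cong₂ _+_ (cong₂ _+_ (ℤ.abs-* (pos (p * p)) x₁) (ℤ.abs-* (pos p) x₂)) (ℤ.abs-* (pos p) x₃)) ⟩
    p * p * abs x₁ + p * abs x₂ + p * abs x₃ + abs x₄
      ≤⟨ +-mono-≤ (+-mono-≤ (+-mono-≤ (*-monoʳ-≤ (p * p) (mean-zero-bound cop adms N D E (Test-tail T) mean))
           (*-monoʳ-≤ p (mean-zero-bound cop adms N D (E ÷ p) (Test-ψ adm p⊥ps T) (mean-ψ adm p⊥ps T))))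
           (*-monoʳ-≤ p (mean-zero-bound cop adms N (D ÷ p) E (Test-ψ adm p⊥ps T) (mean-ψ adm p⊥ps T))))
           -- The term in ψ² carries p³ w², where the product of the two σ offers p⁴ w²; one factor
           -- p is given away.
           (≤-trans (mean-zero-bound cop adms N (D ÷ p) (E ÷ p) (Test-ψψ adm p⊥ps T)
                (trans (mean-ψψ adm p⊥ps T) (cong (ℤ._* pos (p * (w p * (p ∸ w p)))) mean)))
              (enlarge (proj₁ adm) _)) ⟩
    p * p * (m * B * (a * b)) + p * (p * m * (B * (p * w p)) * (a * b′)) + p * (p * m * (B * (p * w p)) * (a′ * b))
      + p * (p * m * (B * (p * w p * (p * w p))) * (a′ * b′))
      ≡⟨ eq p m B (w p) a a′ b b′ ⟩
    m * B * (σ (p ∷ ps) D * σ (p ∷ ps) E) ∎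
    where
    x₁ = X N f ps D E
    x₂ = X N (λ n → f n ℤ.* ψ p n) ps D (E ÷ p)
    x₃ = X N (λ n → f n ℤ.* ψ p n) ps (D ÷ p) E
    x₄ = X N (λ n → f n ℤ.* (ψ p n ℤ.* ψ p n)) ps (D ÷ p) (E ÷ p)
    a = σ ps D
    a′ = σ ps (D ÷ p)
    b = σ ps E
    b′ = σ ps (E ÷ p)
    triangle : ∀ x y z u → abs (x ℤ.+ y ℤ.+ z ℤ.+ u) ≤ abs x + abs y + abs z + abs u
    triangle x y z u = ≤-trans (ℤ.∣i+j∣≤∣i∣+∣j∣ (x ℤ.+ y ℤ.+ z) u) (+-monoˡ-≤ (abs u)
      (≤-trans (ℤ.∣i+j∣≤∣i∣+∣j∣ (x ℤ.+ y) z) (+-monoˡ-≤ (abs z) (ℤ.∣i+j∣≤∣i∣+∣j∣ x y))))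
    enlarge : ∀ {p} → 1 ≤ p → ∀ x → x ≤ p * x
    enlarge p≥1 x = ≤-trans (≤-reflexive (sym (*-identityˡ x))) (*-monoˡ-≤ x p≥1)
    eq : ∀ p m B w a a′ b b′ →
      p * p * (m * B * (a * b)) + p * (p * m * (B * (p * w)) * (a * b′)) + p * (p * m * (B * (p * w)) * (a′ * b))
        + p * (p * m * (B * (p * w * (p * w))) * (a′ * b′))
      ≡ m * B * ((p * a + p * p * w * a′) * (p * b + p * p * w * b′))
    eq = solve-∀

  -- Orthogonality: the cross terms of `X-step` have mean zero and go to `mean-zero-bound`; only the
  -- terms in ψ⁰ and ψ² feed the main term. Replacing p - w by p in the latter gives exactly the
  -- recursion of `product ps * G w ps D`. The factor `m` on the left is there because μ bounds the
  -- sum of f over a period, not its mean.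
  square-bound : ∀ {ps} → AllPairs Coprime ps → All Admissible ps → ∀ {m B f μ} N D →
    Test m B ps f → ∑ℤ m f ℤ.≤ pos μ →
    pos m ℤ.* X N f ps D D ℤ.≤ pos (N * μ * (product ps * G w ps D) + m * m * B * (σ ps D * σ ps D))
  square-bound {[]} [] [] {m} {B} {f} {μ} N zero T mean =
    ℤ.≤-trans (ℤ.≤-reflexive (trans (cong (pos m ℤ.*_) (trans (∑ℤ-cong N λ n → ℤ.*-zeroʳ (f n)) (∑ℤ-zero N))) (ℤ.*-zeroʳ (pos m))))
      (ℤ.+≤+ z≤n)
  square-bound {[]} [] [] {m} {B} {f} {μ} N (suc D) T mean with ∑ℤ-partial (Test.m≥1 T) (Test.periodic T) (Test.bounded T) N
  ... | k , e , km≤N , e≤ , eq = ℤ.≤-trans (ℤ.≤-reflexive (cong (pos m ℤ.*_) (trans (∑ℤ-cong N λ n → ℤ.*-identityʳ (f n)) eq)))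
    (ℤ.≤-trans (ℤ.*-monoˡ-≤-nonNeg (pos m) (ℤ.+-mono-≤ (ℤ.*-monoˡ-≤-nonNeg (pos k) mean) (ℤ.≤-trans (i≤+∣i∣ e) (ℤ.+≤+ e≤))))
    (ℤ.≤-trans (ℤ.≤-reflexive (trans (cong (λ z → pos m ℤ.* (z ℤ.+ pos (m * B))) (sym (ℤ.pos-* k μ))) (sym (ℤ.pos-* m (k * μ + m * B)))))
    (ℤ.+≤+ (begin
      m * (k * μ + m * B)  ≡⟨ lemma m k μ B ⟩
      k * m * μ + m * m * B  ≤⟨ +-monoˡ-≤ _ (*-monoˡ-≤ μ km≤N) ⟩
      N * μ + m * m * B  ≡⟨ cong₂ _+_ (*-identityʳ (N * μ)) (*-identityʳ (m * m * B)) ⟨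
      N * μ * 1 + m * m * B * 1  ∎))))
    where
    lemma : ∀ m k μ B → m * (k * μ + m * B) ≡ k * m * μ + m * m * B
    lemma = solve-∀
  square-bound {p ∷ ps} (p⊥ps ∷ cop) (adm ∷ adms) {m} {B} {f} {μ} N D T mean =
    ℤ.≤-trans (ℤ.≤-reflexive (trans (cong (pos m ℤ.*_) (X-step N f p ps D D)) (distribute (pos m) (pos (p * p)) (pos p) x₁ x₂ x₃ x₄)))
    (ℤ.≤-trans (ℤ.+-mono-≤ (ℤ.+-mono-≤ (ℤ.+-mono-≤
        (ℤ.*-monoˡ-≤-nonNeg (pos (p * p)) (square-bound cop adms N D (Test-tail T) mean))
        (ℤ.*-monoˡ-≤-nonNeg (pos p) (cross x₂ (mean-zero-bound cop adms N D (D ÷ p) (Test-ψ adm p⊥ps T) (mean-ψ adm p⊥ps T)))))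
        (ℤ.*-monoˡ-≤-nonNeg (pos p) (cross x₃ (mean-zero-bound cop adms N (D ÷ p) D (Test-ψ adm p⊥ps T) (mean-ψ adm p⊥ps T)))))
        diagonal)
    (ℤ.≤-trans (ℤ.≤-reflexive (trans
        (cong (ℤ._+ pos A₄) (cong₂ ℤ._+_ (cong₂ ℤ._+_ (sym (ℤ.pos-* (p * p) A₁)) (sym (ℤ.pos-* p (m * Z₂)))) (sym (ℤ.pos-* p (m * Z₃)))))
        refl))
    (ℤ.+≤+ (begin
      p * p * A₁ + p * (m * Z₂) + p * (m * Z₃) + A₄
        ≤⟨ +-monoʳ-≤ (p * p * A₁ + p * (m * Z₂) + p * (m * Z₃)) (+-mono-≤
             (*-monoˡ-≤ (product ps * G w ps (D ÷ p)) (*-monoʳ-≤ N (*-monoˡ-≤ μ (*-monoʳ-≤ (w p) (m∸n≤m p (w p))))))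
             (enlarge (proj₁ adm) (m * (p * m) * (B * (p * w p * (p * w p))) * (a′ * a′)))) ⟩
      p * p * A₁ + p * (m * Z₂) + p * (m * Z₃)
        + (N * (w p * p * μ) * (product ps * G w ps (D ÷ p)) + p * (m * (p * m) * (B * (p * w p * (p * w p))) * (a′ * a′)))
        ≡⟨ eq p m B (w p) a a′ N μ (product ps) (G w ps D) (G w ps (D ÷ p)) ⟩
      N * μ * (product (p ∷ ps) * G w (p ∷ ps) D) + m * m * B * (σ (p ∷ ps) D * σ (p ∷ ps) D) ∎))))
    where
    x₁ = X N f ps D D
    x₂ = X N (λ n → f n ℤ.* ψ p n) ps D (D ÷ p)
    x₃ = X N (λ n → f n ℤ.* ψ p n) ps (D ÷ p) D
    x₄ = X N (λ n → f n ℤ.* (ψ p n ℤ.* ψ p n)) ps (D ÷ p) (D ÷ p)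
    a = σ ps D
    a′ = σ ps (D ÷ p)
    A₁ = N * μ * (product ps * G w ps D) + m * m * B * (a * a)
    Z₂ = p * m * (B * (p * w p)) * (a * a′)
    Z₃ = p * m * (B * (p * w p)) * (a′ * a)
    A₄ = N * (w p * (p ∸ w p) * μ) * (product ps * G w ps (D ÷ p)) + m * (p * m) * (B * (p * w p * (p * w p))) * (a′ * a′)
    distribute : ∀ m q p x y z u → m ℤ.* (q ℤ.* x ℤ.+ p ℤ.* y ℤ.+ p ℤ.* z ℤ.+ u)
      ≡ q ℤ.* (m ℤ.* x) ℤ.+ p ℤ.* (m ℤ.* y) ℤ.+ p ℤ.* (m ℤ.* z) ℤ.+ m ℤ.* u
    distribute = ℤ-Solver.solve-∀
    cross : ∀ x {Z} → abs x ≤ Z → pos m ℤ.* x ℤ.≤ pos (m * Z)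
    cross x {Z} h = ℤ.≤-trans (ℤ.*-monoˡ-≤-nonNeg (pos m) (ℤ.≤-trans (i≤+∣i∣ x) (ℤ.+≤+ h))) (ℤ.≤-reflexive (sym (ℤ.pos-* m Z)))
    enlarge : ∀ {p} → 1 ≤ p → ∀ x → x ≤ p * x
    enlarge p≥1 x = ≤-trans (≤-reflexive (sym (*-identityˡ x))) (*-monoˡ-≤ x p≥1)
    mean′ : ∑ℤ (p * m) (λ n → f n ℤ.* (ψ p n ℤ.* ψ p n)) ℤ.≤ pos (μ * (p * (w p * (p ∸ w p))))
    mean′ = ℤ.≤-trans (ℤ.≤-reflexive (mean-ψψ adm p⊥ps T))
      (ℤ.≤-trans (ℤ.*-monoʳ-≤-nonNeg (pos (p * (w p * (p ∸ w p)))) mean) (ℤ.≤-reflexive (sym (ℤ.pos-* μ _))))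
    diagonal : pos m ℤ.* x₄ ℤ.≤ pos A₄
    diagonal = ℤ.*-cancelˡ-≤-pos (pos m ℤ.* x₄) (pos A₄) (pos p) {{ℤ.positive (ℤ.+<+ (proj₁ adm))}}
      (ℤ.≤-trans (ℤ.≤-reflexive (trans (sym (ℤ.*-assoc (pos p) (pos m) x₄)) (cong (ℤ._* x₄) (sym (ℤ.pos-* p m)))))
      (ℤ.≤-trans (square-bound cop adms N (D ÷ p) (Test-ψψ adm p⊥ps T) mean′)
      (ℤ.≤-reflexive (trans (cong pos (factor p m N (w p) (p ∸ w p) μ (product ps * G w ps (D ÷ p)) (B * (p * w p * (p * w p))) (a′ * a′)))
        (ℤ.pos-* p A₄)))))
      where
      factor : ∀ p m N w u μ g b s → N * (μ * (p * (w * u))) * g + p * m * (p * m) * b * s ≡ p * (N * (w * u * μ) * g + m * (p * m) * b * s)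
      factor = solve-∀
    eq : ∀ p m B w a a′ N μ Q g g′ →
      p * p * (N * μ * (Q * g) + m * m * B * (a * a)) + p * (m * (p * m * (B * (p * w)) * (a * a′))) + p * (m * (p * m * (B * (p * w)) * (a′ * a)))
        + (N * (w * p * μ) * (Q * g′) + p * (m * (p * m) * (B * (p * w * (p * w))) * (a′ * a′)))
      ≡ N * μ * ((p * Q) * (p * g + w * g′)) + m * m * B * ((p * a + p * p * w * a′) * (p * a + p * p * w * a′))
    eq = solve-∀

  -- The term of d in `σ` is d² times its term in `G`, and d ≤ D.
  σ≤D²G : ∀ ps D → σ ps D ≤ D * D * G w ps D
  σ≤D²G []       zero    = z≤n
  σ≤D²G []       (suc D) = s≤s z≤n
  σ≤D²G (p ∷ ps) D       = begin
    p * σ ps D + p * p * w p * σ ps D′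
      ≤⟨ +-mono-≤ (*-monoʳ-≤ p (σ≤D²G ps D)) (*-monoʳ-≤ (p * p * w p) (σ≤D²G ps D′)) ⟩
    p * (D * D * g) + p * p * w p * (D′ * D′ * g′)
      ≡⟨ eq₁ p D D′ g g′ (w p) ⟩
    D * D * (p * g) + (p * D′) * (p * D′) * (w p * g′)
      ≤⟨ +-monoʳ-≤ (D * D * (p * g)) (*-monoˡ-≤ (w p * g′) (*-mono-≤ (*-÷-≤ p D) (*-÷-≤ p D))) ⟩
    D * D * (p * g) + D * D * (w p * g′)
      ≡⟨ *-distribˡ-+ (D * D) (p * g) (w p * g′) ⟨
    D * D * G w (p ∷ ps) D ∎
    where
    D′ = D ÷ p
    g = G w ps D
    g′ = G w ps D′
    eq₁ : ∀ p D D′ g g′ w → p * (D * D * g) + p * p * w * (D′ * D′ * g′) ≡ D * D * (p * g) + (p * D′) * (p * D′) * (w * g′)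
    eq₁ = solve-∀

  G-pos : ∀ {ps} → All Admissible ps → ∀ {D} → 1 ≤ D → 1 ≤ G w ps D
  G-pos []                           (s≤s z≤n) = ≤-refl
  G-pos {p ∷ ps} ((p≥1 , _) ∷ adms) D≥1       = ≤-trans (*-mono-≤ p≥1 (G-pos adms D≥1)) (m≤m+n _ _)

  F-unsifted : ∀ {ps} D {t} → All (λ p → δ p t ≡ 0) ps → F ps D t ≡ pos (G w ps D)
  F-unsifted zero    [] = refl
  F-unsifted (suc D) [] = refl
  F-unsifted {p ∷ ps} D {t} (δ≡0 ∷ zs) = trans
    (cong₂ ℤ._+_ (cong (pos p ℤ.*_) (F-unsifted D zs)) (cong₂ ℤ._*_ ψ≡w (F-unsifted (D ÷ p) zs)))
    (cong₂ ℤ._+_ (sym (ℤ.pos-* p (G w ps D))) (sym (ℤ.pos-* (w p) (G w ps (D ÷ p)))))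
    where
    ψ≡w : ψ p t ≡ pos (w p)
    ψ≡w = trans (cong (λ z → pos (w p) ℤ.- pos p ℤ.* pos z) δ≡0)
      (trans (cong (λ z → pos (w p) ℤ.- z) (ℤ.*-zeroʳ (pos p))) (ℤ.+-identityʳ (pos (w p))))

  -- Bessel's inequality for the nearly orthogonal functions ∏_{p ∣ d} ψ p: the combination F of them
  -- is constantly G on the unsifted set, while its mean square is about product ps * G.
  sieve-bound : ∀ {ps} → AllPairs Coprime ps → All Admissible ps → ∀ N {D} → 1 ≤ D →
    {P : ℕ → Set} (P? : ∀ t → Dec (P t)) → (∀ t → P t → All (λ p → δ p t ≡ 0) ps) →
    ∑ N (λ t → ⟦ P? t ⟧) * G w ps D ≤ N * product ps + D * D * (D * D) * G w ps D
  sieve-bound {ps} cop adms N {D} D≥1 P? unsifted = *-cancelʳ-≤ _ _ g {{>-nonZero (G-pos adms D≥1)}} (begin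
    ∑ N (λ t → ⟦ P? t ⟧) * g * g
      ≡⟨ trans (*-assoc (∑ N λ t → ⟦ P? t ⟧) g g) (sym (∑-*ʳ N (g * g) (λ t → ⟦ P? t ⟧))) ⟩
    ∑ N (λ t → ⟦ P? t ⟧ * (g * g))
      ≤⟨ ℤ.drop‿+≤+ (ℤ.≤-trans (ℤ.≤-trans (ℤ.≤-reflexive (sym (∑ℤ-pos N _))) (∑ℤ-mono N pointwise))
           (ℤ.≤-trans (ℤ.≤-reflexive (sym (ℤ.*-identityˡ (X N (λ _ → 1ℤ) ps D D))))
             (square-bound cop adms {f = λ _ → 1ℤ} N D (test {B = 1} (s≤s z≤n) (λ _ → refl) (λ _ → s≤s z≤n) (all-1 ps)) (ℤ.≤-refl {1ℤ})))) ⟩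
    N * 1 * (product ps * g) + 1 * (σ ps D * σ ps D)
      ≤⟨ +-monoʳ-≤ (N * 1 * (product ps * g)) (*-monoʳ-≤ 1 (*-mono-≤ (σ≤D²G ps D) (σ≤D²G ps D))) ⟩
    N * 1 * (product ps * g) + 1 * (D * D * g * (D * D * g))
      ≡⟨ eq N (product ps) g D ⟩
    (N * product ps + D * D * (D * D) * g) * g ∎)
    where
    g = G w ps D
    eq : ∀ N Q g D → N * 1 * (Q * g) + 1 * (D * D * g * (D * D * g)) ≡ (N * Q + D * D * (D * D) * g) * g
    eq = solve-∀
    all-1 : ∀ qs → All (Coprime 1) qs
    all-1 []       = []
    all-1 (q ∷ qs) = (λ (d∣1 , _) → ∣1⇒≡1 d∣1) ∷ all-1 qs
    square : ∀ i → i ℤ.* i ≡ pos (abs i * abs i)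
    square (pos n)    = sym (ℤ.pos-* n n)
    square ℤ.-[1+ n ] = refl
    pointwise : ∀ t → pos (⟦ P? t ⟧ * (g * g)) ℤ.≤ 1ℤ ℤ.* (F ps D t ℤ.* F ps D t)
    pointwise t with P? t
    ... | yes h = ℤ.≤-reflexive (trans (cong pos (*-identityˡ (g * g))) (trans (ℤ.pos-* g g)
                    (trans (cong (λ z → z ℤ.* z) (sym (F-unsifted D (unsifted t h)))) (sym (ℤ.*-identityˡ _)))))
    ... | no _  = ℤ.≤-trans (ℤ.+≤+ z≤n) (ℤ.≤-reflexive (trans (sym (square (F ps D t))) (sym (ℤ.*-identityˡ _))))

-- Lower bounds for the sieve sum G

÷-monoˡ : ∀ p {m n} → m ≤ n → m ÷ p ≤ n ÷ p
÷-monoˡ zero    h = z≤n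
÷-monoˡ (suc p) h = /-monoˡ-≤ (suc p) h

÷-greatest : ∀ {p x n} → 1 ≤ p → x * p ≤ n → x ≤ n ÷ p
÷-greatest {suc p} {x} {n} _ h = ≤-trans (≤-reflexive (sym (m*n/n≡m x (suc p)))) (/-monoˡ-≤ (suc p) h)

÷-≤ : ∀ n p → n ÷ p ≤ n
÷-≤ n zero    = z≤n
÷-≤ n (suc p) = m/n≤m n (suc p)

÷-÷ : ∀ n p q → n ÷ p ÷ q ≡ n ÷ (p * q)
÷-÷ n zero    zero    = refl
÷-÷ n zero    (suc q) = 0/n≡0 (suc q)
÷-÷ n (suc p) zero    = cong (n ÷_) (sym (*-zeroʳ p))
÷-÷ n (suc p) (suc q) = m/n/o≡m/[n*o] n (suc p) (suc q)

÷-*-≤ : ∀ y z p → (y ÷ p) * z ≤ (y * z) ÷ p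
÷-*-≤ y z zero    = z≤n
÷-*-≤ y z (suc p) = ÷-greatest (s≤s z≤n) (begin
  (y ÷ suc p) * z * suc p  ≡⟨ eq (y ÷ suc p) z (suc p) ⟩
  suc p * (y ÷ suc p) * z  ≤⟨ *-monoˡ-≤ z (*-÷-≤ (suc p) y) ⟩
  y * z  ∎)
  where
  eq : ∀ x z p → x * z * p ≡ p * x * z
  eq = solve-∀

one : ℕ → ℕ
one _ = 1

G-mono : ∀ w ps {D E} → D ≤ E → G w ps D ≤ G w ps E
G-mono w []       {zero}          h = z≤n
G-mono w []       {suc D} {suc E} h = ≤-refl
G-mono w (p ∷ ps)                 h = +-mono-≤ (*-monoʳ-≤ p (G-mono w ps h)) (*-monoʳ-≤ (w p) (G-mono w ps (÷-monoˡ p h)))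

-- Discarding a prime p costs at most a factor 1 + 1/p: the terms with p ∣ d amount to 1/p times a
-- sum without p and with a smaller cutoff.
G-thin : ∀ {u e : ℕ → ℕ} → (∀ p → u p + e p ≡ 1) → ∀ ps D →
  G one ps D * product ps ≤ G u ps D * product (map (λ p → p + e p) ps)
G-thin h []       zero    = z≤n
G-thin h []       (suc D) = ≤-refl
G-thin {u} {e} h (p ∷ ps) D with u p | e p | h p
... | suc zero | zero | refl = begin
  (p * S + 1 * S′) * (p * Q)  ≡⟨ eq₁ p S S′ Q ⟩
  p * (p * (S * Q) + S′ * Q)  ≤⟨ *-monoʳ-≤ p (+-mono-≤ (*-monoʳ-≤ p (G-thin h ps D)) (G-thin h ps (D ÷ p))) ⟩
  p * (p * (U * f) + U′ * f)  ≡⟨ eq₂ p U U′ f ⟩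
  (p * U + 1 * U′) * ((p + 0) * f)  ∎
  where
  S = G one ps D
  S′ = G one ps (D ÷ p)
  U = G u ps D
  U′ = G u ps (D ÷ p)
  Q = product ps
  f = product (map (λ p → p + e p) ps)
  eq₁ : ∀ p S S′ Q → (p * S + 1 * S′) * (p * Q) ≡ p * (p * (S * Q) + S′ * Q)
  eq₁ = solve-∀
  eq₂ : ∀ p S S′ Q → p * (p * (S * Q) + S′ * Q) ≡ (p * S + 1 * S′) * ((p + 0) * Q)
  eq₂ = solve-∀
... | zero | suc zero | refl = begin
  (p * S + 1 * S′) * (p * Q)  ≤⟨ *-monoˡ-≤ (p * Q) (+-monoʳ-≤ (p * S) (*-monoʳ-≤ 1 (G-mono one ps (÷-≤ D p)))) ⟩
  (p * S + 1 * S) * (p * Q)  ≡⟨ eq₁ p S Q ⟩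
  (p + 1) * p * (S * Q)  ≤⟨ *-monoʳ-≤ ((p + 1) * p) (G-thin h ps D) ⟩
  (p + 1) * p * (U * f)  ≡⟨ eq₂ p U U′ f ⟩
  (p * U + 0 * U′) * ((p + 1) * f)  ∎
  where
  S = G one ps D
  S′ = G one ps (D ÷ p)
  U = G u ps D
  U′ = G u ps (D ÷ p)
  Q = product ps
  f = product (map (λ p → p + e p) ps)
  eq₁ : ∀ p S Q → (p * S + 1 * S) * (p * Q) ≡ (p + 1) * p * (S * Q)
  eq₁ = solve-∀
  eq₂ : ∀ p U U′ f → (p + 1) * p * (U * f) ≡ (p * U + 0 * U′) * ((p + 1) * f)
  eq₂ = solve-∀
... | suc zero    | suc _ | ()
... | suc (suc _) | _     | ()

-- Sums over pairs (a , b) against sums over products ab: a common prime p of a and b costs a factor 1 + 1/p².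
G-convolve : ∀ {u : ℕ → ℕ} → (∀ p → u p ≤ 1) → ∀ ps y z →
  product ps * (G one ps y * G u ps z) ≤ product (map (λ p → p * p + 1) ps) * G (λ p → 1 + u p) ps (y * z)
G-convolve h []       zero    z       = z≤n
G-convolve h []       (suc y) zero    = z≤n
G-convolve h []       (suc y) (suc z) = ≤-refl
G-convolve {u} h (p ∷ ps) y z = begin
  p * Q * ((p * A + 1 * A′) * (p * B + u p * B′))
    ≡⟨ eq₁ p Q A A′ B B′ (u p) ⟩
  p * (p * p * (Q * (A * B)) + p * (Q * (A′ * B)) + p * u p * (Q * (A * B′)) + u p * (Q * (A′ * B′)))
    ≤⟨ *-monoʳ-≤ p (+-mono-≤ (+-mono-≤ (+-mono-≤
         (*-monoʳ-≤ (p * p) (G-convolve h ps y z))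
         (*-monoʳ-≤ p (≤-trans (G-convolve h ps (y ÷ p) z) (*-monoʳ-≤ K (G-mono w ps (÷-*-≤ y z p))))))
         (*-monoʳ-≤ (p * u p) (≤-trans (G-convolve h ps y (z ÷ p)) (*-monoʳ-≤ K (G-mono w ps y*[z÷p])))))
         (*-monoʳ-≤ (u p) (≤-trans (G-convolve h ps (y ÷ p) (z ÷ p)) (*-monoʳ-≤ K (G-mono w ps (*-mono-≤ (÷-≤ y p) (÷-≤ z p)))))) ) ⟩
  p * (p * p * (K * g) + p * (K * g′) + p * u p * (K * g′) + u p * (K * g))
    ≡⟨ eq₂ p K g g′ (u p) ⟩
  K * (p * (p * p) * g + p * g * u p + p * p * (1 + u p) * g′)
    ≤⟨ *-monoʳ-≤ K (+-mono-≤ (+-monoʳ-≤ (p * (p * p) * g) (*-monoʳ-≤ (p * g) (h p))) (m≤m+n _ ((1 + u p) * g′))) ⟩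
  K * (p * (p * p) * g + p * g * 1 + (p * p * (1 + u p) * g′ + (1 + u p) * g′))
    ≡⟨ eq₃ p K g g′ (u p) ⟩
  (p * p + 1) * K * (p * g + (1 + u p) * g′) ∎
  where
  w : ℕ → ℕ
  w p = 1 + u p
  Q = product ps
  K = product (map (λ p → p * p + 1) ps)
  A = G one ps y
  A′ = G one ps (y ÷ p)
  B = G u ps z
  B′ = G u ps (z ÷ p)
  g = G w ps (y * z)
  g′ = G w ps ((y * z) ÷ p)
  y*[z÷p] : y * (z ÷ p) ≤ (y * z) ÷ p
  y*[z÷p] = subst₂ _≤_ (*-comm (z ÷ p) y) (cong (_÷ p) (*-comm z y)) (÷-*-≤ z y p)
  eq₁ : ∀ p Q A A′ B B′ u → p * Q * ((p * A + 1 * A′) * (p * B + u * B′)) ≡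
    p * (p * p * (Q * (A * B)) + p * (Q * (A′ * B)) + p * u * (Q * (A * B′)) + u * (Q * (A′ * B′)))
  eq₁ = solve-∀
  eq₂ : ∀ p K g g′ u → p * (p * p * (K * g) + p * (K * g′) + p * u * (K * g′) + u * (K * g)) ≡
    K * (p * (p * p) * g + p * g * u + p * p * (1 + u) * g′)
  eq₂ = solve-∀
  eq₃ : ∀ p K g g′ u → K * (p * (p * p) * g + p * g * 1 + (p * p * (1 + u) * g′ + (1 + u) * g′)) ≡
    (p * p + 1) * K * (p * g + (1 + u) * g′)
  eq₃ = solve-∀

-- Products over the primes up to a bound

consWhen : ∀ {P : Set} → Dec P → ℕ → List ℕ → List ℕ
consWhen (yes _) n l = n ∷ l
consWhen (no _)  n l = l

select : {P : ℕ → Set} → (∀ i → Dec (P i)) → ℕ → List ℕ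
select P? zero    = []
select P? (suc n) = consWhen (P? (suc n)) (suc n) (select P? n)

Descending : List ℕ → Set
Descending = AllPairs (λ i j → j < i)

module _ {P : ℕ → Set} (P? : ∀ i → Dec (P i)) where

  select-All : ∀ n → All P (select P? n)
  select-All zero    = []
  select-All (suc n) with P? (suc n)
  ... | yes p = p ∷ select-All n
  ... | no _  = select-All n

  select-≤ : ∀ n → All (_≤ n) (select P? n)
  select-≤ zero    = []
  select-≤ (suc n) with P? (suc n)
  ... | yes p = ≤-refl ∷ All.map m≤n⇒m≤1+n (select-≤ n)
  ... | no _  = All.map m≤n⇒m≤1+n (select-≤ n)

  select-≥1 : ∀ n → All (1 ≤_) (select P? n)
  select-≥1 zero    = []
  select-≥1 (suc n) with P? (suc n)
  ... | yes p = s≤s z≤n ∷ select-≥1 n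
  ... | no _  = select-≥1 n

  select-desc : ∀ n → Descending (select P? n)
  select-desc zero    = []
  select-desc (suc n) with P? (suc n)
  ... | yes p = All.map s≤s (select-≤ n) ∷ select-desc n
  ... | no _  = select-desc n

  select-lookup : ∀ {Q : ℕ → Set} n {i} → All Q (select P? n) → P i → 1 ≤ i → i ≤ n → Q i
  select-lookup zero    qs p (s≤s _) ()
  select-lookup (suc n) {i} qs p 1≤i i≤1+n with P? (suc n) | m≤n⇒m<n∨m≡n i≤1+n
  select-lookup (suc n) (q ∷ qs) p 1≤i _ | yes _ | inj₁ (s≤s i≤n) = select-lookup n qs p 1≤i i≤n
  select-lookup (suc n) (q ∷ qs) p 1≤i _ | yes _ | inj₂ refl      = q
  select-lookup (suc n) qs       p 1≤i _ | no _  | inj₁ (s≤s i≤n) = select-lookup n qs p 1≤i i≤n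
  select-lookup (suc n) qs       p 1≤i _ | no ¬p | inj₂ refl      = contradiction p ¬p

  -- The product telescopes: ∏_{2 ≤ i ≤ n} i² / (i² − 1) = 2n / (n + 1).
  product²-telescope : (∀ i → P i → 2 ≤ i) → ∀ n →
    product (select P? (suc n)) * product (select P? (suc n)) * (2 + n) ≤ 2 * suc n * product (map (λ p → p * p ∸ 1) (select P? (suc n)))
  product²-telescope P≥2 zero with P? 1
  ... | yes p = contradiction (P≥2 1 p) λ { (s≤s ()) }
  ... | no _  = ≤-refl
  product²-telescope P≥2 (suc n) with P? (2 + n)
  ... | yes p = *-cancelʳ-≤ _ _ (2 + n) (begin
    (2 + n) * Q * ((2 + n) * Q) * (3 + n) * (2 + n)  ≡⟨ eq₁ n Q ⟩
    (2 + n) * (2 + n) * (3 + n) * (Q * Q * (2 + n))  ≤⟨ *-monoʳ-≤ ((2 + n) * (2 + n) * (3 + n)) (product²-telescope P≥2 n) ⟩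
    (2 + n) * (2 + n) * (3 + n) * (2 * suc n * π)  ≡⟨ eq₂ n π ⟩
    2 * (2 + n) * ((1 + n) * (3 + n) * π) * (2 + n)  ≡⟨ cong (λ z → 2 * (2 + n) * (z * π) * (2 + n)) (eq₃ n) ⟨
    2 * (2 + n) * (((2 + n) * (2 + n) ∸ 1) * π) * (2 + n)  ∎)
    where
    Q = product (select P? (suc n))
    π = product (map (λ p → p * p ∸ 1) (select P? (suc n)))
    eq₁ : ∀ n Q → (2 + n) * Q * ((2 + n) * Q) * (3 + n) * (2 + n) ≡ (2 + n) * (2 + n) * (3 + n) * (Q * Q * (2 + n))
    eq₁ = solve-∀
    eq₂ : ∀ n π → (2 + n) * (2 + n) * (3 + n) * (2 * (1 + n) * π) ≡ 2 * (2 + n) * ((1 + n) * (3 + n) * π) * (2 + n)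
    eq₂ = solve-∀
    eq₄ : ∀ n → (2 + n) * (2 + n) ≡ 1 + (1 + n) * (3 + n)
    eq₄ = solve-∀
    eq₃ : ∀ n → (2 + n) * (2 + n) ∸ 1 ≡ (1 + n) * (3 + n)
    eq₃ n = cong (_∸ 1) (eq₄ n)
  ... | no _  = *-cancelʳ-≤ _ _ (2 + n) (begin
    Q * Q * (3 + n) * (2 + n)  ≡⟨ eq₁ n (Q * Q) ⟩
    (3 + n) * (Q * Q * (2 + n))  ≤⟨ *-monoʳ-≤ (3 + n) (product²-telescope P≥2 n) ⟩
    (3 + n) * (2 * suc n * π)  ≤⟨ m≤m+n _ (2 * π) ⟩
    (3 + n) * (2 * suc n * π) + 2 * π  ≡⟨ eq₂ n π ⟩
    2 * (2 + n) * π * (2 + n)  ∎)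
    where
    Q = product (select P? (suc n))
    π = product (map (λ p → p * p ∸ 1) (select P? (suc n)))
    eq₁ : ∀ n Q → Q * (3 + n) * (2 + n) ≡ (3 + n) * (Q * (2 + n))
    eq₁ = solve-∀
    eq₂ : ∀ n π → (3 + n) * (2 * (1 + n) * π) + 2 * π ≡ 2 * (2 + n) * π * (2 + n)
    eq₂ = solve-∀

  product²≤ : (∀ i → P i → 2 ≤ i) → ∀ n →
    product (select P? n) * product (select P? n) ≤ 2 * product (map (λ p → p * p ∸ 1) (select P? n))
  product²≤ P≥2 zero    = s≤s z≤n
  product²≤ P≥2 (suc n) = *-cancelʳ-≤ _ _ (2 + n) (begin
    Q * Q * (2 + n)  ≤⟨ product²-telescope P≥2 n ⟩
    2 * suc n * π  ≤⟨ *-monoˡ-≤ π (*-monoʳ-≤ 2 (n≤1+n (suc n))) ⟩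
    2 * (2 + n) * π  ≡⟨ eq n π ⟩
    2 * π * (2 + n)  ∎)
    where
    Q = product (select P? (suc n))
    π = product (map (λ p → p * p ∸ 1) (select P? (suc n)))
    eq : ∀ n π → 2 * (2 + n) * π ≡ 2 * π * (2 + n)
    eq = solve-∀

product>0 : ∀ {ps} → All (1 ≤_) ps → 1 ≤ product ps
product>0 []       = ≤-refl
product>0 (h ∷ hs) = *-mono-≤ h (product>0 hs)

-- From (p² + 1)(p² - 1) ≤ p⁴ one gets ∏ (1 + 1/p²) ≤ ∏ (1 - 1/p²)⁻¹, and `product²≤` bounds the
-- latter by 2.
product[p²+1]≤ : ∀ {P : ℕ → Set} (P? : ∀ i → Dec (P i)) → (∀ i → P i → 2 ≤ i) → ∀ n → let ps = select P? n in
  product (map (λ p → p * p + 1) ps) ≤ 2 * (product ps * product ps)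
product[p²+1]≤ P? P≥2 n = *-cancelʳ-≤ _ _ (Q * Q) {{>-nonZero (*-mono-≤ Q>0 Q>0)}} (begin
  K * (Q * Q)  ≤⟨ *-monoʳ-≤ K (product²≤ P? P≥2 n) ⟩
  K * (2 * π)  ≡⟨ eq₁ K π ⟩
  2 * (K * π)  ≤⟨ *-monoʳ-≤ 2 (Kπ ps) ⟩
  2 * (Q * Q * (Q * Q))  ≡⟨ *-assoc 2 (Q * Q) (Q * Q) ⟨
  2 * (Q * Q) * (Q * Q)  ∎)
  where
  ps = select P? n
  Q = product ps
  Q>0 = product>0 (select-≥1 P? n)
  K = product (map (λ p → p * p + 1) ps)
  π = product (map (λ p → p * p ∸ 1) ps)
  eq₁ : ∀ K π → K * (2 * π) ≡ 2 * (K * π)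
  eq₁ = solve-∀
  Kπ : ∀ qs → product (map (λ p → p * p + 1) qs) * product (map (λ p → p * p ∸ 1) qs) ≤ product qs * product qs * (product qs * product qs)
  Kπ []       = ≤-refl
  Kπ (q ∷ qs) = begin
    (q * q + 1) * k * ((q * q ∸ 1) * l)  ≡⟨ eq₂ (q * q + 1) k (q * q ∸ 1) l ⟩
    (q * q + 1) * (q * q ∸ 1) * (k * l)  ≤⟨ *-mono-≤ (square (q * q)) (Kπ qs) ⟩
    q * q * (q * q) * (r * r * (r * r))  ≡⟨ eq₃ q r ⟩
    q * r * (q * r) * (q * r * (q * r))  ∎
    where
    k = product (map (λ p → p * p + 1) qs)
    l = product (map (λ p → p * p ∸ 1) qs)
    r = product qs
    eq₂ : ∀ a b c d → a * b * (c * d) ≡ a * c * (b * d)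
    eq₂ = solve-∀
    eq₃ : ∀ q r → q * q * (q * q) * (r * r * (r * r)) ≡ q * r * (q * r) * (q * r * (q * r))
    eq₃ = solve-∀
    square : ∀ a → (a + 1) * (a ∸ 1) ≤ a * a
    square zero    = z≤n
    square (suc a) = ≤-trans (n≤1+n _) (≤-reflexive (eq a))
      where
      eq : ∀ a → 1 + (1 + a + 1) * a ≡ (1 + a) * (1 + a)
      eq = solve-∀

prime≥2 : ∀ {p} → Prime p → 2 ≤ p
prime≥2 {p} pp = nonTrivial⇒n>1 p {{prime⇒nonTrivial pp}}

prime-factor : ∀ m → 2 ≤ m → ∃ λ p → Prime p × p ∣ m
prime-factor = <-rec _ step
  where
  step : ∀ m → (∀ {d} → d < m → 2 ≤ d → ∃ λ p → Prime p × p ∣ d) → 2 ≤ m → ∃ λ p → Prime p × p ∣ m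
  step m rec 2≤m with prime? m
  ... | yes pm = m , pm , ∣-refl
  ... | no ¬pm with ¬prime⇒composite {{n>1⇒nonTrivial 2≤m}} ¬pm
  ...   | hasNonTrivialDivisor {divisor = d} d<m d∣m with rec d<m (nonTrivial⇒n>1 d)
  ...     | p , pp , p∣d = p , pp , ∣-trans p∣d d∣m

prime-∣-prime : ∀ {p q} → Prime p → Prime q → p ∣ q → p ≡ q
prime-∣-prime pp pq p∣q = [ (λ p≡1 → contradiction (subst Prime p≡1 pp) ¬prime[1]) , id ]′ (prime⇒irreducible pq p∣q)

∑-multiples : ∀ {p} → 1 ≤ p → ∀ (g : ℕ → ℕ) y →
  ∑ y (λ i → ⟦ p ∣? suc i ⟧ * g (suc i)) ≤ ∑ (y ÷ p) (λ j → g (p * suc j))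
∑-multiples {suc p′} _ g zero = z≤n
∑-multiples {p@(suc p′)} p≥1 g (suc y) with p ∣? suc y
... | no _ = ≤-trans (≤-reflexive (+-identityʳ _)) (≤-trans (∑-multiples p≥1 g y) (∑-monoˡ _ (÷-monoˡ p (n≤1+n y))))
... | yes (divides zero ())
... | yes (divides (suc k) eq) = begin
  ∑ y (λ i → ⟦ p ∣? suc i ⟧ * g (suc i)) + (g (suc y) + 0)
    ≤⟨ +-mono-≤ (≤-trans (∑-multiples p≥1 g y) (∑-monoˡ _ y÷p≤k))
         (≤-reflexive (trans (+-identityʳ _) (cong g (trans eq (*-comm (suc k) p))))) ⟩
  ∑ (suc k) (λ j → g (p * suc j))
    ≤⟨ ∑-monoˡ _ (÷-greatest p≥1 (≤-reflexive (sym eq))) ⟩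
  ∑ (suc y ÷ p) (λ j → g (p * suc j)) ∎
  where
  y÷p≤k : y ÷ p ≤ k
  y÷p≤k = s≤s⁻¹ (*-cancelˡ-< p _ _ (<-≤-trans (s≤s (*-÷-≤ p y)) (≤-reflexive (trans eq (*-comm (suc k) p)))))

Avoids : List ℕ → ℕ → Set
Avoids qs m = All (λ q → ¬ q ∣ m) qs

avoids? : ∀ qs m → Dec (Avoids qs m)
avoids? qs m = All.all? (λ q → ¬? (q ∣? m)) qs

-- V times the sum of 1/m over the m ≤ y with no divisor in qs, up to rounding each term down.
H : List ℕ → ℕ → ℕ → ℕ
H qs V y = ∑ y (λ i → ⟦ avoids? qs (suc i) ⟧ * (V ÷ suc i))

-- The terms m = p j are split off; rounding down twice is rounding down once, so V ÷ (p j) is (V ÷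
-- p) ÷ j.
H-step : ∀ {p} → 1 ≤ p → ∀ qs V y → H qs V y ≤ H (p ∷ qs) V y + H qs (V ÷ p) (y ÷ p)
H-step {p} p≥1 qs V y = begin
  H qs V y
    ≤⟨ ∑-mono y (λ i _ → split i) ⟩
  ∑ y (λ i → ⟦ avoids? (p ∷ qs) (suc i) ⟧ * (V ÷ suc i) + ⟦ p ∣? suc i ⟧ * g (suc i))
    ≡⟨ ∑-+ y _ _ ⟩
  H (p ∷ qs) V y + ∑ y (λ i → ⟦ p ∣? suc i ⟧ * g (suc i))
    ≤⟨ +-monoʳ-≤ (H (p ∷ qs) V y) (≤-trans (∑-multiples p≥1 g y) (∑-mono (y ÷ p) λ j _ → multiple j)) ⟩
  H (p ∷ qs) V y + H qs (V ÷ p) (y ÷ p) ∎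
  where
  g : ℕ → ℕ
  g m = ⟦ avoids? qs m ⟧ * (V ÷ m)
  multiple : ∀ j → g (p * suc j) ≤ ⟦ avoids? qs (suc j) ⟧ * (V ÷ p ÷ suc j)
  multiple j = *-mono-≤ (⟦⟧-mono (avoids? qs (p * suc j)) (avoids? qs (suc j))
      (All.map λ ¬q∣ q∣j → ¬q∣ (∣n⇒∣m*n p q∣j))) (≤-reflexive (sym (÷-÷ V p (suc j))))
  split : ∀ i → g (suc i) ≤ ⟦ avoids? (p ∷ qs) (suc i) ⟧ * (V ÷ suc i) + ⟦ p ∣? suc i ⟧ * g (suc i)
  split i = lemma (p ∣? suc i)
    where
    x = V ÷ suc i
    lemma : (d : Dec (p ∣ suc i)) → g (suc i) ≤ ⟦ avoids? (p ∷ qs) (suc i) ⟧ * x + ⟦ d ⟧ * g (suc i)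
    lemma (yes _)  = ≤-trans (≤-reflexive (sym (*-identityˡ _))) (m≤n+m (1 * g (suc i)) (⟦ avoids? (p ∷ qs) (suc i) ⟧ * x))
    lemma (no p∤i) = ≤-trans (*-monoˡ-≤ x (⟦⟧-mono (avoids? qs (suc i)) (avoids? (p ∷ qs) (suc i)) (p∤i ∷_))) (m≤m+n _ _)

H-scale : ∀ p qs V y → p * p * H qs (V ÷ p ÷ p) (y ÷ p ÷ p) ≤ H qs V y
H-scale p qs V y = begin
  p * p * H qs (V ÷ p ÷ p) (y ÷ p ÷ p)
    ≡⟨ ∑-*ˡ (y ÷ p ÷ p) (p * p) _ ⟨
  ∑ (y ÷ p ÷ p) (λ i → p * p * (⟦ avoids? qs (suc i) ⟧ * (V ÷ p ÷ p ÷ suc i)))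
    ≤⟨ ∑-mono (y ÷ p ÷ p) (λ i _ → term ⟦ avoids? qs (suc i) ⟧ (suc i) (s≤s z≤n)) ⟩
  ∑ (y ÷ p ÷ p) (λ i → ⟦ avoids? qs (suc i) ⟧ * (V ÷ suc i))
    ≤⟨ ∑-monoˡ _ (≤-trans (÷-≤ (y ÷ p) p) (÷-≤ y p)) ⟩
  H qs V y ∎
  where
  eq₁ : ∀ p a x → p * p * (a * x) ≡ a * (p * p * x)
  eq₁ = solve-∀
  eq₂ : ∀ p x m → p * p * x * m ≡ p * (p * (m * x))
  eq₂ = solve-∀
  term : ∀ a m → 1 ≤ m → p * p * (a * (V ÷ p ÷ p ÷ m)) ≤ a * (V ÷ m)
  term a m m≥1 = ≤-trans (≤-reflexive (eq₁ p a (V ÷ p ÷ p ÷ m))) (*-monoʳ-≤ a (÷-greatest m≥1 (begin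
    p * p * (V ÷ p ÷ p ÷ m) * m  ≡⟨ eq₂ p (V ÷ p ÷ p ÷ m) m ⟩
    p * (p * (m * (V ÷ p ÷ p ÷ m)))  ≤⟨ *-monoʳ-≤ p (*-monoʳ-≤ p (*-÷-≤ m (V ÷ p ÷ p))) ⟩
    p * (p * (V ÷ p ÷ p))  ≤⟨ *-monoʳ-≤ p (*-÷-≤ p (V ÷ p)) ⟩
    p * (V ÷ p)  ≤⟨ *-÷-≤ p V ⟩
    V  ∎)))

-- Every m ≤ y is a square times a squarefree number, and the squares contribute a factor ∏ (1 − 1/p²)⁻¹.
H≤G : ∀ ps → All (1 ≤_) ps → ∀ qs V y → (∀ m → 2 ≤ m → m ≤ y → Avoids qs m → Avoids ps m → ⊥) →
  H qs V y * product (map (λ p → p * p ∸ 1) ps) ≤ V * product ps * G one ps y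
H≤G []       []           qs V zero    h = z≤n
H≤G []       []           qs V (suc y) h = *-monoˡ-≤ 1 (begin
  H qs V (suc y)
    ≡⟨ ∑-split 1 y _ ⟩
  ⟦ avoids? qs 1 ⟧ * (V ÷ 1) + ∑ y (λ i → ⟦ avoids? qs (2 + i) ⟧ * (V ÷ (2 + i)))
    ≡⟨ cong (⟦ avoids? qs 1 ⟧ * (V ÷ 1) +_) (∑-zero y λ i i<y →
         cong (_* (V ÷ (2 + i))) (⟦⟧-no (avoids? qs (2 + i)) λ av → h (2 + i) (s≤s (s≤s z≤n)) (s≤s i<y) av [])) ⟩
  ⟦ avoids? qs 1 ⟧ * (V ÷ 1) + 0
    ≤⟨ +-monoˡ-≤ 0 (*-mono-≤ (⟦⟧≤1 (avoids? qs 1)) (÷-≤ V 1)) ⟩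
  1 * V + 0
    ≡⟨ eq V ⟩
  V * 1 ∎)
  where
  eq : ∀ V → 1 * V + 0 ≡ V * 1
  eq = solve-∀
H≤G (p ∷ ps) (p≥1 ∷ ps≥1) qs V y h = begin
  H qs V y * ((p * p ∸ 1) * π)
    ≡⟨ eq₁ (H qs V y) (p * p ∸ 1) π ⟩
  (p * p ∸ 1) * H qs V y * π
    ≤⟨ *-monoˡ-≤ π [p²-1]H ⟩
  (p * p * H⁺ + p * p * H⁺′) * π
    ≡⟨ eq₂ p H⁺ H⁺′ π ⟩
  p * p * (H⁺ * π) + p * p * (H⁺′ * π)
    ≤⟨ +-mono-≤ (*-monoʳ-≤ (p * p) (H≤G ps ps≥1 (p ∷ qs) V y h⁺))
         (*-monoʳ-≤ (p * p) (H≤G ps ps≥1 (p ∷ qs) (V ÷ p) (y ÷ p) λ m 2≤m m≤ → h⁺ m 2≤m (≤-trans m≤ (÷-≤ y p)))) ⟩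
  p * p * (V * Q * g) + p * p * ((V ÷ p) * Q * g′)
    ≡⟨ eq₃ p V (V ÷ p) Q g g′ ⟩
  p * p * (V * Q * g) + p * (V ÷ p) * (p * Q * g′)
    ≤⟨ +-monoʳ-≤ (p * p * (V * Q * g)) (*-monoˡ-≤ (p * Q * g′) (*-÷-≤ p V)) ⟩
  p * p * (V * Q * g) + V * (p * Q * g′)
    ≡⟨ eq₄ p V Q g g′ ⟩
  V * (p * Q) * (p * g + 1 * g′) ∎
  where
  π = product (map (λ p → p * p ∸ 1) ps)
  Q = product ps
  g = G one ps y
  g′ = G one ps (y ÷ p)
  H⁺ = H (p ∷ qs) V y
  H⁺′ = H (p ∷ qs) (V ÷ p) (y ÷ p)
  h⁺ : ∀ m → 2 ≤ m → m ≤ y → Avoids (p ∷ qs) m → Avoids ps m → ⊥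
  h⁺ m 2≤m m≤y (p∤m ∷ av) av′ = h m 2≤m m≤y av (p∤m ∷ av′)
  eq₁ : ∀ h a π → h * (a * π) ≡ a * h * π
  eq₁ = solve-∀
  eq₂ : ∀ p a b π → (p * p * a + p * p * b) * π ≡ p * p * (a * π) + p * p * (b * π)
  eq₂ = solve-∀
  eq₃ : ∀ p V V′ Q g g′ → p * p * (V * Q * g) + p * p * (V′ * Q * g′) ≡ p * p * (V * Q * g) + p * V′ * (p * Q * g′)
  eq₃ = solve-∀
  eq₄ : ∀ p V Q g g′ → p * p * (V * Q * g) + V * (p * Q * g′) ≡ V * (p * Q) * (p * g + 1 * g′)
  eq₄ = solve-∀
  eq₅ : ∀ p a b c → p * p * (a + (b + c)) ≡ p * p * a + p * p * b + p * p * c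
  eq₅ = solve-∀
  [p²-1]H : (p * p ∸ 1) * H qs V y ≤ p * p * H⁺ + p * p * H⁺′
  -- Sort the m by their exponent of p: the parts with exponent 0 and 1 remain, while the part with
  -- p² ∣ m is at most H / p² by `H-scale` and moves to the left.
  [p²-1]H = begin
    (p * p ∸ 1) * H qs V y  ≡⟨ *-distribʳ-∸ (H qs V y) (p * p) 1 ⟩
    p * p * H qs V y ∸ 1 * H qs V y  ≤⟨ ∸-monoˡ-≤ (1 * H qs V y) (begin
      p * p * H qs V y
        ≤⟨ *-monoʳ-≤ (p * p) (≤-trans (H-step p≥1 qs V y) (+-monoʳ-≤ H⁺ (H-step p≥1 qs (V ÷ p) (y ÷ p)))) ⟩
      p * p * (H⁺ + (H⁺′ + H qs (V ÷ p ÷ p) (y ÷ p ÷ p)))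
        ≡⟨ eq₅ p H⁺ H⁺′ _ ⟩
      p * p * H⁺ + p * p * H⁺′ + p * p * H qs (V ÷ p ÷ p) (y ÷ p ÷ p)
        ≤⟨ +-monoʳ-≤ (p * p * H⁺ + p * p * H⁺′) (≤-trans (H-scale p qs V y) (≤-reflexive (sym (*-identityˡ _)))) ⟩
      p * p * H⁺ + p * p * H⁺′ + 1 * H qs V y ∎) ⟩
    p * p * H⁺ + p * p * H⁺′ + 1 * H qs V y ∸ 1 * H qs V y
      ≡⟨ m+n∸n≡m _ (1 * H qs V y) ⟩
    p * p * H⁺ + p * p * H⁺′ ∎

-- Dyadic blocks: each of the 2^k numbers m with 2^k < m ≤ 2^(k+1) contributes at least 2^(s - k -
-- 1), together half of 2^s. This lower bound is an integer, so rounding down does no harm.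
harmonic : ∀ s k → k ≤ s → k * 2 ^ s ≤ 2 * H [] (2 ^ s) (2 ^ k)
harmonic s zero    k≤s = z≤n
harmonic s (suc k) k<s = begin
  2 ^ s + k * 2 ^ s
    ≤⟨ +-mono-≤ block (harmonic s k (<⇒≤ k<s)) ⟩
  2 * ∑ (2 ^ k) (λ i → f (2 ^ k + i)) + 2 * ∑ (2 ^ k) f
    ≡⟨ eq (∑ (2 ^ k) (λ i → f (2 ^ k + i))) (∑ (2 ^ k) f) ⟩
  2 * (∑ (2 ^ k) f + ∑ (2 ^ k) (λ i → f (2 ^ k + i)))
    ≡⟨ cong (2 *_) (∑-split (2 ^ k) (2 ^ k) f) ⟨
  2 * ∑ (2 ^ k + 2 ^ k) f
    ≡⟨ cong (λ z → 2 * ∑ (2 ^ k + z) f) (+-identityʳ (2 ^ k)) ⟨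
  2 * H [] (2 ^ s) (2 ^ suc k) ∎
  where
  f : ℕ → ℕ
  f i = ⟦ avoids? [] (suc i) ⟧ * (2 ^ s ÷ suc i)
  eq : ∀ a b → 2 * a + 2 * b ≡ 2 * (b + a)
  eq = solve-∀
  r = s ∸ suc k
  2^s : 2 ^ s ≡ 2 ^ r * (2 * 2 ^ k)
  2^s = trans (cong (2 ^_) (sym (m∸n+n≡m k<s))) (^-distribˡ-+-* 2 r (suc k))
  block : 2 ^ s ≤ 2 * ∑ (2 ^ k) (λ i → f (2 ^ k + i))
  block = begin
    2 ^ s  ≡⟨ trans 2^s (eq₂ (2 ^ r) (2 ^ k)) ⟩
    2 * (2 ^ k * 2 ^ r)  ≡⟨ cong (2 *_) (∑-const (2 ^ k) (2 ^ r)) ⟨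
    2 * ∑ (2 ^ k) (λ _ → 2 ^ r)  ≤⟨ *-monoʳ-≤ 2 (∑-mono (2 ^ k) λ i i<2^k → ≤-trans
      (÷-greatest (s≤s z≤n) (≤-trans (*-monoʳ-≤ (2 ^ r) (+-monoʳ-< (2 ^ k) i<2^k)) (≤-reflexive (trans (cong (2 ^ r *_) (cong (2 ^ k +_) (sym (+-identityʳ (2 ^ k))))) (sym 2^s)))))
      (≤-reflexive (sym (*-identityˡ _)))) ⟩
    2 * ∑ (2 ^ k) (λ i → f (2 ^ k + i)) ∎
    where
    eq₂ : ∀ a b → a * (2 * b) ≡ 2 * (b * a)
    eq₂ = solve-∀

OddPrime : ℕ → Set
OddPrime p = Prime p × p ≢ 2

oddPrime? : ∀ p → Dec (OddPrime p)
oddPrime? p = prime? p ×-dec ¬? (p ≟ 2)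

oddPrimes : ℕ → List ℕ
oddPrimes = select oddPrime?

oddPrime≥2 : ∀ p → OddPrime p → 2 ≤ p
oddPrime≥2 p (pp , _) = prime≥2 pp

-- All prime factors of an m ≤ 2^s lie in `2 ∷ oddPrimes D`, so `H≤G` converts the harmonic sum, at
-- least s/2, into a bound for `G`. In 8 = 2 · 2 · 2 the factors come from `harmonic`, from
-- `product²≤` and from the prime 2, whose 2² - 1 = 3 cancels. This is the source both of the
-- logarithm saved by each sieve and of the divergence of ∏ (1 + 1/q).
G-lower : ∀ s D → 2 ^ s ≤ D → s * product (oddPrimes D) ≤ 8 * G one (oddPrimes D) (2 ^ s)
G-lower s D y≤D = *-cancelʳ-≤ _ _ Q {{>-nonZero (product>0 (select-≥1 oddPrime? D))}}
  (*-cancelʳ-≤ _ _ (3 * y) {{>-nonZero (*-mono-≤ {1} {3} (s≤s z≤n) (m^n>0 2 s))}} (begin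
  s * Q * Q * (3 * y)  ≡⟨ eq₁ s Q y ⟩
  s * y * (3 * (Q * Q))  ≤⟨ *-mono-≤ (harmonic s s ≤-refl) (*-monoʳ-≤ 3 (product²≤ oddPrime? oddPrime≥2 D)) ⟩
  2 * h * (3 * (2 * π))  ≡⟨ eq₂ h π ⟩
  4 * (h * (3 * π))  ≤⟨ *-monoʳ-≤ 4 (H≤G (2 ∷ ps) (s≤s z≤n ∷ select-≥1 oddPrime? D) [] y y no-factor) ⟩
  4 * (y * (2 * Q) * (2 * g + 1 * G one ps (y ÷ 2)))
    ≤⟨ *-monoʳ-≤ 4 (*-monoʳ-≤ (y * (2 * Q)) (+-monoʳ-≤ (2 * g) (*-monoʳ-≤ 1 (G-mono one ps (÷-≤ y 2))))) ⟩
  4 * (y * (2 * Q) * (2 * g + 1 * g))  ≡⟨ eq₃ y Q g ⟩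
  8 * g * Q * (3 * y) ∎))
  where
  y = 2 ^ s
  ps = oddPrimes D
  Q = product ps
  g = G one ps y
  h = H [] y y
  π = product (map (λ p → p * p ∸ 1) ps)
  eq₁ : ∀ s Q y → s * Q * Q * (3 * y) ≡ s * y * (3 * (Q * Q))
  eq₁ = solve-∀
  eq₂ : ∀ h π → 2 * h * (3 * (2 * π)) ≡ 4 * (h * (3 * π))
  eq₂ = solve-∀
  eq₃ : ∀ y Q g → 4 * (y * (2 * Q) * (2 * g + 1 * g)) ≡ 8 * g * Q * (3 * y)
  eq₃ = solve-∀
  no-factor : ∀ m → 2 ≤ m → m ≤ y → Avoids [] m → Avoids (2 ∷ ps) m → ⊥
  no-factor m 2≤m m≤y _ (2∤m ∷ av) with prime-factor m 2≤m
  ... | p , pp , p∣m with p ≟ 2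
  ...   | yes refl = 2∤m p∣m
  ...   | no p≢2   = select-lookup oddPrime? D av (pp , p≢2) (<⇒≤ (prime≥2 pp))
                       (≤-trans (∣⇒≤ {{>-nonZero (<⇒≤ 2≤m)}} p∣m) (≤-trans m≤y y≤D)) p∣m

-- Chebyshev's lower bound

n<2^n : ∀ n → n < 2 ^ n
n<2^n zero    = s≤s z≤n
n<2^n (suc n) = ≤-trans (+-mono-≤ (m^n>0 2 n) (n<2^n n)) (≤-reflexive (cong (2 ^ n +_) (sym (+-identityʳ (2 ^ n)))))

nC0≡1 : ∀ n → n C 0 ≡ 1
nC0≡1 zero    = refl
nC0≡1 (suc n) = refl

absorption : ∀ n k → suc k * (suc n C suc k) ≡ suc n * (n C k)
absorption zero    zero    = refl
absorption zero    (suc k) = trans (cong (suc (suc k) *_) (k>n⇒nCk≡0 {1} {suc (suc k)} (s≤s (s≤s z≤n)))) (*-zeroʳ (suc (suc k)))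
absorption (suc n) zero    = begin-equality
  1 * (suc (suc n) C 1)  ≡⟨ cong (1 *_) (nCk+nC[k+1]≡[n+1]C[k+1] (suc n) 0) ⟨
  1 * (suc n C 0 + suc n C 1)  ≡⟨ eq (suc n C 0) (suc n C 1) ⟩
  suc n C 0 + 1 * (suc n C 1)  ≡⟨ cong₂ _+_ (nC0≡1 (suc n)) (trans (absorption n 0) (trans (cong (suc n *_) (nC0≡1 n)) (*-identityʳ (suc n)))) ⟩
  suc (suc n)  ≡⟨ trans (cong (suc (suc n) *_) (nC0≡1 (suc n))) (*-identityʳ (suc (suc n))) ⟨
  suc (suc n) * (suc n C 0)  ∎
  where
  eq : ∀ a b → 1 * (a + b) ≡ a + 1 * b
  eq = solve-∀
absorption (suc n) (suc k) = begin-equality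
  (2 + k) * ((2 + n) C (2 + k))
    ≡⟨ cong ((2 + k) *_) (nCk+nC[k+1]≡[n+1]C[k+1] (suc n) (suc k)) ⟨
  (2 + k) * (suc n C suc k + suc n C (2 + k))
    ≡⟨ eq₁ k (suc n C suc k) (suc n C (2 + k)) ⟩
  (suc n C suc k) + suc k * (suc n C suc k) + (2 + k) * (suc n C (2 + k))
    ≡⟨ cong₂ _+_ (cong ((suc n C suc k) +_) (absorption n k)) (absorption n (suc k)) ⟩
  (suc n C suc k) + suc n * (n C k) + suc n * (n C suc k)
    ≡⟨ eq₂ (suc n C suc k) (suc n) (n C k) (n C suc k) ⟩
  (suc n C suc k) + suc n * (n C k + n C suc k)
    ≡⟨ cong (λ z → (suc n C suc k) + suc n * z) (nCk+nC[k+1]≡[n+1]C[k+1] n k) ⟩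
  (2 + n) * (suc n C suc k) ∎
  where
  eq₁ : ∀ k a b → (2 + k) * (a + b) ≡ a + (1 + k) * a + (2 + k) * b
  eq₁ = solve-∀
  eq₂ : ∀ x n a b → x + n * a + n * b ≡ x + n * (a + b)
  eq₂ = solve-∀

CommonMultiple : ℕ → ℕ → Set
CommonMultiple n D = ∀ m → 1 ≤ m → m ≤ n → m ∣ D

-- The reciprocals of the m * (n C m) form Leibniz's harmonic triangle, in which each entry is the
-- difference of two entries of the previous column.
harmonic-triangle : ∀ {N D} → 1 ≤ D → CommonMultiple N D → ∀ m n → m ≤ n → suc n ≤ N → suc m * (suc n C suc m) ∣ D
harmonic-triangle {N} {D} D≥1 cm zero n m≤n n<N =
  subst (_∣ D) (sym (trans (absorption n 0) (trans (cong (suc n *_) (nC0≡1 n)) (*-identityʳ (suc n))))) (cm (suc n) (s≤s z≤n) n<N)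
harmonic-triangle {N} {D} D≥1 cm (suc j) (suc n) (s≤s j≤n) n<N
  with harmonic-triangle D≥1 cm j n j≤n (<⇒≤ n<N) | harmonic-triangle D≥1 cm j (suc n) (m≤n⇒m≤1+n j≤n) n<N
... | divides a D≡ax | divides b D≡by = divides (a ∸ b) (*-cancelʳ-≡ D ((a ∸ b) * z) w {{≢-nonZero w≢0}} (begin-equality
  D * w  ≡⟨ m+n∸m≡n (D * x) (D * w) ⟨
  D * x + D * w ∸ D * x  ≡⟨ cong (_∸ D * x) (*-distribˡ-+ D x w) ⟨
  D * (x + w) ∸ D * x  ≡⟨ cong₂ (λ u v → u * (x + w) ∸ v * x) D≡ax D≡by ⟩
  a * x * (x + w) ∸ b * y * x  ≡⟨ cong (λ u → a * x * u ∸ b * y * x) (sym y≡x+w) ⟩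
  a * x * y ∸ b * y * x  ≡⟨ cong₂ _∸_ (*-assoc a x y) (eq b y x) ⟩
  a * (x * y) ∸ b * (x * y)  ≡⟨ *-distribʳ-∸ (x * y) a b ⟨
  (a ∸ b) * (x * y)  ≡⟨ cong ((a ∸ b) *_) xy≡zw ⟩
  (a ∸ b) * (z * w)  ≡⟨ *-assoc (a ∸ b) z w ⟨
  (a ∸ b) * z * w  ∎))
  where
  x = suc j * (suc n C suc j)
  y = suc j * (suc (suc n) C suc j)
  z = suc (suc j) * (suc (suc n) C suc (suc j))
  w = suc j * (suc n C j)
  eq : ∀ b y x → b * y * x ≡ b * (x * y)
  eq = solve-∀
  y≡x+w : y ≡ x + w
  y≡x+w = trans (cong (suc j *_) (sym (nCk+nC[k+1]≡[n+1]C[k+1] (suc n) j)))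
    (trans (*-distribˡ-+ (suc j) (suc n C j) _) (+-comm w x))
  y≡ : y ≡ suc (suc n) * (suc n C j)
  y≡ = absorption (suc n) j
  xy≡zw : x * y ≡ z * w
  xy≡zw = trans (cong (x *_) y≡) (trans (eq₂ (suc j) (suc n C suc j) (suc (suc n)) (suc n C j)) (cong (_* w) (sym (absorption (suc n) (suc j)))))
    where
    eq₂ : ∀ j c n d → j * c * (n * d) ≡ n * c * (j * d)
    eq₂ = solve-∀
  w≢0 : w ≢ 0
  w≢0 w≡0 with m*n≡0⇒m≡0∨n≡0 (suc j) w≡0
  ... | inj₂ c≡0 = <⇒≢ D≥1 (sym (trans D≡by (trans (cong (b *_) (trans y≡ (trans (cong (suc (suc n) *_) c≡0) (*-zeroʳ (suc (suc n)))))) (*-zeroʳ b))))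

C-mono : ∀ n k → n C k ≤ suc n C k
C-mono n zero    = ≤-reflexive (trans (nC0≡1 n) (sym (nC0≡1 (suc n))))
C-mono n (suc k) = ≤-trans (m≤n+m _ (n C k)) (≤-reflexive (nCk+nC[k+1]≡[n+1]C[k+1] n k))

central : ∀ m → 2 ^ m ≤ (2 * m) C m
central zero    = ≤-refl
central (suc m) = begin
  2 ^ m + (2 ^ m + 0)  ≡⟨ cong (2 ^ m +_) (+-identityʳ (2 ^ m)) ⟩
  2 ^ m + 2 ^ m  ≤⟨ +-mono-≤ (central m) (central m) ⟩
  (2 * m) C m + (2 * m) C m  ≤⟨ +-mono-≤ (C-mono (2 * m) m)
      (≤-trans (m≤m+n _ ((2 * m) C suc m)) (≤-reflexive (nCk+nC[k+1]≡[n+1]C[k+1] (2 * m) m))) ⟩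
  suc (2 * m) C m + suc (2 * m) C suc m  ≡⟨ nCk+nC[k+1]≡[n+1]C[k+1] (suc (2 * m)) m ⟩
  suc (suc (2 * m)) C suc m  ≡⟨ cong (_C suc m) (eq m) ⟩
  (2 * suc m) C suc m  ∎
  where
  eq : ∀ m → 2 + 2 * m ≡ 2 * (1 + m)
  eq = solve-∀

-- Nair's argument: m times the central binomial coefficient of 2m is the reciprocal of an entry of
-- the harmonic triangle, so it divides D.
common-multiple-large : ∀ {m D} → 1 ≤ m → 1 ≤ D → CommonMultiple (2 * m) D → 2 ^ m ≤ D
common-multiple-large {suc m} {D} _ D≥1 cm = begin
  2 ^ suc m  ≤⟨ central (suc m) ⟩
  (2 * suc m) C suc m  ≤⟨ m≤n*m _ (suc m) ⟩
  suc m * ((2 * suc m) C suc m)  ≤⟨ ∣⇒≤ {{>-nonZero D≥1}} (harmonic-triangle D≥1 cm m (m + suc (m + 0)) (m≤m+n m _) ≤-refl) ⟩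
  D  ∎

split-power : ∀ {p} → 2 ≤ p → ∀ m → 1 ≤ m → ∃ λ a → ∃ λ m′ → m ≡ p ^ a * m′ × ¬ p ∣ m′
split-power {p} p≥2 = <-rec _ step
  where
  step : ∀ m → (∀ {k} → k < m → 1 ≤ k → ∃ λ a → ∃ λ m′ → k ≡ p ^ a * m′ × ¬ p ∣ m′) → 1 ≤ m → ∃ λ a → ∃ λ m′ → m ≡ p ^ a * m′ × ¬ p ∣ m′
  step m rec m≥1 with p ∣? m
  ... | no p∤m = 0 , m , sym (+-identityʳ m) , p∤m
  ... | yes (divides zero eq) = contradiction (sym eq) (<⇒≢ m≥1)
  ... | yes (divides (suc k) refl) with rec (m<m*n (suc k) p p≥2) (s≤s z≤n)
  ...   | a , m′ , eq , p∤m′ = suc a , m′ , trans (*-comm (suc k) p) (trans (cong (p *_) eq) (sym (*-assoc p (p ^ a) m′))) , p∤m′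

greatest-power : ∀ {p} → 2 ≤ p → ∀ n → 1 ≤ n → ∃ λ e → p ^ e ≤ n × n < p ^ suc e
greatest-power {p} p≥2 n n≥1 = search n (<-≤-trans (n<2^n n) (^-monoˡ-≤ n p≥2))
  where
  search : ∀ k → n < p ^ k → ∃ λ e → p ^ e ≤ n × n < p ^ suc e
  search zero    n<1 = contradiction n≥1 (<⇒≱ n<1)
  search (suc k) n<p^ with p ^ k ≤? n
  ... | yes p^k≤n = k , p^k≤n , n<p^
  ... | no p^k≰n  = search k (≰⇒> p^k≰n)

-- D is the product over ps of the greatest powers of p not exceeding n, so each prime contributes a
-- factor at most n.
common-multiple-small : ∀ {n} → 1 ≤ n → ∀ ps → All Prime ps → ∃ λ D → 1 ≤ D × D ≤ n ^ length ps ×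
  (∀ m → 1 ≤ m → m ≤ n → (∀ r → Prime r → r ∣ m → r ∈ ps) → m ∣ D)
common-multiple-small n≥1 [] [] = 1 , ≤-refl , ≤-refl , one-divides
  where
  one-divides : ∀ m → 1 ≤ m → m ≤ _ → (∀ r → Prime r → r ∣ m → r ∈ []) → m ∣ 1
  one-divides m m≥1 m≤n h with m ≟ 1
  ... | yes refl = ∣-refl
  ... | no m≢1 with prime-factor m (≤∧≢⇒< m≥1 (m≢1 ∘ sym))
  ...   | p , pp , p∣m with h p pp p∣m
  ...     | ()
common-multiple-small {n} n≥1 (p ∷ ps) (pp ∷ pps) with greatest-power (prime≥2 pp) n n≥1 | common-multiple-small n≥1 ps pps
... | e , p^e≤n , n<p^1+e | D , D≥1 , D≤ , h =
  p ^ e * D , *-mono-≤ (m^n>0 p {{>-nonZero (<⇒≤ (prime≥2 pp))}} e) D≥1 , *-mono-≤ p^e≤n D≤ , h′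
  where
  h′ : ∀ m → 1 ≤ m → m ≤ n → (∀ r → Prime r → r ∣ m → r ∈ p ∷ ps) → m ∣ p ^ e * D
  h′ m m≥1 m≤n factors with split-power (prime≥2 pp) m m≥1
  ... | a , zero   , eq , p∤m′ = contradiction (divides 0 refl) p∤m′
  ... | a , m′@(suc _) , eq , p∤m′ = subst (_∣ p ^ e * D) (sym eq) (*-pres-∣
        (subst (p ^ a ∣_) (trans (sym (^-distribˡ-+-* p a (e ∸ a))) (cong (p ^_) (m+[n∸m]≡n a≤e))) (m∣m*n (p ^ (e ∸ a))))
        (h m′ (s≤s z≤n) (≤-trans (∣⇒≤ {{>-nonZero m≥1}} m′∣m) m≤n) factors′))
    where
    m′∣m : m′ ∣ m
    m′∣m = subst (m′ ∣_) (sym eq) (n∣m*n (p ^ a))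
    a≤e : a ≤ e
    a≤e = s≤s⁻¹ (≰⇒> λ e<a → <⇒≱ (≤-<-trans (≤-trans (≤-trans (m≤m*n (p ^ a) m′) (≤-reflexive (sym eq))) m≤n) n<p^1+e)
            (^-monoʳ-≤ p {{>-nonZero (<⇒≤ (prime≥2 pp))}} e<a))
    factors′ : ∀ r → Prime r → r ∣ m′ → r ∈ ps
    factors′ r pr r∣m′ with factors r pr (∣-trans r∣m′ m′∣m)
    ... | Any.here refl = contradiction r∣m′ p∤m′
    ... | Any.there r∈  = r∈

select-∈ : ∀ {P : ℕ → Set} (P? : ∀ i → Dec (P i)) n {i} → P i → 1 ≤ i → i ≤ n → i ∈ select P? n
select-∈ P? n = select-lookup P? n (All.tabulate id)

length-select : ∀ {P : ℕ → Set} (P? : ∀ i → Dec (P i)) n → length (select P? n) ≡ ∑ n (λ i → ⟦ P? (suc i) ⟧)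
length-select P? zero    = refl
length-select P? (suc n) with P? (suc n)
... | yes _ = trans (cong suc (length-select P? n)) (sym (+-comm _ 1))
... | no _  = trans (length-select P? n) (sym (+-identityʳ _))

-- A common multiple of the numbers up to n = 2^(L+1), bounded from both sides: 2^(2^L) ≤ D ≤ n^π.
-- The prime 2 accounts for the outer `suc` on the count of odd primes.
chebyshev : ∀ L → 2 ^ L ≤ suc L * suc (∑ (2 ^ suc L) (λ i → ⟦ oddPrime? (suc i) ⟧))
chebyshev L with common-multiple-small (m^n>0 2 (suc L)) (select prime? (2 ^ suc L)) (select-All prime? (2 ^ suc L))
... | D , D≥1 , D≤ , cm = begin
  2 ^ L  ≤⟨ ≮⇒≥ (λ lt → <⇒≱ (^-monoʳ-< 2 (s≤s (s≤s z≤n)) lt) 2^2^L≤) ⟩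
  suc L * π  ≤⟨ *-monoʳ-≤ (suc L) (begin
    π  ≡⟨ length-select prime? n ⟩
    ∑ n (λ i → ⟦ prime? (suc i) ⟧)  ≤⟨ ∑-mono n (λ i _ → split (suc i)) ⟩
    ∑ n (λ i → ⟦ suc i ≟ 2 ⟧ + ⟦ oddPrime? (suc i) ⟧)  ≡⟨ ∑-+ n _ _ ⟩
    ∑ n (λ i → ⟦ suc i ≟ 2 ⟧) + πₒ  ≤⟨ +-monoˡ-≤ πₒ (∑-unique n (λ i → suc i ≟ 2) λ i j _ _ p q → suc-injective (trans p (sym q))) ⟩
    suc πₒ  ∎) ⟩
  suc L * suc πₒ  ∎
  where
  n = 2 ^ suc L
  π = length (select prime? n)
  πₒ = ∑ n (λ i → ⟦ oddPrime? (suc i) ⟧)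
  split : ∀ i → ⟦ prime? i ⟧ ≤ ⟦ i ≟ 2 ⟧ + ⟦ oddPrime? i ⟧
  split i = ⟦⟧-bound (prime? i) λ pi → lemma pi (i ≟ 2)
    where
    lemma : Prime i → (d : Dec (i ≡ 2)) → 1 ≤ ⟦ d ⟧ + ⟦ oddPrime? i ⟧
    lemma pi (yes _)  = s≤s z≤n
    lemma pi (no i≢2) = ≤-reflexive (sym (⟦⟧-yes (oddPrime? i) (pi , i≢2)))
  2^2^L≤ : 2 ^ (2 ^ L) ≤ 2 ^ (suc L * π)
  2^2^L≤ = ≤-trans (common-multiple-large (m^n>0 2 L) D≥1 λ m m≥1 m≤n → cm m m≥1 m≤n λ r pr r∣m →
      select-∈ prime? n pr (<⇒≤ (prime≥2 pr)) (≤-trans (∣⇒≤ {{>-nonZero m≥1}} r∣m) m≤n))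
    (≤-trans D≤ (≤-reflexive (^-*-assoc 2 (suc L) π)))

-- The average of ∏ (1 + 1/p) over the primes p dividing 2ⁿ − 1

-- `product ps` times ∏ (1 + 1/p) over the p in ps with P p. For P p meaning p ∣ 2ⁿ - 1 this is the
-- arithmetic factor in the sieve bound for two exponents that differ by n.
weight : {P : ℕ → Set} → (∀ p → Dec (P p)) → List ℕ → ℕ
weight P? ps = product (map (λ p → p + ⟦ P? p ⟧) ps)

-- The sum over the sublists d of ps of product ps / product d * g d.
Ex : List ℕ → (List ℕ → ℕ) → ℕ
Ex []       g = g []
Ex (p ∷ ps) g = p * Ex ps g + Ex ps (g ∘ (p ∷_))

Ex-mono : ∀ ps {g h : List ℕ → ℕ} → (∀ d → g d ≤ h d) → Ex ps g ≤ Ex ps h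
Ex-mono []       h = h []
Ex-mono (p ∷ ps) h = +-mono-≤ (*-monoʳ-≤ p (Ex-mono ps h)) (Ex-mono ps (h ∘ (p ∷_)))

Ex-cong : ∀ ps {g h : List ℕ → ℕ} → (∀ d → g d ≡ h d) → Ex ps g ≡ Ex ps h
Ex-cong ps e = ≤-antisym (Ex-mono ps λ d → ≤-reflexive (e d)) (Ex-mono ps λ d → ≤-reflexive (sym (e d)))

Ex-*ˡ : ∀ ps c g → Ex ps (λ d → c * g d) ≡ c * Ex ps g
Ex-*ˡ []       c g = refl
Ex-*ˡ (p ∷ ps) c g = trans (cong₂ (λ a b → p * a + b) (Ex-*ˡ ps c g) (Ex-*ˡ ps c (g ∘ (p ∷_)))) (eq p c _ _)
  where
  eq : ∀ p c a b → p * (c * a) + c * b ≡ c * (p * a + b)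
  eq = solve-∀

Ex-∑ : ∀ ps n (g : ℕ → List ℕ → ℕ) → Ex ps (λ d → ∑ n (λ i → g i d)) ≡ ∑ n (λ i → Ex ps (g i))
Ex-∑ []       n g = refl
Ex-∑ (p ∷ ps) n g = trans (cong₂ (λ a b → p * a + b) (Ex-∑ ps n g) (Ex-∑ ps n (λ i d → g i (p ∷ d))))
  (trans (cong (_+ ∑ n (λ i → Ex ps (g i ∘ (p ∷_)))) (sym (∑-*ˡ n p _))) (sym (∑-+ n _ _)))

Ex-All : ∀ {P : ℕ → Set} (P? : ∀ p → Dec (P p)) ps → Ex ps (λ d → ⟦ All.all? P? d ⟧) ≡ weight P? ps
Ex-All P? []       = refl
Ex-All P? (p ∷ ps) = begin-equality
  p * Ex ps (λ d → ⟦ All.all? P? d ⟧) + Ex ps (λ d → ⟦ All.all? P? (p ∷ d) ⟧)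
    ≡⟨ cong (p * Ex ps (λ d → ⟦ All.all? P? d ⟧) +_) (trans (Ex-cong ps cons) (Ex-*ˡ ps ⟦ P? p ⟧ _)) ⟩
  p * Ex ps (λ d → ⟦ All.all? P? d ⟧) + ⟦ P? p ⟧ * Ex ps (λ d → ⟦ All.all? P? d ⟧)
    ≡⟨ *-distribʳ-+ (Ex ps (λ d → ⟦ All.all? P? d ⟧)) p ⟦ P? p ⟧ ⟨
  (p + ⟦ P? p ⟧) * Ex ps (λ d → ⟦ All.all? P? d ⟧)
    ≡⟨ cong ((p + ⟦ P? p ⟧) *_) (Ex-All P? ps) ⟩
  weight P? (p ∷ ps) ∎
  where
  cons : ∀ d → ⟦ All.all? P? (p ∷ d) ⟧ ≡ ⟦ P? p ⟧ * ⟦ All.all? P? d ⟧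
  cons d = lemma (P? p)
    where
    lemma : ∀ e → ⟦ All.all? P? (p ∷ d) ⟧ ≡ ⟦ e ⟧ * ⟦ All.all? P? d ⟧
    lemma (yes q) = trans (⟦⟧-cong (All.all? P? (p ∷ d)) (All.all? P? d) All.tail (q ∷_)) (sym (*-identityˡ _))
    lemma (no ¬q) = ⟦⟧-no (All.all? P? (p ∷ d)) (¬q ∘ All.head)

-- The order of 2 modulo primes

least : ∀ {P : ℕ → Set} → (∀ i → Dec (P i)) → ∀ n → P n → ∃ λ e → P e × e ≤ n × (∀ i → i < e → ¬ P i)
least {P} P? = <-rec _ step
  where
  step : ∀ n → (∀ {m} → m < n → P m → ∃ λ e → P e × e ≤ m × (∀ i → i < e → ¬ P i)) → P n → ∃ λ e → P e × e ≤ n × (∀ i → i < e → ¬ P i)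
  step n rec pn with anyUpTo? P? n
  ... | yes (m , m<n , pm) with rec m<n pm
  ...   | e , pe , e≤m , h = e , pe , ≤-trans e≤m (<⇒≤ m<n) , h
  step n rec pn | no none = n , pn , ≤-refl , λ i i<n pi → none (i , i<n , pi)

cong-pow : ∀ {p e} k → Cong p (2 ^ e) 1 → Cong p (2 ^ (k * e)) 1
cong-pow         zero    h = cong-refl
cong-pow {p} {e} (suc k) h = subst (λ z → Cong p z 1) (sym (^-distribˡ-+-* 2 e (k * e))) (cong-* h (cong-pow k h))

cong-pow-% : ∀ {p} m e .{{_ : NonZero e}} → Cong p (2 ^ e) 1 → Cong p (2 ^ m) (2 ^ (m % e))
cong-pow-% {p} m e h = cong-trans (cong-reflexive (trans (cong (2 ^_) (m≡m%n+[m/n]*n m e)) (^-distribˡ-+-* 2 (m % e) _)))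
  (cong-trans (cong-*ˡ (2 ^ (m % e)) (cong-pow (m / e) h)) (cong-reflexive (*-identityʳ _)))

-- The exponent is n + 1, so that n < L runs over the exponents 1 to L.
One : ℕ → ℕ → Set
One n p = Cong p (2 ^ suc n) 1

one? : ∀ n p → Dec (One n p)
one? n p = cong? p (2 ^ suc n) 1

Order≤ : ℕ → ℕ → Set
Order≤ y p = ∃ λ n → n < y × One n p

order≤? : ∀ y p → Dec (Order≤ y p)
order≤? y p = anyUpTo? (λ n → one? n p) y

minimal-exponent : ∀ d n₀ → All (One n₀) d → (∀ i → i < n₀ → ¬ All (One i) d) → ∀ n → All (One n) d → suc n₀ ∣ suc n
minimal-exponent d n₀ h₀ min n h with suc n % suc n₀ in eq
... | zero  = m%n≡0⇒n∣m (suc n) (suc n₀) eq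
... | suc r = contradiction (All.zipWith (λ {p} (x , y) → cong-trans (cong-sym (subst (λ z → Cong p (2 ^ suc n) (2 ^ z)) eq (cong-pow-% (suc n) (suc n₀) x))) y) (h₀ , h))
                (min r (s≤s⁻¹ (subst (_< suc n₀) eq (m%n<n (suc n) (suc n₀)))))

-- Powers of 8 are used rather than powers of 2 because the bound of `weight-order≤` is of order
-- y^(2/3), which is an integer when y is a cube.
cube-interval : ∀ e → 1 ≤ e → ∀ J → e ≤ 2 ^ J * 2 ^ J * 2 ^ J →
  ∃ λ j → j ≤ J × e ≤ 2 ^ j * 2 ^ j * 2 ^ j × 2 ^ j * 2 ^ j * 2 ^ j ≤ 8 * e
cube-interval e e≥1 zero    e≤ = 0 , z≤n , e≤ , *-mono-≤ {1} {8} (s≤s z≤n) e≥1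
cube-interval e e≥1 (suc J) e≤ with e ≤? 2 ^ J * 2 ^ J * 2 ^ J
... | yes e≤′ with cube-interval e e≥1 J e≤′
...   | j , j≤J , a , b = j , m≤n⇒m≤1+n j≤J , a , b
cube-interval e e≥1 (suc J) e≤ | no e≰ = suc J , ≤-refl , e≤ ,
  ≤-trans (≤-reflexive (eq (2 ^ J))) (*-monoʳ-≤ 8 (<⇒≤ (≰⇒> e≰)))
  where
  eq : ∀ a → 2 * a * (2 * a) * (2 * a) ≡ 8 * (a * a * a)
  eq = solve-∀

-- The exponents n ≤ L with 2ⁿ ≡ 1 modulo every element of d are multiples of the least one, e say;
-- the factor 1/e is bounded by 8 times the sum of 8⁻ʲ over the j with e ≤ 8ʲ.
count-exponents : ∀ d L J → L ≤ 2 ^ J * 2 ^ J * 2 ^ J →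
  2 ^ J * 2 ^ J * 2 ^ J * ∑ L (λ n → ⟦ All.all? (one? n) d ⟧) ≤
  8 * L * ∑ (suc J) (λ j → 2 ^ (J ∸ j) * 2 ^ (J ∸ j) * 2 ^ (J ∸ j) * ⟦ All.all? (order≤? (2 ^ j * 2 ^ j * 2 ^ j)) d ⟧)
count-exponents d L J L≤ with anyUpTo? (λ n → All.all? (one? n) d) L
... | no none = ≤-trans (≤-reflexive (trans (cong (2 ^ J * 2 ^ J * 2 ^ J *_)
        (∑-zero L λ n n<L → ⟦⟧-no (All.all? (one? n) d) λ a → none (n , n<L , a))) (*-zeroʳ (2 ^ J * 2 ^ J * 2 ^ J)))) z≤n
... | yes (m , m<L , am) with least (λ n → All.all? (one? n) d) m am
...   | n₀ , h₀ , n₀≤m , min with cube-interval (suc n₀) (s≤s z≤n) J (≤-trans (≤-trans (s≤s n₀≤m) m<L) L≤)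
...     | j , j≤J , e≤ , ≤8e = begin
  K * K * K * cnt  ≡⟨ cong (λ z → z * z * z * cnt) K≡ ⟩
  a * b * (a * b) * (a * b) * cnt  ≡⟨ eq₁ a b cnt ⟩
  b * b * b * (a * a * a) * cnt ≤⟨ *-monoˡ-≤ cnt (*-monoʳ-≤ (b * b * b) ≤8e) ⟩
  b * b * b * (8 * e) * cnt  ≡⟨ eq₂ b e cnt ⟩
  8 * (e * cnt) * (b * b * b)  ≤⟨ *-monoˡ-≤ (b * b * b) (*-monoʳ-≤ 8 (≤-trans (*-monoʳ-≤ e cnt≤) (*-÷-≤ e L))) ⟩
  8 * L * (b * b * b)  ≡⟨ cong (8 * L *_) (trans (cong (b * b * b *_) (⟦⟧-yes (All.all? (order≤? (a * a * a)) d) (All.map (λ x → n₀ , e≤ , x) h₀))) (*-identityʳ _)) ⟨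
  8 * L * f j  ≤⟨ *-monoʳ-≤ (8 * L) (term≤∑ (suc J) f j (s≤s j≤J)) ⟩
  8 * L * ∑ (suc J) f  ∎
  where
  K = 2 ^ J
  a = 2 ^ j
  b = 2 ^ (J ∸ j)
  e = suc n₀
  cnt = ∑ L (λ n → ⟦ All.all? (one? n) d ⟧)
  f : ℕ → ℕ
  f j = 2 ^ (J ∸ j) * 2 ^ (J ∸ j) * 2 ^ (J ∸ j) * ⟦ All.all? (order≤? (2 ^ j * 2 ^ j * 2 ^ j)) d ⟧
  K≡ : K ≡ a * b
  K≡ = trans (cong (2 ^_) (sym (m+[n∸m]≡n j≤J))) (^-distribˡ-+-* 2 j (J ∸ j))
  eq₁ : ∀ a b c → a * b * (a * b) * (a * b) * c ≡ b * b * b * (a * a * a) * c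
  eq₁ = solve-∀
  eq₂ : ∀ b e c → b * b * b * (8 * e) * c ≡ 8 * (e * c) * (b * b * b)
  eq₂ = solve-∀
  cnt≤ : cnt ≤ L ÷ e
  cnt≤ = begin
    cnt  ≤⟨ ∑-mono L (λ n _ → ≤-trans (⟦⟧-mono (All.all? (one? n) d) (e ∣? suc n) (minimal-exponent d n₀ h₀ min n)) (≤-reflexive (sym (*-identityʳ _)))) ⟩
    ∑ L (λ n → ⟦ e ∣? suc n ⟧ * 1)  ≤⟨ ∑-multiples (s≤s z≤n) one L ⟩
    ∑ (L ÷ e) (λ _ → 1)  ≡⟨ trans (∑-const (L ÷ e) 1) (*-identityʳ _) ⟩
    L ÷ e  ∎

mersenne : ℕ → ℕ
mersenne zero    = 1
mersenne (suc y) = mersenne y * (2 ^ suc y ∸ 1)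

mersenne>0 : ∀ y → 1 ≤ mersenne y
mersenne>0 zero    = ≤-refl
mersenne>0 (suc y) = *-mono-≤ (mersenne>0 y) (m<n⇒0<n∸m {1} {2 ^ suc y} (≤-trans (s≤s (s≤s z≤n)) (n<2^n (suc y))))

mersenne≤ : ∀ y → mersenne y ≤ 2 ^ (y * y)
mersenne≤ zero    = ≤-refl
mersenne≤ (suc y) = begin
  mersenne y * (2 ^ suc y ∸ 1)  ≤⟨ *-mono-≤ (mersenne≤ y) (m∸n≤m (2 ^ suc y) 1) ⟩
  2 ^ (y * y) * 2 ^ suc y  ≡⟨ ^-distribˡ-+-* 2 (y * y) (suc y) ⟨
  2 ^ (y * y + suc y)  ≤⟨ ^-monoʳ-≤ 2 (≤-trans (m≤m+n (y * y + suc y) y) (≤-reflexive (eq y))) ⟩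
  2 ^ (suc y * suc y)  ∎
  where
  eq : ∀ y → y * y + (1 + y) + y ≡ (1 + y) * (1 + y)
  eq = solve-∀

order≤⇒∣ : ∀ y {p} → Order≤ y p → p ∣ mersenne y
order≤⇒∣ (suc y) {p} (n , n<1+y , h) with m<1+n⇒m<n∨m≡n n<1+y
... | inj₁ n<y  = ∣m⇒∣m*n (2 ^ suc y ∸ 1) (order≤⇒∣ y (n , n<y , h))
... | inj₂ refl = ∣n⇒∣m*n (mersenne y) (cong-∸ (m^n>0 2 (suc y)) h)

prime-∣-product : ∀ {p qs} → Prime p → All Prime qs → p ∣ product qs → ∃ λ q → p ≡ q × Any (q ≡_) qs
prime-∣-product {p} pp []                  p∣1 = contradiction (subst Prime (∣1⇒≡1 p∣1) pp) ¬prime[1]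
prime-∣-product {p} {q ∷ qs} pp (pq ∷ pqs) p∣ with euclidsLemma q (product qs) pp p∣
... | inj₁ p∣q = q , prime-∣-prime pp pq p∣q , here refl
... | inj₂ p∣∏ with prime-∣-product pp pqs p∣∏
...   | r , p≡r , r∈ = r , p≡r , there r∈

distinct-primes-∣ : ∀ {A qs} → Descending qs → All Prime qs → All (_∣ A) qs → product qs ∣ A
distinct-primes-∣ {A} []           []         []        = 1∣ A
distinct-primes-∣ {A} {q ∷ qs} (<q ∷ desc) (pq ∷ pqs) (q∣A ∷ ds) with distinct-primes-∣ desc pqs ds
... | divides k A≡ with euclidsLemma k (product qs) pq (subst (q ∣_) A≡ q∣A)
...   | inj₁ (divides l refl) = divides l (trans A≡ (*-assoc l q (product qs)))
...   | inj₂ q∣∏ with prime-∣-product pq pqs q∣∏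
...     | r , refl , r∈ = contradiction refl (<⇒≢ (All.lookup <q r∈))

2^length≤product : ∀ {qs} → All Prime qs → 2 ^ length qs ≤ product qs
2^length≤product []         = ≤-refl
2^length≤product (pq ∷ pqs) = *-mono-≤ (prime≥2 pq) (2^length≤product pqs)

odd-prime-odd : ∀ {p} → OddPrime p → ¬ 2 ∣ p
odd-prime-odd (pp , p≢2) 2∣p = p≢2 (sym (prime-∣-prime prime[2] pp 2∣p))

∤3-form : ∀ {p} → ¬ 3 ∣ p → ∃ λ t → p ≡ 1 + 3 * t ⊎ p ≡ 2 + 3 * t
∤3-form {p} ¬3∣p with p % 3 in eq | m≡m%n+[m/n]*n p 3 | m%n<n p 3
... | 0 | e | _ = contradiction (divides (p / 3) e) ¬3∣p
... | 1 | e | _ = p / 3 , inj₁ (trans e (cong suc (*-comm (p / 3) 3)))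
... | 2 | e | _ = p / 3 , inj₂ (trans e (cong (2 +_) (*-comm (p / 3) 3)))
... | suc (suc (suc _)) | _ | s≤s (s≤s (s≤s ()))

odd-not-consecutive : ∀ {q p} → ¬ 2 ∣ q → ¬ 2 ∣ p → ¬ p ≡ suc q
odd-not-consecutive {q} q-odd p-odd refl with q % 2 in eq | m%n<n q 2
... | 0 | _ = q-odd (m%n≡0⇒n∣m q 2 eq)
... | 1 | _ = p-odd (m%n≡0⇒n∣m (suc q) 2 (trans (%-distribˡ-+ 1 q 2) (cong (λ z → (1 + z) % 2) eq)))
... | suc (suc _) | s≤s (s≤s ())

-- Odd numbers prime to 3 are determined by their quotient by 3.
third-< : ∀ {q p s t} → ¬ 2 ∣ q → ¬ 2 ∣ p → q < p → (q ≡ 1 + 3 * s ⊎ q ≡ 2 + 3 * s) → (p ≡ 1 + 3 * t ⊎ p ≡ 2 + 3 * t) → s < t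
third-< {q} {p} {s} {t} q-odd p-odd q<p fq fp with s <? t
... | yes s<t = s<t
... | no s≮t  = contradiction (consecutive fq fp) (odd-not-consecutive q-odd p-odd)
  where
  t≤s : 3 * t ≤ 3 * s
  t≤s = *-monoʳ-≤ 3 (≮⇒≥ s≮t)
  consecutive : (q ≡ 1 + 3 * s ⊎ q ≡ 2 + 3 * s) → (p ≡ 1 + 3 * t ⊎ p ≡ 2 + 3 * t) → p ≡ suc q
  consecutive (inj₁ refl) (inj₁ refl) = contradiction (s≤s t≤s) (<⇒≱ q<p)
  consecutive (inj₁ refl) (inj₂ refl) = ≤-antisym (s≤s (s≤s t≤s)) q<p
  consecutive (inj₂ refl) (inj₁ refl) = contradiction (s≤s (m≤n⇒m≤1+n t≤s)) (<⇒≱ q<p)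
  consecutive (inj₂ refl) (inj₂ refl) = contradiction (s≤s (s≤s t≤s)) (<⇒≱ q<p)

oddPrime-∤3 : ∀ {p} → OddPrime p → p ≢ 3 → ¬ 3 ∣ p
oddPrime-∤3 (pp , _) p≢3 3∣p = p≢3 (sym (prime-∣-prime prime[3] pp 3∣p))
  where
  prime[3] : Prime 3
  prime[3] = from-yes (prime? 3)

module _ {R : ℕ → Set} (R? : ∀ p → Dec (R p)) where

  big? : ∀ p → Dec (R p × p ≢ 3)
  big? p = R? p ×-dec ¬? (p ≟ 3)

  #big : List ℕ → ℕ
  #big []       = 0
  #big (p ∷ ps) = ⟦ big? p ⟧ + #big ps

  #big≤length : ∀ ps → #big ps ≤ length (filter R? ps)
  #big≤length []       = z≤n
  #big≤length (p ∷ ps) with R? p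
  ... | yes r = +-mono-≤ (⟦⟧≤1 ((yes r) ×-dec ¬? (p ≟ 3))) (#big≤length ps)
  ... | no ¬r = #big≤length ps

  #big-bound : ∀ {p ps t} → OddPrime p → (p ≡ 1 + 3 * t ⊎ p ≡ 2 + 3 * t) → All (_< p) ps → Descending ps → All OddPrime ps → #big ps < t
  #big-bound {p} {t = zero}  op (inj₁ refl) [] [] [] = contradiction (proj₁ op) ¬prime[1]
  #big-bound {p} {t = zero}  op (inj₂ refl) [] [] [] = contradiction refl (proj₂ op)
  #big-bound {p} {t = suc t} op fp [] [] [] = s≤s z≤n
  #big-bound {p} {q ∷ qs} op fp (q<p ∷ <p) (<q ∷ desc) (oq ∷ oqs) with big? q
  ... | no _ = #big-bound op fp <p desc oqs
  ... | yes (_ , q≢3) with ∤3-form (oddPrime-∤3 oq q≢3)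
  ...   | s , fq = ≤-trans (s≤s (#big-bound {t = s} oq fq <q desc oqs)) (third-< (odd-prime-odd oq) (odd-prime-odd op) q<p fq fp)

  -- The i-th smallest odd prime other than 3 is at least 3i + 1, and (1 + 1/(3i + 1))³ ≤ (i + 1)/i.
  weight³≤ : ∀ ps → Descending ps → All OddPrime ps →
    27 * (weight R? ps * weight R? ps * weight R? ps) ≤ 64 * (suc (#big ps) * (product ps * product ps * product ps))
  weight³≤ []       []            []        = m≤m+n 27 37
  weight³≤ (p ∷ ps) (<p ∷ desc) (op ∷ ops) with R? p | p ≟ 3
  ... | no _  | _ = begin
    27 * ((p + 0) * W * ((p + 0) * W) * ((p + 0) * W))  ≡⟨ eq₁ p W ⟩
    p * p * p * (27 * (W * W * W))  ≤⟨ *-monoʳ-≤ (p * p * p) (weight³≤ ps desc ops) ⟩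
    p * p * p * (64 * (suc c * (Q * Q * Q)))  ≡⟨ eq₂ p (suc c) Q ⟩
    64 * (suc c * (p * Q * (p * Q) * (p * Q)))  ∎
    where
    W = weight R? ps
    Q = product ps
    c = #big ps
    eq₁ : ∀ p W → 27 * ((p + 0) * W * ((p + 0) * W) * ((p + 0) * W)) ≡ p * p * p * (27 * (W * W * W))
    eq₁ = solve-∀
    eq₂ : ∀ p c Q → p * p * p * (64 * (c * (Q * Q * Q))) ≡ 64 * (c * (p * Q * (p * Q) * (p * Q)))
    eq₂ = solve-∀
  -- 64/27 = (4/3)³ reserves room for the prime 3, which `#big` does not count; as the least odd
  -- prime it ends the list.
  ... | yes _ | yes refl = only-3 ps <p ops
    where
    only-3 : ∀ ps → All (_< 3) ps → All OddPrime ps → 27 * (4 * weight R? ps * (4 * weight R? ps) * (4 * weight R? ps)) ≤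
      64 * (suc (#big ps) * (3 * product ps * (3 * product ps) * (3 * product ps)))
    only-3 []       []        []       = ≤-refl
    only-3 (q ∷ qs) (q<3 ∷ _) (oq ∷ _) = contradiction (≤-antisym (s≤s⁻¹ q<3) (prime≥2 (proj₁ oq))) (proj₂ oq)
  ... | yes _ | no p≢3 = begin
    27 * ((p + 1) * W * ((p + 1) * W) * ((p + 1) * W))  ≡⟨ eq₁ p W ⟩
    (p + 1) * (p + 1) * (p + 1) * (27 * (W * W * W))  ≤⟨ *-monoʳ-≤ ((p + 1) * (p + 1) * (p + 1)) (weight³≤ ps desc ops) ⟩
    (p + 1) * (p + 1) * (p + 1) * (64 * (suc c * (Q * Q * Q)))  ≡⟨ eq₂ (p + 1) (suc c) Q ⟩
    (p + 1) * (p + 1) * (p + 1) * suc c * (64 * (Q * Q * Q))  ≤⟨ *-monoˡ-≤ (64 * (Q * Q * Q)) (growth p (suc c) 3c<p) ⟩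
    p * p * p * (2 + c) * (64 * (Q * Q * Q))  ≡⟨ eq₃ p (2 + c) Q ⟩
    64 * (suc (1 + c) * (p * Q * (p * Q) * (p * Q)))  ∎
    where
    W = weight R? ps
    Q = product ps
    c = #big ps
    eq₁ : ∀ p W → 27 * ((p + 1) * W * ((p + 1) * W) * ((p + 1) * W)) ≡ (p + 1) * (p + 1) * (p + 1) * (27 * (W * W * W))
    eq₁ = solve-∀
    eq₂ : ∀ p c Q → p * p * p * (64 * (c * (Q * Q * Q))) ≡ p * p * p * c * (64 * (Q * Q * Q))
    eq₂ = solve-∀
    eq₃ : ∀ p c Q → p * p * p * c * (64 * (Q * Q * Q)) ≡ 64 * (c * (p * Q * (p * Q) * (p * Q)))
    eq₃ = solve-∀
    3c<p : 3 * suc c < p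
    3c<p with ∤3-form (oddPrime-∤3 op p≢3)
    ... | t , inj₁ p≡ = ≤-trans (s≤s (*-monoʳ-≤ 3 (#big-bound {t = t} op (inj₁ p≡) <p desc ops))) (≤-reflexive (sym p≡))
    ... | t , inj₂ p≡ = ≤-trans (s≤s (*-monoʳ-≤ 3 (#big-bound {t = t} op (inj₂ p≡) <p desc ops))) (≤-trans (n≤1+n _) (≤-reflexive (sym p≡)))
    growth : ∀ p n → 3 * n < p → (p + 1) * (p + 1) * (p + 1) * n ≤ p * p * p * suc n
    growth (suc p) n (s≤s 3n≤p) = *-cancelˡ-≤ 3 (begin
      3 * ((1 + p + 1) * (1 + p + 1) * (1 + p + 1) * n)
        ≡⟨ e₁ p n ⟩
      3 * n * (7 + 9 * p + 3 * p * p) + 3 * ((1 + p) * (1 + p) * (1 + p) * n)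
        ≤⟨ +-monoˡ-≤ (3 * ((1 + p) * (1 + p) * (1 + p) * n)) (≤-trans (*-monoˡ-≤ (7 + 9 * p + 3 * p * p) 3n≤p) (m≤m+n _ (3 + 2 * p))) ⟩
      p * (7 + 9 * p + 3 * p * p) + (3 + 2 * p) + 3 * ((1 + p) * (1 + p) * (1 + p) * n)
        ≡⟨ e₂ p n ⟩
      3 * ((1 + p) * (1 + p) * (1 + p) * (1 + n)) ∎)
      where
      e₁ : ∀ p n → 3 * ((1 + p + 1) * (1 + p + 1) * (1 + p + 1) * n) ≡ 3 * n * (7 + 9 * p + 3 * p * p) + 3 * ((1 + p) * (1 + p) * (1 + p) * n)
      e₁ = solve-∀
      e₂ : ∀ p n → p * (7 + 9 * p + 3 * p * p) + (3 + 2 * p) + 3 * ((1 + p) * (1 + p) * (1 + p) * n) ≡ 3 * ((1 + p) * (1 + p) * (1 + p) * (1 + n))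
      e₂ = solve-∀

-- Primes for which 2 has order at most y divide ∏ (2ⁿ - 1) over n ≤ y, which is at most 2^(y²).
-- Their product divides it too, and each is at least 2, so there are at most y² of them.
#big-order≤ : ∀ y ps → Descending ps → All OddPrime ps → #big (order≤? y) ps ≤ y * y
#big-order≤ y ps desc ops = ≤-trans (#big≤length (order≤? y) ps) (≮⇒≥ λ lt → <⇒≱ (^-monoʳ-< 2 (s≤s (s≤s z≤n)) lt) (begin
  2 ^ length qs  ≤⟨ 2^length≤product primes ⟩
  product qs  ≤⟨ ∣⇒≤ {{>-nonZero (mersenne>0 y)}} (distinct-primes-∣ (AllPairs.filter⁺ (order≤? y) desc) primes (All.map (order≤⇒∣ y) (All.all-filter (order≤? y) ps))) ⟩
  mersenne y  ≤⟨ mersenne≤ y ⟩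
  2 ^ (y * y)  ∎))
  where
  qs = filter (order≤? y) ps
  primes : All Prime qs
  primes = All.map proj₁ (All.filter⁺ (order≤? y) ops)

cube-cancel : ∀ a b → a * a * a ≤ b * b * b → a ≤ b
cube-cancel a b h = ≮⇒≥ λ b<a → <⇒≱ (*-mono-< (*-mono-< b<a b<a) b<a) h

weight-order≤ : ∀ a → 1 ≤ a → ∀ ps → Descending ps → All OddPrime ps →
  weight (order≤? (a * a * a)) ps ≤ 2 * (a * a) * product ps
weight-order≤ a a≥1 ps desc ops = cube-cancel W (2 * (a * a) * Q) (*-cancelˡ-≤ 27 (begin
  27 * (W * W * W)  ≤⟨ weight³≤ (order≤? y) ps desc ops ⟩
  64 * (suc (#big (order≤? y) ps) * (Q * Q * Q))  ≤⟨ *-monoʳ-≤ 64 (*-monoˡ-≤ (Q * Q * Q) (begin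
      suc (#big (order≤? y) ps)  ≤⟨ s≤s (#big-order≤ y ps desc ops) ⟩
      1 + y * y  ≤⟨ +-monoˡ-≤ (y * y) (*-mono-≤ y≥1 y≥1) ⟩
      y * y + y * y  ∎)) ⟩
  -- The surplus of 27 · 2³ = 216 over 64 · 2 = 128 is 88.
  64 * ((y * y + y * y) * (Q * Q * Q))  ≤⟨ m≤m+n _ (88 * (y * y * (Q * Q * Q))) ⟩
  64 * ((y * y + y * y) * (Q * Q * Q)) + 88 * (y * y * (Q * Q * Q))  ≡⟨ eq a Q ⟩
  27 * (2 * (a * a) * Q * (2 * (a * a) * Q) * (2 * (a * a) * Q)) ∎))
  where
  y = a * a * a
  y≥1 : 1 ≤ y
  y≥1 = *-mono-≤ (*-mono-≤ a≥1 a≥1) a≥1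
  W = weight (order≤? y) ps
  Q = product ps
  eq : ∀ a Q → 64 * ((a * a * a * (a * a * a) + a * a * a * (a * a * a)) * (Q * Q * Q)) + 88 * (a * a * a * (a * a * a) * (Q * Q * Q)) ≡
    27 * (2 * (a * a) * Q * (2 * (a * a) * Q) * (2 * (a * a) * Q))
  eq = solve-∀

geometric : ∀ J → ∑ (suc J) (λ j → 2 ^ (J ∸ j)) ≤ 2 * 2 ^ J
geometric zero    = s≤s z≤n
geometric (suc J) = begin
  ∑ (2 + J) (λ j → 2 ^ (suc J ∸ j))  ≡⟨ ∑-split 1 (suc J) (λ j → 2 ^ (suc J ∸ j)) ⟩
  2 ^ suc J + ∑ (suc J) (λ j → 2 ^ (J ∸ j))  ≤⟨ +-monoʳ-≤ (2 ^ suc J) (geometric J) ⟩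
  2 ^ suc J + 2 ^ suc J  ≡⟨ cong (2 ^ suc J +_) (+-identityʳ (2 ^ suc J)) ⟨
  2 * 2 ^ suc J  ∎

-- Expanding the products leaves, for each sublist d, 1/d times the number of exponents up to L for
-- which 2ⁿ ≡ 1 modulo d. `count-exponents` replaces this number by 8 L ∑ 8⁻ʲ over the j for which
-- all orders are at most 8ʲ. Summing back over d gives the weight of the primes of order at most
-- 8ʲ, at most 2 · 4ʲ, so the total is at most 16 L ∑ 2⁻ʲ ≤ 32 L.
average-weight : ∀ D L → ∑ L (λ n → weight (one? n) (oddPrimes D)) ≤ 32 * (L * product (oddPrimes D))
average-weight D L = *-cancelˡ-≤ (K * K * K) {{>-nonZero (*-mono-≤ (*-mono-≤ K≥1 K≥1) K≥1)}} (begin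
  K * K * K * ∑ L (λ n → weight (one? n) ps)
    ≡⟨ cong (K * K * K *_) (trans (∑-cong L λ n _ → sym (Ex-All (one? n) ps)) (sym (Ex-∑ ps L _))) ⟩
  K * K * K * Ex ps (λ d → ∑ L (λ n → ⟦ All.all? (one? n) d ⟧))
    ≡⟨ Ex-*ˡ ps (K * K * K) _ ⟨
  Ex ps (λ d → K * K * K * ∑ L (λ n → ⟦ All.all? (one? n) d ⟧))
    ≤⟨ Ex-mono ps (λ d → count-exponents d L L L≤K³) ⟩
  Ex ps (λ d → 8 * L * ∑ (suc L) (λ j → b j * b j * b j * ⟦ All.all? (order≤? (y j)) d ⟧))
    ≡⟨ trans (Ex-*ˡ ps (8 * L) _) (cong (8 * L *_) (trans (Ex-∑ ps (suc L) _)
         (∑-cong (suc L) λ j _ → trans (Ex-*ˡ ps (b j * b j * b j) _) (cong (b j * b j * b j *_) (Ex-All (order≤? (y j)) ps))))) ⟩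
  8 * L * ∑ (suc L) (λ j → b j * b j * b j * weight (order≤? (y j)) ps)
    ≤⟨ *-monoʳ-≤ (8 * L) (∑-mono (suc L) λ j j<1+L → term j (s≤s⁻¹ j<1+L)) ⟩
  8 * L * ∑ (suc L) (λ j → 2 * Q * (K * K) * b j)
    ≡⟨ cong (8 * L *_) (∑-*ˡ (suc L) (2 * Q * (K * K)) b) ⟩
  8 * L * (2 * Q * (K * K) * ∑ (suc L) b)
    ≤⟨ *-monoʳ-≤ (8 * L) (*-monoʳ-≤ (2 * Q * (K * K)) (geometric L)) ⟩
  8 * L * (2 * Q * (K * K) * (2 * K))
    ≡⟨ eq L Q K ⟩
  K * K * K * (32 * (L * Q)) ∎)
  where
  ps = oddPrimes D
  Q = product ps
  K = 2 ^ L
  K≥1 = m^n>0 2 L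
  b y : ℕ → ℕ
  b j = 2 ^ (L ∸ j)
  y j = 2 ^ j * 2 ^ j * 2 ^ j
  L≤K³ : L ≤ K * K * K
  L≤K³ = ≤-trans (<⇒≤ (n<2^n L)) (m≤n*m K (K * K) {{>-nonZero (*-mono-≤ K≥1 K≥1)}})
  eq : ∀ L Q K → 8 * L * (2 * Q * (K * K) * (2 * K)) ≡ K * K * K * (32 * (L * Q))
  eq = solve-∀
  eq₂ : ∀ a b Q → b * b * b * (2 * (a * a) * Q) ≡ 2 * Q * (a * b * (a * b)) * b
  eq₂ = solve-∀
  term : ∀ j → j ≤ L → b j * b j * b j * weight (order≤? (y j)) ps ≤ 2 * Q * (K * K) * b j
  term j j≤L = begin
    b j * b j * b j * weight (order≤? (y j)) ps
      ≤⟨ *-monoʳ-≤ (b j * b j * b j) (weight-order≤ (2 ^ j) (m^n>0 2 j) ps (select-desc oddPrime? D) (select-All oddPrime? D)) ⟩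
    b j * b j * b j * (2 * (2 ^ j * 2 ^ j) * Q)
      ≡⟨ eq₂ (2 ^ j) (b j) Q ⟩
    2 * Q * (2 ^ j * b j * (2 ^ j * b j)) * b j
      ≡⟨ cong (λ z → 2 * Q * (z * z) * b j) (trans (sym (^-distribˡ-+-* 2 j (L ∸ j))) (cong (2 ^_) (m+[n∸m]≡n j≤L))) ⟩
    2 * Q * (K * K) * b j ∎

-- Romanoff's theorem

coprime-sym : ∀ {m n} → Coprime m n → Coprime n m
coprime-sym c (a , b) = c (b , a)

prime-coprime : ∀ {p m} → Prime p → ¬ p ∣ m → Coprime p m
prime-coprime pp p∤m (d∣p , d∣m) = [ id , (λ d≡p → contradiction (subst (_∣ _) d≡p d∣m) p∤m) ]′ (prime⇒irreducible pp d∣p)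

oddPrime-∤2^ : ∀ {p} → OddPrime p → ∀ k → ¬ p ∣ 2 ^ k
oddPrime-∤2^ (pp , _)   zero    p∣1 = ¬prime[1] (subst Prime (∣1⇒≡1 p∣1) pp)
oddPrime-∤2^ (pp , p≢2) (suc k) p∣  = [ (λ p∣2 → p≢2 (prime-∣-prime pp prime[2] p∣2)) , oddPrime-∤2^ (pp , p≢2) k ]′ (euclidsLemma 2 (2 ^ k) pp p∣)

descending-primes-coprime : ∀ {ps} → Descending ps → All OddPrime ps → AllPairs Coprime ps
descending-primes-coprime []          []         = []
descending-primes-coprime (<p ∷ desc) (op ∷ ops) =
  coprimes <p ops ∷ descending-primes-coprime desc ops
  where
  coprimes : ∀ {qs} → All (_< _) qs → All OddPrime qs → All (Coprime _) qs
  coprimes []           []         = []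
  coprimes {q ∷ qs} (q<p ∷ <p) (oq ∷ oqs) = prime-coprime (proj₁ op) (λ p∣q → <⇒≢ q<p (sym (prime-∣-prime (proj₁ op) (proj₁ oq) p∣q))) ∷ coprimes <p oqs

oddPrimes-coprime : ∀ D → AllPairs Coprime (oddPrimes D)
oddPrimes-coprime D = descending-primes-coprime (select-desc oddPrime? D) (select-All oddPrime? D)

residue : ℕ → ℕ → ℕ → ℕ → ℕ → ℕ
residue c M α p n = ⟦ cong? p (c + M * n) α ⟧

residue-periodic : ∀ c M α p → Periodic p (residue c M α p)
residue-periodic c M α p n = ⟦⟧-cong (cong? p (c + M * (n + p)) α) (cong? p (c + M * n) α)
  (cong-trans (cong-sym shift)) (cong-trans shift)
  where
  eq : ∀ c M n p → (c + M * n) + p * M ≡ c + M * (n + p)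
  eq = solve-∀
  shift : Cong p (c + M * (n + p)) (c + M * n)
  shift = cong-trans (cong-reflexive (sym (eq c M n p))) (cong-p* (c + M * n) M)

residue-mean : ∀ c M α p → 1 ≤ p → Coprime M p → ∀ m → Coprime m p → ∀ j → ∑ p (λ i → residue c M α p (i * m + j)) ≡ 1
residue-mean c M α p p≥1 M⊥p m m⊥p j = ≤-antisym
  (∑-unique p (λ i → cong? p (c + M * (i * m + j)) α) λ i k i<p k<p x y →
    cong-< i<p k<p (cong-cancel-* i k (coprime-sym Mm⊥p) (cong-+-cancelˡ (c + M * j)
      (subst₂ (Cong p) (eq c M i m j) (eq c M k m j) (cong-trans x (cong-sym y))))))
  exists
  where
  Mm⊥p : Coprime (M * m) p
  Mm⊥p = coprime-* {M} {m} {p} M⊥p m⊥p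
  eq : ∀ c M i m j → c + M * (i * m + j) ≡ (c + M * j) + M * m * i
  eq = solve-∀
  exists : 1 ≤ ∑ p (λ i → residue c M α p (i * m + j))
  exists with solve-mod {{>-nonZero p≥1}} Mm⊥p (c + M * j) α
  ... | t , t<p , h = ≤-trans (≤-reflexive (sym (⟦⟧-yes (cong? p (c + M * (t * m + j)) α) (subst (λ z → Cong p z α) (sym (eq c M t m j)) h))))
                        (term≤∑ p (λ i → residue c M α p (i * m + j)) t t<p)

residue-local : ∀ c M α p → 1 ≤ p → Coprime M p → Local p 1 (residue c M α p)
residue-local c M α p p≥1 M⊥p = record
  { δ-periodic = residue-periodic c M α p
  ; δ≤1        = λ n → ⟦⟧≤1 (cong? p (c + M * n) α)
  ; δ≤w        = λ n → ⟦⟧≤1 (cong? p (c + M * n) α)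
  ; δ-mean     = residue-mean c M α p p≥1 M⊥p
  }

two-residues-local : ∀ c M α β p → 1 ≤ p → Coprime M p → ¬ Cong p α β →
  Local p 2 (λ n → residue c M α p n + residue c M β p n)
two-residues-local c M α β p p≥1 M⊥p α≢β = record
  { δ-periodic = λ n → cong₂ _+_ (residue-periodic c M α p n) (residue-periodic c M β p n)
  ; δ≤1        = at-most-one
  ; δ≤w        = λ n → m≤n⇒m≤1+n (at-most-one n)
  ; δ-mean     = λ m m⊥p j → trans (∑-+ p _ _) (cong₂ _+_ (residue-mean c M α p p≥1 M⊥p m m⊥p j) (residue-mean c M β p p≥1 M⊥p m m⊥p j))
  }
  where
  at-most-one : ∀ n → residue c M α p n + residue c M β p n ≤ 1
  at-most-one n with cong? p (c + M * n) α | cong? p (c + M * n) β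
  ... | yes x | yes y = contradiction (cong-trans (cong-sym x) y) α≢β
  ... | yes _ | no _  = ≤-refl
  ... | no _  | yes _ = ≤-refl
  ... | no _  | no _  = z≤n

-- For representations whose prime is at most D: the sieve by the primes up to D does not see them,
-- and there are at most D of them.
∑-window : ∀ N c D → ∑ N (λ n → ⟦ (1 ≤? n ∸ c) ×-dec (n ∸ c ≤? D) ⟧) ≤ D
∑-window N c D = begin
  ∑ N f  ≤⟨ ∑-monoˡ f (m≤n+m N (suc c + D)) ⟩
  ∑ (suc c + D + N) f  ≡⟨ ∑-split (suc c + D) N f ⟩
  ∑ (suc c + D) f + ∑ N (λ i → f (suc c + D + i))  ≡⟨ cong₂ _+_ (∑-split (suc c) D f) (∑-zero N above) ⟩
  ∑ (suc c) f + ∑ D (λ i → f (suc c + i)) + 0  ≤⟨ +-monoˡ-≤ 0 (+-mono-≤ (≤-reflexive (∑-zero (suc c) below)) (∑-≤const D 1 λ i _ → ⟦⟧≤1 _)) ⟩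
  D * 1 + 0  ≡⟨ trans (+-identityʳ _) (*-identityʳ D) ⟩
  D  ∎
  where
  f : ℕ → ℕ
  f n = ⟦ (1 ≤? n ∸ c) ×-dec (n ∸ c ≤? D) ⟧
  below : ∀ i → i < suc c → f i ≡ 0
  below i i≤c = ⟦⟧-no ((1 ≤? i ∸ c) ×-dec (i ∸ c ≤? D)) λ (1≤ , _) → <⇒≱ 1≤ (≤-reflexive (m≤n⇒m∸n≡0 (s≤s⁻¹ i≤c)))
  above : ∀ i → i < N → f (suc c + D + i) ≡ 0
  above i _ = ⟦⟧-no ((1 ≤? (suc c + D + i) ∸ c) ×-dec ((suc c + D + i) ∸ c ≤? D)) λ (_ , ≤D) →
    <⇒≱ (≤-trans (s≤s (m≤m+n D i)) (≤-reflexive (sym (trans (cong (_∸ c) (eq c D i)) (m+n∸m≡n c (suc (D + i))))))) ≤D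
    where
    eq : ∀ c D i → 1 + c + D + i ≡ c + (1 + (D + i))
    eq = solve-∀

OddPrime> : ℕ → ℕ → Set
OddPrime> D p = OddPrime p × D < p

oddPrime>? : ∀ D p → Dec (OddPrime> D p)
oddPrime>? D p = oddPrime? p ×-dec (suc D ≤? p)

oddPrime-split : ∀ D n c → ⟦ oddPrime? (n ∸ c) ⟧ ≤ ⟦ (1 ≤? n ∸ c) ×-dec (n ∸ c ≤? D) ⟧ + ⟦ oddPrime>? D (n ∸ c) ⟧
oddPrime-split D n c = ⟦⟧-bound (oddPrime? (n ∸ c)) λ op → lemma op (n ∸ c ≤? D)
  where
  lemma : OddPrime (n ∸ c) → Dec (n ∸ c ≤ D) → 1 ≤ ⟦ (1 ≤? n ∸ c) ×-dec (n ∸ c ≤? D) ⟧ + ⟦ oddPrime>? D (n ∸ c) ⟧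
  lemma op (yes ≤D) = ≤-trans (≤-reflexive (sym (⟦⟧-yes ((1 ≤? n ∸ c) ×-dec (n ∸ c ≤? D)) (<⇒≤ (oddPrime≥2 _ op) , ≤D)))) (m≤m+n _ _)
  lemma op (no ≰D)  = ≤-trans (≤-reflexive (sym (⟦⟧-yes (oddPrime>? D (n ∸ c)) (op , ≰⇒> ≰D)))) (m≤n+m _ _)

prime-unsifted : ∀ {D c M α p n} → OddPrime> D ((c + M * n) ∸ α) → Prime p → p ≤ D → residue c M α p n ≡ 0
prime-unsifted {D} {c} {M} {α} {p} {n} ((pr , _) , D<) pp p≤D = ⟦⟧-no (cong? p (c + M * n) α) λ h →
  <⇒≢ (≤-<-trans p≤D D<) (prime-∣-prime pp pr (cong-∸ (<⇒≤ (m∸n≢0⇒n<m λ ≡0 → ¬prime[0] (subst Prime ≡0 pr))) h))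

-- The sieve removes n ≡ α and n ≡ β modulo each odd prime p ≤ D. The two classes coincide exactly
-- when p ∣ 2^(i - j) - 1, that is when `e p` is 1; then `w p` is 1 instead of 2, and `f` measures
-- the loss.
module Pair (s : ℕ) (s≥1 : 1 ≤ s) (N i j : ℕ) (j<i : j < i) where

  -- The cutoff is a product because `G-convolve` bounds `G` at y * z from sums at y and at z.
  D = 2 ^ s * 2 ^ s
  ps = oddPrimes D
  Q = product ps
  α = 2 ^ suc i
  β = 2 ^ suc j
  f = weight (one? (i ∸ suc j)) ps

  e u w : ℕ → ℕ
  e p = ⟦ one? (i ∸ suc j) p ⟧
  u p = 1 ∸ e p
  w p = 1 + u p

  δ : ℕ → ℕ → ℕ
  δ p n = residue 0 1 α p n + u p * residue 0 1 β p n

  u+e : ∀ p → u p + e p ≡ 1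
  u+e p = m∸n+n≡m (⟦⟧≤1 (one? (i ∸ suc j) p))

  local : ∀ {p} → OddPrime p → Local p (w p) (δ p)
  local {p} op = by-cases (one? (i ∸ suc j) p)
    where
    1⊥p : Coprime 1 p
    1⊥p (d∣1 , _) = ∣1⇒≡1 d∣1
    p≥1 = <⇒≤ (oddPrime≥2 p op)
    α≡ : α ≡ β * 2 ^ suc (i ∸ suc j)
    α≡ = trans (cong (2 ^_) (trans (sym (m+[n∸m]≡n {suc j} {suc i} (s≤s (<⇒≤ j<i)))) (cong (suc j +_) (+-∸-assoc 1 j<i)))) (^-distribˡ-+-* 2 (suc j) _)
    by-cases : (d : Dec (One (i ∸ suc j) p)) → Local p (1 + (1 ∸ ⟦ d ⟧)) (λ n → residue 0 1 α p n + (1 ∸ ⟦ d ⟧) * residue 0 1 β p n)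
    by-cases (yes _) = record
      { δ-periodic = λ n → cong (_+ 0) (δ-periodic n)
      ; δ≤1        = λ n → ≤-trans (≤-reflexive (+-identityʳ _)) (δ≤1 n)
      ; δ≤w        = λ n → ≤-trans (≤-reflexive (+-identityʳ _)) (δ≤w n)
      ; δ-mean     = λ m m⊥p k → trans (∑-cong p λ _ _ → +-identityʳ _) (δ-mean m m⊥p k)
      }
      where open Local (residue-local 0 1 α p p≥1 1⊥p)
    by-cases (no ¬one) = record
      { δ-periodic = λ n → cong₂ _+_ (residue-periodic 0 1 α p n) (cong (1 *_) (residue-periodic 0 1 β p n))
      ; δ≤1        = λ n → ≤-trans (≤-reflexive (eq n)) (δ≤1 n)
      ; δ≤w        = λ n → ≤-trans (≤-reflexive (eq n)) (δ≤w n)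
      ; δ-mean     = λ m m⊥p k → trans (∑-cong p λ l _ → eq (l * m + k)) (δ-mean m m⊥p k)
      }
      where
      open Local (two-residues-local 0 1 α β p p≥1 1⊥p λ h → ¬one (cong-cancel-* (2 ^ suc (i ∸ suc j)) 1 (prime-coprime (proj₁ op) (oddPrime-∤2^ op (suc j)))
        (cong-trans (cong-reflexive (sym α≡)) (cong-trans h (cong-reflexive (sym (*-identityʳ β)))))))
      eq : ∀ n → residue 0 1 α p n + 1 * residue 0 1 β p n ≡ residue 0 1 α p n + residue 0 1 β p n
      eq n = cong (residue 0 1 α p n +_) (*-identityˡ _)

  open Sieve w δ using (Admissible; sieve-bound)

  admissible : All Admissible ps
  admissible = All.map (λ {p} op → <⇒≤ (oddPrime≥2 p op) , local op) (select-All oddPrime? D)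

  g = G w ps D

  Q≥1 : 1 ≤ Q
  Q≥1 = product>0 (select-≥1 oddPrime? D)

  D≥1 : 1 ≤ D
  D≥1 = *-mono-≤ (m^n>0 2 s) (m^n>0 2 s)

  -- As w = 1 + u, the sum `g` is at least the product of the sums for `one` and `u` up to 2^s,
  -- apart from ∏ (1 + 1/p²) ≤ 2. The first is at least s Q / 8, the second also, apart from the
  -- loss f / Q of `G-thin`; 128 = 8 · 8 · 2.
  s²Q²≤ : s * Q * (s * Q) ≤ 128 * (g * f)
  s²Q²≤ = begin
    s * Q * (s * Q)  ≤⟨ *-mono-≤ sQ≤ sQ≤ ⟩
    8 * A * (8 * A)  ≡⟨ eq₁ A ⟩
    64 * (A * A)  ≤⟨ *-monoʳ-≤ 64 (*-cancelʳ-≤ (A * A) (2 * (g * f)) (Q * Q) {{>-nonZero (*-mono-≤ Q≥1 Q≥1)}} (begin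
      A * A * (Q * Q)  ≡⟨ eq₂ A Q ⟩
      Q * A * (A * Q)  ≤⟨ *-monoʳ-≤ (Q * A) (G-thin u+e ps (2 ^ s)) ⟩
      Q * A * (B * f)  ≡⟨ eq₃ Q A B f ⟩
      Q * (A * B) * f  ≤⟨ *-monoˡ-≤ f (≤-trans (G-convolve (λ p → m∸n≤m 1 (e p)) ps (2 ^ s) (2 ^ s))
                                  (*-monoˡ-≤ g (product[p²+1]≤ oddPrime? oddPrime≥2 D))) ⟩
      2 * (Q * Q) * g * f  ≡⟨ eq₄ Q g f ⟩
      2 * (g * f) * (Q * Q)  ∎)) ⟩
    64 * (2 * (g * f))  ≡⟨ *-assoc 64 2 (g * f) ⟨
    128 * (g * f)  ∎
    where
    A = G one ps (2 ^ s)
    B = G u ps (2 ^ s)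
    sQ≤ : s * Q ≤ 8 * A
    sQ≤ = G-lower s D (m≤m*n (2 ^ s) (2 ^ s) {{>-nonZero (m^n>0 2 s)}})
    eq₁ : ∀ A → 8 * A * (8 * A) ≡ 64 * (A * A)
    eq₁ = solve-∀
    eq₂ : ∀ A Q → A * A * (Q * Q) ≡ Q * A * (A * Q)
    eq₂ = solve-∀
    eq₃ : ∀ Q A B f → Q * A * (B * f) ≡ Q * (A * B) * f
    eq₃ = solve-∀
    eq₄ : ∀ Q g f → 2 * (Q * Q) * g * f ≡ 2 * (g * f) * (Q * Q)
    eq₄ = solve-∀

  both? : ∀ n → Dec (OddPrime> D ((0 + 1 * n) ∸ α) × OddPrime> D ((0 + 1 * n) ∸ β))
  both? n = oddPrime>? D ((0 + 1 * n) ∸ α) ×-dec oddPrime>? D ((0 + 1 * n) ∸ β)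

  sifted : ℕ
  sifted = ∑ N (λ n → ⟦ both? n ⟧)

  sifted-bound : (sifted ∸ D * D * (D * D)) * (s * s * Q) ≤ 128 * (N * f)
  sifted-bound = *-cancelʳ-≤ _ _ Q {{>-nonZero Q≥1}} (begin
    a * (s * s * Q) * Q  ≡⟨ eq₁ a s Q ⟩
    a * (s * Q * (s * Q))  ≤⟨ *-monoʳ-≤ a s²Q²≤ ⟩
    a * (128 * (g * f))  ≡⟨ eq₂ a g f ⟩
    128 * (a * g * f)  ≤⟨ *-monoʳ-≤ 128 (*-monoˡ-≤ f ag≤) ⟩
    128 * (N * Q * f)  ≡⟨ eq₃ N Q f ⟩
    128 * (N * f) * Q  ∎)
    where
    -- The truncated difference absorbs the error D⁴ of the sieve, so that the main term can be
    -- treated alone.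
    a = sifted ∸ D * D * (D * D)
    eq₁ : ∀ a s Q → a * (s * s * Q) * Q ≡ a * (s * Q * (s * Q))
    eq₁ = solve-∀
    eq₂ : ∀ a g f → a * (128 * (g * f)) ≡ 128 * (a * g * f)
    eq₂ = solve-∀
    eq₃ : ∀ N Q f → 128 * (N * Q * f) ≡ 128 * (N * f) * Q
    eq₃ = solve-∀
    ag≤ : a * g ≤ N * Q
    ag≤ = begin
      (sifted ∸ D * D * (D * D)) * g  ≡⟨ *-distribʳ-∸ g sifted (D * D * (D * D)) ⟩
      sifted * g ∸ D * D * (D * D) * g  ≤⟨ ∸-monoˡ-≤ (D * D * (D * D) * g)
        (sieve-bound (oddPrimes-coprime D) admissible N D≥1 both? λ n (x , y) → All.zipWith (λ {p} (op , p≤D) →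
          trans (cong₂ (λ a b → a + u p * b) (prime-unsifted {c = 0} {M = 1} x (proj₁ op) p≤D) (prime-unsifted {c = 0} {M = 1} y (proj₁ op) p≤D)) (*-zeroʳ (u p)))
          (select-All oddPrime? D , select-≤ oddPrime? D)) ⟩
      N * Q + D * D * (D * D) * g ∸ D * D * (D * D) * g  ≡⟨ m+n∸n≡m (N * Q) (D * D * (D * D) * g) ⟩
      N * Q  ∎

  pair-bound : ∑ N (λ n → ⟦ oddPrime? (n ∸ α) ⟧ * ⟦ oddPrime? (n ∸ β) ⟧) * (s * s * Q) ≤
    (2 * D + D * D * (D * D)) * (s * s * Q) + 128 * (N * f)
  pair-bound = begin
    T * t  ≤⟨ *-monoˡ-≤ t T≤ ⟩
    (2 * D + (D * D * (D * D) + a)) * t  ≡⟨ eq (2 * D) (D * D * (D * D)) a t ⟩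
    (2 * D + D * D * (D * D)) * t + a * t  ≤⟨ +-monoʳ-≤ ((2 * D + D * D * (D * D)) * t) sifted-bound ⟩
    (2 * D + D * D * (D * D)) * t + 128 * (N * f)  ∎
    where
    t = s * s * Q
    a = sifted ∸ D * D * (D * D)
    T = ∑ N (λ n → ⟦ oddPrime? (n ∸ α) ⟧ * ⟦ oddPrime? (n ∸ β) ⟧)
    eq : ∀ x y a t → (x + (y + a)) * t ≡ (x + y) * t + a * t
    eq = solve-∀
    small : ℕ → ℕ → ℕ
    small c n = ⟦ (1 ≤? n ∸ c) ×-dec (n ∸ c ≤? D) ⟧
    both : ∀ n → ⟦ oddPrime>? D (n ∸ α) ⟧ * ⟦ oddPrime>? D (n ∸ β) ⟧ ≤ ⟦ both? n ⟧
    both n = lemma (oddPrime>? D (n ∸ α)) (oddPrime>? D (n ∸ β))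
      where
      1*n : 0 + 1 * n ≡ n
      1*n = *-identityˡ n
      lemma : (x : Dec (OddPrime> D (n ∸ α))) (y : Dec (OddPrime> D (n ∸ β))) → ⟦ x ⟧ * ⟦ y ⟧ ≤ ⟦ both? n ⟧
      lemma (no _)  _       = z≤n
      lemma (yes _) (no _)  = z≤n
      lemma (yes x) (yes y) = ≤-reflexive (sym (⟦⟧-yes (both? n) (subst (λ z → OddPrime> D (z ∸ α)) (sym 1*n) x , subst (λ z → OddPrime> D (z ∸ β)) (sym 1*n) y)))
    cases : ∀ {x y a b c d} → x ≤ 1 → y ≤ 1 → x ≤ a + c → y ≤ b + d → x * y ≤ a + b + c * d
    cases {zero}                  _ _ _ _ = z≤n
    cases {suc zero} {zero}       _ _ _ _ = z≤n
    cases {suc zero} {suc zero} {zero}  {zero}  _ _ x≤ y≤ = *-mono-≤ x≤ y≤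
    cases {suc zero} {suc zero} {zero}  {suc b} _ _ x≤ y≤ = s≤s z≤n
    cases {suc zero} {suc zero} {suc a}         _ _ x≤ y≤ = s≤s z≤n
    cases {suc (suc _)}           (s≤s ()) _ _ _
    cases {suc zero} {suc (suc _)} _ (s≤s ()) _ _
    T≤ : T ≤ 2 * D + (D * D * (D * D) + a)
    T≤ = begin
      T
        ≤⟨ ∑-mono N (λ n _ → cases {a = small α n} {small β n} {⟦ oddPrime>? D (n ∸ α) ⟧} {⟦ oddPrime>? D (n ∸ β) ⟧} (⟦⟧≤1 (oddPrime? (n ∸ α))) (⟦⟧≤1 (oddPrime? (n ∸ β))) (oddPrime-split D n α) (oddPrime-split D n β)) ⟩
      ∑ N (λ n → small α n + small β n + ⟦ oddPrime>? D (n ∸ α) ⟧ * ⟦ oddPrime>? D (n ∸ β) ⟧)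
        ≤⟨ ∑-mono N (λ n _ → +-monoʳ-≤ (small α n + small β n) (both n)) ⟩
      ∑ N (λ n → small α n + small β n + ⟦ both? n ⟧)
        ≡⟨ trans (∑-+ N (λ n → small α n + small β n) (λ n → ⟦ both? n ⟧)) (cong (_+ sifted) (∑-+ N (small α) (small β))) ⟩
      ∑ N (small α) + ∑ N (small β) + sifted
        ≤⟨ +-mono-≤ (+-mono-≤ (∑-window N α D) (∑-window N β D)) (m≤n+m∸n sifted (D * D * (D * D))) ⟩
      D + D + (D * D * (D * D) + a)
        ≡⟨ cong (λ z → D + z + (D * D * (D * D) + a)) (sym (+-identityʳ D)) ⟩
      2 * D + (D * D * (D * D) + a) ∎

-- The second moment of the number of representations

∑-reverse : ∀ n (g : ℕ → ℕ) → ∑ n (λ j → g (n ∸ suc j)) ≡ ∑ n g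
∑-reverse zero    g = refl
∑-reverse (suc n) g = trans (∑-split 1 n (λ j → g (suc n ∸ suc j))) (trans (cong (g n +_) (∑-reverse n g)) (+-comm (g n) _))

∑-square : ∀ n (a : ℕ → ℕ) → (∀ i → a i ≤ 1) → ∑ n a * ∑ n a ≤ ∑ n a + 2 * ∑ n (λ i → ∑ i (λ j → a i * a j))
∑-square zero    a a≤1 = z≤n
∑-square (suc n) a a≤1 = begin
  (R + a n) * (R + a n)  ≡⟨ eq₁ R (a n) ⟩
  R * R + (2 * (a n * R) + a n * a n)  ≤⟨ +-mono-≤ (∑-square n a a≤1) (+-mono-≤ (≤-reflexive (cong (2 *_) (sym (∑-*ˡ n (a n) a))))
                                              (≤-trans (*-monoʳ-≤ (a n) (a≤1 n)) (≤-reflexive (*-identityʳ (a n))))) ⟩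
  R + 2 * P + (2 * ∑ n (λ j → a n * a j) + a n)  ≡⟨ eq₂ R P _ (a n) ⟩
  R + a n + 2 * (P + ∑ n (λ j → a n * a j)) ∎
  where
  R = ∑ n a
  P = ∑ n (λ i → ∑ i (λ j → a i * a j))
  eq₁ : ∀ R a → (R + a) * (R + a) ≡ R * R + (2 * (a * R) + a * a)
  eq₁ = solve-∀
  eq₂ : ∀ R P x a → R + 2 * P + (2 * x + a) ≡ R + a + 2 * (P + x)
  eq₂ = solve-∀

2ab≤a²+b² : ∀ a b → 2 * a * b ≤ a * a + b * b
2ab≤a²+b² a b = [ ordered a b , (λ b≤a → subst₂ _≤_ (eq b a) (+-comm (b * b) (a * a)) (ordered b a b≤a)) ]′ (≤-total a b)
  where
  eq : ∀ a b → 2 * a * b ≡ 2 * b * a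
  eq = solve-∀
  ordered : ∀ a b → a ≤ b → 2 * a * b ≤ a * a + b * b
  ordered a b a≤b = subst (λ b → 2 * a * b ≤ a * a + b * b) (m+[n∸m]≡n a≤b)
    (≤-trans (m≤m+n _ ((b ∸ a) * (b ∸ a))) (≤-reflexive (eq₂ a (b ∸ a))))
    where
    eq₂ : ∀ a d → 2 * a * (a + d) + d * d ≡ a * a + (a + d) * (a + d)
    eq₂ = solve-∀

-- Truncated subtraction does no harm, as 0 is not prime. The prime 2 is left out because 2 + 2^k is
-- even and so never competes with 𝒰.
Rep : ℕ → ℕ → Set
Rep L n = ∃ λ i → i < L × OddPrime (n ∸ 2 ^ suc i)

rep? : ∀ L n → Dec (Rep L n)
rep? L n = anyUpTo? (λ i → oddPrime? (n ∸ 2 ^ suc i)) L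

primeAt : ℕ → ℕ → ℕ
primeAt i n = ⟦ oddPrime? (n ∸ 2 ^ suc i) ⟧

representations pairs : ℕ → ℕ → ℕ
representations L n = ∑ L (λ i → primeAt i n)
pairs           L n = ∑ L (λ i → ∑ i (λ j → primeAt i n * primeAt j n))

-- 2 K r ≤ K² + r² takes the place of the Cauchy-Schwarz inequality: it can be summed over n at
-- once, and K is chosen afterwards.
second-moment : ∀ K L n → 2 * K * representations L n ≤ K * K * ⟦ rep? L n ⟧ + (representations L n + 2 * pairs L n)
second-moment K L n with rep? L n
... | no none = ≤-trans (≤-reflexive (trans (cong (2 * K *_) (∑-zero L λ i i<L → ⟦⟧-no (oddPrime? (n ∸ 2 ^ suc i)) λ op → none (i , i<L , op))) (*-zeroʳ (2 * K)))) z≤n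
... | yes _   = ≤-trans (2ab≤a²+b² K (representations L n)) (+-mono-≤ (≤-reflexive (sym (*-identityʳ (K * K))))
                  (∑-square L (λ i → primeAt i n) λ i → ⟦⟧≤1 (oddPrime? (n ∸ 2 ^ suc i))))

∑-second-moment : ∀ K L N → 2 * K * ∑ N (representations L) ≤ K * K * ∑ N (λ n → ⟦ rep? L n ⟧) + (∑ N (representations L) + 2 * ∑ N (pairs L))
∑-second-moment K L N = begin
  2 * K * ∑ N (representations L)
    ≡⟨ ∑-*ˡ N (2 * K) (representations L) ⟨
  ∑ N (λ n → 2 * K * representations L n)
    ≤⟨ ∑-mono N (λ n _ → second-moment K L n) ⟩
  ∑ N (λ n → K * K * ⟦ rep? L n ⟧ + (representations L n + 2 * pairs L n))
    ≡⟨ trans (∑-+ N _ _) (cong₂ _+_ (∑-*ˡ N (K * K) _) (trans (∑-+ N (representations L) _) (cong (∑ N (representations L) +_) (∑-*ˡ N 2 (pairs L))))) ⟩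
  K * K * ∑ N (λ n → ⟦ rep? L n ⟧) + (∑ N (representations L) + 2 * ∑ N (pairs L)) ∎

-- With y = 2^s, one pair has sieve error D⁴ = y⁸ up to a constant, there are at most 100 s² pairs,
-- and s² ≤ y²; this is why N ≥ y¹⁰ is required. In the main term the differences i - j for fixed i
-- run through 1 to i, so `average-weight` applies.
pairs-bound : ∀ s → 1 ≤ s → ∀ L → L ≤ 10 * s → ∀ N → 2 ^ s * 2 ^ s * (2 ^ s * 2 ^ s) * (2 ^ s * 2 ^ s * (2 ^ s * 2 ^ s)) * (2 ^ s * 2 ^ s) ≤ N →
  ∑ N (pairs L) ≤ 100 * (3 * N + 128 * (32 * N))
pairs-bound s s≥1 L L≤ N y¹⁰≤N = *-cancelʳ-≤ _ _ (s * s * Q) {{>-nonZero (*-mono-≤ (*-mono-≤ s≥1 s≥1) (product>0 (select-≥1 oddPrime? D)))}} (begin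
  ∑ N (pairs L) * t
    ≡⟨ cong (_* t) (trans (∑-swap N L _) (∑-cong L λ i _ → ∑-swap N i _)) ⟩
  ∑ L (λ i → ∑ i (λ j → ∑ N (λ n → primeAt i n * primeAt j n))) * t
    ≡⟨ trans (sym (∑-*ʳ L t _)) (∑-cong L λ i _ → sym (∑-*ʳ i t _)) ⟩
  ∑ L (λ i → ∑ i (λ j → ∑ N (λ n → primeAt i n * primeAt j n) * t))
    ≤⟨ ∑-mono L (λ i i<L → ∑-mono i λ j j<i → Pair.pair-bound s s≥1 N i j j<i) ⟩
  ∑ L (λ i → ∑ i (λ j → E * t + 128 * (N * f (i ∸ suc j))))
    ≤⟨ ∑-≤const L (L * (E * t) + 128 * (N * (32 * (L * Q)))) row ⟩
  L * (L * (E * t) + 128 * (N * (32 * (L * Q))))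
    ≡⟨ eq₁ L E t N Q 128 32 ⟩
  L * L * (E * t + 128 * (32 * N) * Q)
    ≤⟨ *-monoˡ-≤ (E * t + 128 * (32 * N) * Q) (*-mono-≤ L≤ L≤) ⟩
  10 * s * (10 * s) * (E * t + 128 * (32 * N) * Q)
    ≡⟨ eq₂ s E N Q (128 * (32 * N)) ⟩
  100 * (E * (s * s) + 128 * (32 * N)) * t
    ≤⟨ *-monoˡ-≤ t (*-monoʳ-≤ 100 (+-monoˡ-≤ (128 * (32 * N)) Es²≤)) ⟩
  100 * (3 * N + 128 * (32 * N)) * t ∎)
  where
  y = 2 ^ s
  D = y * y
  Q = product (oddPrimes D)
  t = s * s * Q
  E = 2 * D + D * D * (D * D)
  f : ℕ → ℕ
  f n = weight (one? n) (oddPrimes D)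
  row : ∀ i → i < L → ∑ i (λ j → E * t + 128 * (N * f (i ∸ suc j))) ≤ L * (E * t) + 128 * (N * (32 * (L * Q)))
  row i i<L = begin
    ∑ i (λ j → E * t + 128 * (N * f (i ∸ suc j)))
      ≡⟨ trans (∑-+ i _ _) (cong₂ _+_ (∑-const i (E * t)) (trans (∑-*ˡ i 128 _) (cong (128 *_) (trans (∑-*ˡ i N _) (cong (N *_) (∑-reverse i f)))))) ⟩
    i * (E * t) + 128 * (N * ∑ i f)
      ≤⟨ +-mono-≤ (*-monoˡ-≤ (E * t) (<⇒≤ i<L)) (*-monoʳ-≤ 128 (*-monoʳ-≤ N (≤-trans (∑-monoˡ f (<⇒≤ i<L)) (average-weight D L)))) ⟩
    L * (E * t) + 128 * (N * (32 * (L * Q))) ∎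
  eq₁ : ∀ L E t N Q b c → L * (L * (E * t) + b * (N * (c * (L * Q)))) ≡ L * L * (E * t + b * (c * N) * Q)
  eq₁ = solve-∀
  eq₂ : ∀ s E N Q c → 10 * s * (10 * s) * (E * (s * s * Q) + c * Q) ≡ 100 * (E * (s * s) + c) * (s * s * Q)
  eq₂ = solve-∀
  D≥1 : 1 ≤ D
  D≥1 = *-mono-≤ (m^n>0 2 s) (m^n>0 2 s)
  Es²≤ : E * (s * s) ≤ 3 * N
  Es²≤ = begin
    E * (s * s)  ≤⟨ *-mono-≤ (+-monoˡ-≤ (D * D * (D * D)) (*-monoʳ-≤ 2 (≤-trans (m≤m*n D (D * (D * D)) {{>-nonZero (*-mono-≤ D≥1 (*-mono-≤ D≥1 D≥1))}}) (≤-reflexive (sym (*-assoc D D (D * D)))))))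
                                                (*-mono-≤ (<⇒≤ (n<2^n s)) (<⇒≤ (n<2^n s))) ⟩
    (2 * (D * D * (D * D)) + D * D * (D * D)) * (y * y)  ≡⟨ eq₃ (D * D * (D * D)) (y * y) ⟩
    3 * (D * D * (D * D) * (y * y))  ≤⟨ *-monoʳ-≤ 3 y¹⁰≤N ⟩
    3 * N  ∎
    where
    eq₃ : ∀ x z → (2 * x + x) * z ≡ 3 * (x * z)
    eq₃ = solve-∀

-- Each of the L + 1 exponents contributes every odd prime up to 2^(L+1), since the sums stay below
-- 2^(L+2). `chebyshev` makes this at least 2^L - (L + 1) representations, and L ≥ 8 allows the loss
-- L + 1 to be absorbed.
representations-lower : ∀ L → 8 ≤ L → 4 * 2 ^ L ≤ 8 * ∑ (suc (4 * 2 ^ L)) (representations (suc L))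
representations-lower L 8≤L = +-cancelˡ-≤ (4 * 2 ^ L) _ _ (begin
  4 * 2 ^ L + 4 * 2 ^ L  ≡⟨ eq₁ (2 ^ L) ⟩
  8 * 2 ^ L  ≤⟨ *-monoʳ-≤ 8 (begin
      2 ^ L  ≤⟨ chebyshev L ⟩
      suc L * suc π  ≡⟨ *-suc (suc L) π ⟩
      suc L + suc L * π  ≤⟨ +-monoʳ-≤ (suc L) (≤-trans (≤-reflexive (sym (∑-const (suc L) π))) (∑-mono (suc L) λ i i≤L → shifted i i≤L)) ⟩
      suc L + ∑ (suc L) (λ i → ∑ (suc N) (primeAt i))  ≡⟨ cong (suc L +_) (∑-swap (suc L) (suc N) primeAt) ⟩
      suc L + X  ∎) ⟩
  8 * (suc L + X)  ≡⟨ *-distribˡ-+ 8 (suc L) X ⟩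
  8 * suc L + 8 * X  ≤⟨ +-monoˡ-≤ (8 * X) 8ℓ≤ ⟩
  4 * 2 ^ L + 8 * X  ∎)
  where
  N = 4 * 2 ^ L
  X = ∑ (suc N) (representations (suc L))
  π = ∑ (2 ^ suc L) (λ i → ⟦ oddPrime? (suc i) ⟧)
  eq₁ : ∀ x → 4 * x + 4 * x ≡ 8 * x
  eq₁ = solve-∀
  8ℓ≤ : 8 * suc L ≤ 4 * 2 ^ L
  8ℓ≤ = subst (λ L → 8 * suc L ≤ 4 * 2 ^ L) (m+[n∸m]≡n 8≤L) (begin
    8 * suc (8 + k)  ≤⟨ m≤m+n _ (120 * k + 56) ⟩
    8 * suc (8 + k) + (120 * k + 56)  ≡⟨ eq₂ k ⟩
    4 * (32 * suc k)  ≤⟨ *-monoʳ-≤ 4 (*-mono-≤ {32} {2 ^ 8} (m≤m+n 32 224) (n<2^n k)) ⟩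
    4 * (2 ^ 8 * 2 ^ k)  ≡⟨ cong (4 *_) (^-distribˡ-+-* 2 8 k) ⟨
    4 * 2 ^ (8 + k)  ∎)
    where
    k = L ∸ 8
    eq₂ : ∀ k → 8 * (1 + (8 + k)) + (120 * k + 56) ≡ 4 * (32 * (1 + k))
    eq₂ = solve-∀
  shifted : ∀ i → i < suc L → π ≤ ∑ (suc N) (primeAt i)
  shifted i i≤L = begin
    π  ≤⟨ m≤n+m π (∑ (suc c) (primeAt i)) ⟩
    ∑ (suc c) (primeAt i) + π  ≡⟨ cong (∑ (suc c) (primeAt i) +_) (∑-cong (2 ^ suc L) λ j _ →
        cong (λ z → ⟦ oddPrime? z ⟧) (trans (sym (m+n∸m≡n c (suc j))) (cong (_∸ c) (+-suc c j)))) ⟩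
    ∑ (suc c) (primeAt i) + ∑ (2 ^ suc L) (λ j → primeAt i (suc c + j))  ≡⟨ ∑-split (suc c) (2 ^ suc L) (primeAt i) ⟨
    ∑ (suc c + 2 ^ suc L) (primeAt i)  ≤⟨ ∑-monoˡ (primeAt i) (s≤s (≤-trans (+-monoˡ-≤ (2 ^ suc L) (^-monoʳ-≤ 2 i≤L)) (≤-reflexive (eq₂ (2 ^ L))))) ⟩
    ∑ (suc N) (primeAt i)  ∎
    where
    c = 2 ^ suc i
    eq₂ : ∀ x → 2 * x + 2 * x ≡ 4 * x
    eq₂ = solve-∀

romanoff : ∃ λ κ → ∀ s → 1 ≤ s → 2 ^ (10 * s) ≤ κ * ∑ (suc (2 ^ (10 * s))) (λ n → ⟦ rep? (10 * s ∸ 1) n ⟧)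
romanoff = (let B = 100 * (3 * 2 + 128 * (32 * 2)) in 8 * ((8 * B + 1) * (8 * B + 1))) , bound _ refl
  where
  bound : ∀ B → B ≡ 100 * (3 * 2 + 128 * (32 * 2)) → ∀ s → 1 ≤ s →
    2 ^ (10 * s) ≤ 8 * ((8 * B + 1) * (8 * B + 1)) * ∑ (suc (2 ^ (10 * s))) (λ n → ⟦ rep? (10 * s ∸ 1) n ⟧)
  bound B B≡ s s≥1 = ≤-trans N≤8X (≤-trans (*-monoʳ-≤ 8 X≤) (≤-reflexive (sym (*-assoc 8 (K * K) R))))
    where
    N = 2 ^ (10 * s)
    L = 10 * s ∸ 2
    10s≡ : 10 * s ≡ 2 + L
    10s≡ = sym (m+[n∸m]≡n {2} {10 * s} (*-mono-≤ {2} {10} (s≤s (s≤s z≤n)) s≥1))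
    ℓ≡ : 10 * s ∸ 1 ≡ suc L
    ℓ≡ = cong (_∸ 1) 10s≡
    N≡ : N ≡ 4 * 2 ^ L
    N≡ = trans (cong (2 ^_) 10s≡) (sym (*-assoc 2 2 (2 ^ L)))
    -- Chosen so that 2 K X exceeds X + 2 · B · 8X, the bound for the second moment, by exactly X.
    K = 8 * B + 1
    ℓ = 10 * s ∸ 1
    X = ∑ (suc N) (representations ℓ)
    R = ∑ (suc N) (λ n → ⟦ rep? ℓ n ⟧)
    N≤8X : N ≤ 8 * X
    N≤8X = subst₂ (λ N ℓ → N ≤ 8 * ∑ (suc N) (representations ℓ)) (sym N≡) (sym ℓ≡)
      (representations-lower L (s≤s⁻¹ (s≤s⁻¹ (≤-trans (*-monoʳ-≤ 10 s≥1) (≤-reflexive 10s≡)))))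
    y = 2 ^ s
    y¹⁰ : N ≡ y * y * (y * y) * (y * y * (y * y)) * (y * y)
    y¹⁰ = trans (cong (2 ^_) (*-comm 10 s)) (trans (sym (^-*-assoc 2 s 10)) (eq y))
      where
      eq : ∀ y → y * (y * (y * (y * (y * (y * (y * (y * (y * (y * 1))))))))) ≡ y * y * (y * y) * (y * y * (y * y)) * (y * y)
      eq = solve-∀
    pairs≤ : ∑ (suc N) (pairs ℓ) ≤ B * N
    pairs≤ = begin
      ∑ (suc N) (pairs ℓ)
        ≤⟨ pairs-bound s s≥1 ℓ (m∸n≤m (10 * s) 1) (suc N) (m≤n⇒m≤1+n (≤-reflexive (sym y¹⁰))) ⟩
      100 * (3 * suc N + 128 * (32 * suc N))
        ≤⟨ *-monoʳ-≤ 100 (+-mono-≤ (*-monoʳ-≤ 3 1+N≤) (*-monoʳ-≤ 128 (*-monoʳ-≤ 32 1+N≤))) ⟩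
      100 * (3 * (2 * N) + 128 * (32 * (2 * N)))
        ≡⟨ eq N 100 128 32 ⟩
      100 * (3 * 2 + 128 * (32 * 2)) * N
        ≡⟨ cong (_* N) B≡ ⟨
      B * N ∎
      where
      1+N≤ : suc N ≤ 2 * N
      1+N≤ = ≤-trans (+-monoˡ-≤ N (m^n>0 2 (10 * s))) (≤-reflexive (cong (N +_) (sym (+-identityʳ N))))
      eq : ∀ N a b c → a * (3 * (2 * N) + b * (c * (2 * N))) ≡ a * (3 * 2 + b * (c * 2)) * N
      eq = solve-∀
    X≤ : X ≤ K * K * R
    X≤ = +-cancelʳ-≤ (X + 2 * (B * (8 * X))) X (K * K * R) (begin
      X + (X + 2 * (B * (8 * X)))  ≡⟨ eq B X ⟩
      2 * (8 * B + 1) * X  ≤⟨ ∑-second-moment K ℓ (suc N) ⟩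
      K * K * R + (X + 2 * ∑ (suc N) (pairs ℓ))
                                            ≤⟨ +-monoʳ-≤ (K * K * R) (+-monoʳ-≤ X (*-monoʳ-≤ 2 (≤-trans pairs≤ (*-monoʳ-≤ B N≤8X)))) ⟩
      K * K * R + (X + 2 * (B * (8 * X)))  ∎)
      where
      eq : ∀ B X → X + (X + 2 * (B * (8 * X))) ≡ 2 * (8 * B + 1) * X
      eq = solve-∀

-- Residue classes in which few exponents survive

∑-binomial : ∀ n → ∑ (suc n) (n C_) ≡ 2 ^ n
∑-binomial zero    = refl
∑-binomial (suc n) = begin-equality
  ∑ (2 + n) (suc n C_)
    ≡⟨ ∑-split 1 (suc n) (suc n C_) ⟩
  suc n C 0 + ∑ (suc n) (λ k → suc n C suc k)
    ≡⟨ cong₂ _+_ (trans (nC0≡1 (suc n)) (sym (nC0≡1 n))) (trans (∑-cong (suc n) λ k _ → sym (nCk+nC[k+1]≡[n+1]C[k+1] n k)) (∑-+ (suc n) (n C_) (λ k → n C suc k))) ⟩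
  n C 0 + (∑ (suc n) (n C_) + ∑ (suc n) (λ k → n C suc k))
    ≡⟨ eq (n C 0) _ _ ⟩
  ∑ (suc n) (n C_) + (n C 0 + ∑ (suc n) (λ k → n C suc k))
    ≡⟨ cong₂ _+_ (∑-binomial n) (trans (sym (∑-split 1 (suc n) (n C_))) (trans (cong₂ _+_ (∑-binomial n) (k>n⇒nCk≡0 (n<1+n n))) refl)) ⟩
  2 ^ n + (2 ^ n + 0) ∎
  where
  eq : ∀ a b c → a + (b + c) ≡ b + (a + c)
  eq = solve-∀

-- Expand 2^p = (1 + 1)^p: by `absorption` p divides the inner binomial coefficients, so 2^p ≡ 2,
-- and one factor 2 is cancelled.
fermat : ∀ {n} → OddPrime (suc n) → Cong (suc n) (2 ^ n) 1
fermat {zero}  (pp , _)   = contradiction pp ¬prime[1]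
fermat {suc m} (pp , p≢2) = cong-cancel-* (2 ^ n) 1 (prime-coprime pp p∤2)
  (cong-trans (cong-reflexive (sym expansion)) (cong-trans (cong-+ (cong-+ (cong-refl {a = 1}) (∣⇒cong0 middle)) (cong-refl {a = 1})) cong-refl))
  where
  n = suc m
  p = suc n
  p∤2 : ¬ p ∣ 2
  p∤2 p∣2 = p≢2 (prime-∣-prime pp prime[2] p∣2)
  expansion : 1 + ∑ n (λ k → p C suc k) + 1 ≡ 2 ^ p
  expansion = trans (cong₂ (λ x y → x + ∑ n (λ k → p C suc k) + y) (sym (nC0≡1 p)) (sym (nCn≡1 p)))
    (trans (cong (_+ p C p) (sym (∑-split 1 n (p C_)))) (∑-binomial p))
  divides-all : ∀ j → (∀ k → k < j → p ∣ p C suc k) → p ∣ ∑ j (λ k → p C suc k)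
  divides-all zero    h = p ∣0
  divides-all (suc j) h = ∣m∣n⇒∣m+n (divides-all j λ k k<j → h k (m<n⇒m<1+n k<j)) (h j ≤-refl)
  middle : p ∣ ∑ n (λ k → p C suc k)
  middle = divides-all n λ k k<n → [ (λ p∣k → contradiction p∣k (>⇒∤ (s≤s k<n))) , id ]′
    (euclidsLemma (suc k) (p C suc k) pp (subst (p ∣_) (sym (absorption n k)) (m∣m*n (n C k))))

prime-order : ∀ {p q} → OddPrime p → Prime q → Cong p (2 ^ q) 1 → ∀ m → 1 ≤ m → Cong p (2 ^ m) 1 → q ∣ m
prime-order {q = zero}  op pq hq m m≥1 hm = contradiction pq ¬prime[0]
prime-order {p} {suc q} op pq hq (suc m) m≥1 hm
  with least (λ n → All.all? (one? n) (p ∷ [])) q (hq ∷ [])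
... | n₀ , h₀ , _ , min with prime⇒irreducible pq (minimal-exponent (p ∷ []) n₀ h₀ min q (hq ∷ []))
...   | inj₁ e≡1 = contradiction (cong⇒∣ {a = 1} {b = 1} (subst (λ e → Cong p (2 ^ e) 1) e≡1 (All.head h₀))) λ p∣1 → ¬prime[1] (subst Prime (∣1⇒≡1 p∣1) (proj₁ op))
...   | inj₂ e≡q = subst (_∣ suc m) e≡q (minimal-exponent (p ∷ []) n₀ h₀ min m (hm ∷ []))

-- Any prime factor p of 2^q - 1 will do. By `fermat` and `prime-order`, q divides p - 1; as p and q
-- are both odd, p - 1 is not q itself, hence at least 2 q.
prime-of-order : ∀ {q} → OddPrime q → ∃ λ p → OddPrime p × Cong p (2 ^ q) 1 × 2 * q < p
prime-of-order {q} (pq , q≢2) with prime-factor (2 ^ q ∸ 1) (∸-monoˡ-≤ 1 (≤-trans (n≤1+n 3) (^-monoʳ-≤ 2 (prime≥2 pq))))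
... | zero      , pp , _      = contradiction pp ¬prime[0]
... | p@(suc n) , pp , p∣2^q-1 = p , op , h , 2q<p
  where
  h : Cong p (2 ^ q) 1
  h = ∸-cong (m^n>0 2 q) p∣2^q-1
  op : OddPrime p
  op = pp , λ { refl → 2-adic q (<⇒≤ (prime≥2 pq)) h }
    where
    2-adic : ∀ q → 1 ≤ q → ¬ Cong 2 (2 ^ q) 1
    2-adic (suc q) _ h = contradiction (∣1⇒≡1 (cong0⇒∣ (cong-trans (cong-sym h) (∣⇒cong0 (m∣m*n (2 ^ q)))))) λ ()
  n≥1 : 1 ≤ n
  n≥1 = s≤s⁻¹ (prime≥2 pp)
  2q<p : 2 * q < p
  2q<p with prime-order op pq h n n≥1 (fermat op)
  ... | divides zero          n≡ = contradiction (sym n≡) (<⇒≢ n≥1)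
  ... | divides (suc zero)    n≡ = contradiction (odd-not-consecutive (odd-prime-odd (pq , q≢2)) (odd-prime-odd op) (cong suc (trans n≡ (+-identityʳ q)))) id
  ... | divides (suc (suc k)) n≡ = s≤s (≤-trans (*-monoˡ-≤ q {2} {2 + k} (s≤s (s≤s z≤n))) (≤-reflexive (sym n≡)))

pigeonhole : ∀ q (f : ℕ → ℕ) V → 1 ≤ q → q * V ≤ ∑ q f → ∃ λ r → r < q × V ≤ f r
pigeonhole q f V q≥1 h with anyUpTo? (λ r → V ≤? f r) q
... | yes found = found
... | no none   = contradiction h (<⇒≱ (below q q≥1 λ r r<q → ≰⇒> λ V≤ → none (r , r<q , V≤)))
  where
  below : ∀ q → 1 ≤ q → (∀ r → r < q → f r < V) → ∑ q f < q * V
  below (suc zero)    _ h = ≤-trans (h 0 ≤-refl) (≤-reflexive (sym (+-identityʳ V)))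
  below (suc (suc q)) _ h = ≤-trans (+-mono-< (below (suc q) (s≤s z≤n) λ r r<q → h r (m<n⇒m<1+n r<q)) (h (suc q) ≤-refl)) (≤-reflexive (+-comm (suc q * V) V))

∑-residues : ∀ q .{{_ : NonZero q}} n → ∑ q (λ r → ⟦ n % q ≟ r ⟧) ≡ 1
∑-residues q n = ≤-antisym (∑-unique q (λ r → n % q ≟ r) λ i j _ _ x y → trans (sym x) y)
  (≤-trans (≤-reflexive (sym (⟦⟧-yes (n % q ≟ n % q) refl))) (term≤∑ q (λ r → ⟦ n % q ≟ r ⟧) (n % q) (m%n<n n q)))

product₊ product₋ product₂ product₂₊ : List ℕ → ℕ
product₊  qs = product (map (λ q → q + 1) qs)
product₋  qs = product (map (λ q → q ∸ 1) qs)
product₂  qs = product (map (λ q → 2 * q) qs)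
product₂₊ qs = product (map (λ q → 2 * q + 1) qs)

-- The class c modulo M lies above the class c₀ modulo M₀; v is the indicator function of the exponents k
-- for which c − 2ᵏ is not divisible by any of the new prime factors Ps of M.
record Cover (c₀ M₀ : ℕ) (qs : List ℕ) : Set where
  field
    c M       : ℕ
    Ps        : List ℕ
    v         : ℕ → ℕ
    M≥1       : 1 ≤ M
    M₀∣M      : M₀ ∣ M
    c≡c₀      : Cong M₀ c c₀
    factors   : ∀ r → Prime r → r ∣ M → r ≤ M₀ ⊎ r ∈ Ps
    orders    : All (λ p → OddPrime p × Any (λ q → Cong p (2 ^ q) 1) qs) Ps
    v≤1       : ∀ k → v k ≤ 1
    covered   : ∀ k → v k ≡ 0 → ∃ λ p → Prime p × p ∣ M × Cong p c (2 ^ k)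
    v-period  : ∀ k → v (k + product qs) ≡ v k
    -- With denominators restored, the last two fields say that the surviving exponents have
    -- proportion at most ∏ (1 - 1/q), and that ∏ (1 + 1/p) over `Ps` is at most ∏ (1 + 1/(2q)) over
    -- `qs`.
    v-count   : ∑ (product qs) v ≤ product₋ qs
    Ps-weight : product₊ Ps * product₂ qs ≤ product Ps * product₂₊ qs

periodic-*ℕ : ∀ {T} {v : ℕ → ℕ} → Periodic T v → ∀ q → ∑ (q * T) v ≡ q * ∑ T v
periodic-*ℕ {T} {v} per q = trans (∑-blocks q T v) (trans (∑-cong q λ i _ → ∑-cong T λ j _ → periodic-* per i j) (∑-const q (∑ T v)))

-- If 2 has order q modulo p, the congruence c ≡ 2^r (mod p) covers every exponent k ≡ r (mod q).
-- Choosing the residue r that contains most of the surviving exponents lowers their proportion by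
-- the factor 1 - 1/q.
cover : ∀ c₀ M₀ → 1 ≤ M₀ → ∀ qs → Descending qs → All OddPrime qs → All (M₀ <_) qs → Cover c₀ M₀ qs
cover c₀ M₀ M₀≥1 [] [] [] [] = record
  { c = c₀ ; M = M₀ ; Ps = [] ; v = λ _ → 1
  ; M≥1 = M₀≥1 ; M₀∣M = ∣-refl ; c≡c₀ = cong-refl
  ; factors = λ r _ r∣M₀ → inj₁ (∣⇒≤ {{>-nonZero M₀≥1}} r∣M₀)
  ; orders = [] ; v≤1 = λ _ → ≤-refl ; covered = λ _ ()
  ; v-period = λ _ → refl ; v-count = ≤-refl ; Ps-weight = ≤-refl
  }
cover c₀ M₀ M₀≥1 (q ∷ qs) (<q ∷ desc) (oq ∷ oqs) (M₀<q ∷ M₀<) with prime-of-order oq | cover c₀ M₀ M₀≥1 qs desc oqs M₀<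
... | p , op , h , 2q<p | C = extend (solve-mod M⊥p c (2 ^ r))
  where
  open Cover C
  p≥1 : 1 ≤ p
  p≥1 = <⇒≤ (oddPrime≥2 p op)
  q≥1 : 1 ≤ q
  q≥1 = <⇒≤ (oddPrime≥2 q oq)
  T = product qs
  V = ∑ T v
  instance
    _ : NonZero p
    _ = >-nonZero p≥1
    _ : NonZero q
    _ = >-nonZero q≥1

  not-order : ∀ {qs} → All (_< q) qs → All OddPrime qs → ¬ Any (λ q′ → Cong p (2 ^ q′) 1) qs
  not-order (q′<q ∷ _) (oq′ ∷ _)   (here h′)  = contradiction (∣⇒≤ {{>-nonZero q′≥1}} (prime-order op (proj₁ oq) h _ q′≥1 h′)) (<⇒≱ q′<q)
    where q′≥1 = <⇒≤ (oddPrime≥2 _ oq′)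
  not-order (_ ∷ <q)   (_ ∷ oqs) (there h′) = not-order <q oqs h′

  -- `p` is new: it exceeds `M₀` because q does, and 2 has order q modulo p, which divides none of
  -- the smaller primes in `qs`.
  p∤M : ¬ p ∣ M
  p∤M p∣M with factors p (proj₁ op) p∣M
  ... | inj₁ p≤M₀ = <⇒≱ (<-trans (<-≤-trans M₀<q (m≤m+n q (q + 0))) 2q<p) p≤M₀
  ... | inj₂ p∈Ps = not-order <q oqs (proj₂ (All.lookup orders p∈Ps))
  M⊥p : Coprime M p
  M⊥p = coprime-sym (prime-coprime (proj₁ op) p∤M)

  hits : ℕ → ℕ
  hits r = ∑ (q * T) (λ k → v k * ⟦ k % q ≟ r ⟧)
  -- Over q periods of `v` the q residues share q V survivors, so one of them has at least V. The
  -- average suffices; no independence of the conditions is used.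
  ∑hits : ∑ q hits ≡ q * V
  ∑hits = trans (∑-swap q (q * T) _) (trans (∑-cong (q * T) λ k _ →
    trans (∑-*ˡ q (v k) _) (trans (cong (v k *_) (∑-residues q k)) (*-identityʳ (v k)))) (periodic-*ℕ v-period q))
  best = pigeonhole q hits V q≥1 (≤-reflexive (sym ∑hits))
  r = proj₁ best

  v′ : ℕ → ℕ
  v′ k = v k * (1 ∸ ⟦ k % q ≟ r ⟧)

  v′-count : ∑ (q * T) v′ ≤ (q ∸ 1) * V
  v′-count = begin
    ∑ (q * T) v′  ≡⟨ m+n∸n≡m (∑ (q * T) v′) (hits r) ⟨
    ∑ (q * T) v′ + hits r ∸ hits r  ≡⟨ cong (_∸ hits r) (trans (sym (∑-+ (q * T) _ _)) (∑-cong (q * T) λ k _ → trans (sym (*-distribˡ-+ (v k) _ _))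
                                               (trans (cong (v k *_) (m∸n+n≡m (⟦⟧≤1 (k % q ≟ r)))) (*-identityʳ (v k))))) ⟩
    ∑ (q * T) v ∸ hits r  ≤⟨ ∸-mono (≤-reflexive (periodic-*ℕ v-period q)) (proj₂ (proj₂ best)) ⟩
    q * V ∸ V  ≡⟨ cong (q * V ∸_) (*-identityˡ V) ⟨
    q * V ∸ 1 * V  ≡⟨ *-distribʳ-∸ V q 1 ⟨
    (q ∸ 1) * V  ∎

  extend : (Σ ℕ λ t → t < p × Cong p (c + M * t) (2 ^ r)) → Cover c₀ M₀ (q ∷ qs)
  extend (t , _ , ht) = record
    { c = c + M * t ; M = M * p ; Ps = p ∷ Ps ; v = v′
    ; M≥1 = *-mono-≤ M≥1 p≥1
    ; M₀∣M = ∣m⇒∣m*n p M₀∣M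
    ; c≡c₀ = cong-trans (cong-∣ M₀∣M (cong-p* c t)) c≡c₀
    ; factors = factors′
    ; orders = (op , here h) ∷ All.map (λ (o , a) → o , there a) orders
    ; v≤1 = λ k → *-mono-≤ (v≤1 k) (m∸n≤m 1 ⟦ k % q ≟ r ⟧)
    ; covered = covered′
    ; v-period = λ k → cong₂ _*_ (trans (cong v (cong (k +_) refl)) (periodic-multiple v-period q k))
        (cong (λ z → 1 ∸ ⟦ z ≟ r ⟧) (%-remove-+ʳ k (m∣m*n T)))
    ; v-count = ≤-trans v′-count (*-monoʳ-≤ (q ∸ 1) v-count)
    ; Ps-weight = begin
        (p + 1) * product₊ Ps * (2 * q * product₂ qs)  ≡⟨ eq₁ p (product₊ Ps) q (product₂ qs) ⟩
        (p * (2 * q) + 2 * q) * (product₊ Ps * product₂ qs) ≤⟨ *-mono-≤ (+-monoʳ-≤ (p * (2 * q)) (<⇒≤ 2q<p)) Ps-weight ⟩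
        (p * (2 * q) + p) * (product Ps * product₂₊ qs)  ≡⟨ eq₂ p (product Ps) q (product₂₊ qs) ⟩
        p * product Ps * ((2 * q + 1) * product₂₊ qs)  ∎
    }
    where
    eq₁ : ∀ p x q y → (p + 1) * x * (2 * q * y) ≡ (p * (2 * q) + 2 * q) * (x * y)
    eq₁ = solve-∀
    eq₂ : ∀ p x q y → (p * (2 * q) + p) * (x * y) ≡ p * x * ((2 * q + 1) * y)
    eq₂ = solve-∀
    factors′ : ∀ r → Prime r → r ∣ M * p → r ≤ M₀ ⊎ r ∈ p ∷ Ps
    factors′ r pr r∣ with euclidsLemma M p pr r∣
    ... | inj₂ r∣p = inj₂ (here (prime-∣-prime pr (proj₁ op) r∣p))
    ... | inj₁ r∣M = [ inj₁ , (λ r∈ → inj₂ (there r∈)) ]′ (factors r pr r∣M)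
    covered′ : ∀ k → v′ k ≡ 0 → ∃ λ p′ → Prime p′ × p′ ∣ M * p × Cong p′ (c + M * t) (2 ^ k)
    covered′ k v′≡0 with m*n≡0⇒m≡0∨n≡0 (v k) v′≡0
    ... | inj₁ v≡0 with covered k v≡0
    ...   | p′ , pp′ , p′∣M , h′ = p′ , pp′ , ∣m⇒∣m*n p p′∣M , cong-trans (cong-∣ p′∣M (cong-p* c t)) h′
    covered′ k v′≡0 | inj₂ 1∸≡0 with k % q ≟ r
    ...   | yes k%q≡r = p , proj₁ op , n∣m*n M , cong-trans ht (cong-sym (subst (λ z → Cong p (2 ^ k) (2 ^ z)) k%q≡r (cong-pow-% k q h)))

G≤product₊ : ∀ ps D → G one ps D ≤ product₊ ps
G≤product₊ []       zero    = z≤n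
G≤product₊ []       (suc D) = ≤-refl
G≤product₊ (p ∷ ps) D       = ≤-trans (+-mono-≤ (*-monoʳ-≤ p (G≤product₊ ps D)) (*-monoʳ-≤ 1 (G≤product₊ ps (D ÷ p))))
  (≤-reflexive (sym (*-distribʳ-+ (product₊ ps) p 1)))

-- Telescoping: ∏ (1 + 1/i) over all i ≤ M is already only M + 1.
weight-≤ : ∀ {P : ℕ → Set} (P? : ∀ i → Dec (P i)) M n →
  weight (_≤? M) (select P? n) ≤ suc (n ⊓ M) * product (select P? n)
weight-≤ P? M zero    = ≤-refl
weight-≤ P? M (suc n) with P? (suc n)
... | no _  = ≤-trans (weight-≤ P? M n) (*-monoˡ-≤ (product (select P? n)) (s≤s (⊓-monoˡ-≤ M (n≤1+n n))))
... | yes _ = lemma (suc n ≤? M)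
  where
  W = weight (_≤? M) (select P? n)
  Q = product (select P? n)
  lemma : (d : Dec (suc n ≤ M)) → (suc n + ⟦ d ⟧) * W ≤ suc (suc n ⊓ M) * (suc n * Q)
  lemma (yes 1+n≤M) = begin
    (suc n + 1) * W  ≤⟨ *-monoʳ-≤ (suc n + 1) (weight-≤ P? M n) ⟩
    (suc n + 1) * (suc (n ⊓ M) * Q)  ≡⟨ cong₂ (λ x y → x * (suc y * Q)) (+-comm (suc n) 1) (m≤n⇒m⊓n≡m (<⇒≤ 1+n≤M)) ⟩
    suc (suc n) * (suc n * Q)  ≡⟨ cong (λ x → suc x * (suc n * Q)) (m≤n⇒m⊓n≡m 1+n≤M) ⟨
    suc (suc n ⊓ M) * (suc n * Q)  ∎
  lemma (no _) = begin
    (suc n + 0) * W  ≤⟨ *-monoʳ-≤ (suc n + 0) (weight-≤ P? M n) ⟩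
    (suc n + 0) * (suc (n ⊓ M) * Q)  ≤⟨ *-monoʳ-≤ (suc n + 0) (*-monoˡ-≤ Q (s≤s (⊓-monoˡ-≤ M (n≤1+n n)))) ⟩
    (suc n + 0) * (suc (suc n ⊓ M) * Q) ≡⟨ eq n (suc n ⊓ M) Q ⟩
    suc (suc n ⊓ M) * (suc n * Q)  ∎
    where
    eq : ∀ n x Q → (1 + n + 0) * ((1 + x) * Q) ≡ (1 + x) * ((1 + n) * Q)
    eq = solve-∀

product₊-split : ∀ {B : ℕ → Set} (B? : ∀ p → Dec (B p)) ps →
  product₊ ps * product (filter (¬? ∘ B?) ps) ≤ weight B? ps * product₊ (filter (¬? ∘ B?) ps)
product₊-split B? []       = ≤-refl
product₊-split B? (p ∷ ps) with B? p
... | yes _ = ≤-trans (≤-reflexive (*-assoc (p + 1) (product₊ ps) _))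
                (≤-trans (*-monoʳ-≤ (p + 1) (product₊-split B? ps)) (≤-reflexive (sym (*-assoc (p + 1) (weight B? ps) _))))
... | no _  = begin
  (p + 1) * product₊ ps * (p * product qs)  ≡⟨ eq₁ p (product₊ ps) (product qs) ⟩
  (p + 1) * p * (product₊ ps * product qs)  ≤⟨ *-monoʳ-≤ ((p + 1) * p) (product₊-split B? ps) ⟩
  (p + 1) * p * (weight B? ps * product₊ qs)  ≡⟨ eq₂ p (weight B? ps) (product₊ qs) ⟩
  (p + 0) * weight B? ps * ((p + 1) * product₊ qs)  ∎
  where
  qs = filter (¬? ∘ B?) ps
  eq₁ : ∀ p x y → (p + 1) * x * (p * y) ≡ (p + 1) * p * (x * y)
  eq₁ = solve-∀
  eq₂ : ∀ p x y → (p + 1) * p * (x * y) ≡ (p + 0) * x * ((p + 1) * y)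
  eq₂ = solve-∀

-- (1 − 1/q)² (1 + 1/(2q))² (1 + 1/q) ≤ 1.
product-tradeoff : ∀ {qs} → All (1 ≤_) qs →
  product₋ qs * product₋ qs * (product₂₊ qs * product₂₊ qs) * product₊ qs ≤ product₂ qs * product₂ qs * (product qs * product qs * product qs)
product-tradeoff []       = ≤-refl
product-tradeoff {suc m ∷ qs} (_ ∷ qs≥1) = begin
  m * a * (m * a) * ((2 * suc m + 1) * c * ((2 * suc m + 1) * c)) * ((suc m + 1) * d)
    ≡⟨ eq₁ m a c d ⟩
  m * m * ((2 * suc m + 1) * (2 * suc m + 1)) * (suc m + 1) * (a * a * (c * c) * d)
    ≤⟨ *-mono-≤ (≤-trans (m≤m+n (m * m * ((2 * suc m + 1) * (2 * suc m + 1)) * (suc m + 1)) (7 * (m * m * m) + 22 * (m * m) + 20 * m + 4)) (≤-reflexive (eq₂ m))) (product-tradeoff qs≥1) ⟩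
  2 * suc m * (2 * suc m) * (suc m * suc m * suc m) * (b * b * (T * T * T))
    ≡⟨ eq₃ (suc m) b T ⟩
  2 * suc m * b * (2 * suc m * b) * (suc m * T * (suc m * T) * (suc m * T)) ∎
  where
  a = product₋ qs
  b = product₂ qs
  c = product₂₊ qs
  d = product₊ qs
  T = product qs
  eq₁ : ∀ m a c d → m * a * (m * a) * ((2 * (1 + m) + 1) * c * ((2 * (1 + m) + 1) * c)) * ((1 + m + 1) * d) ≡
    m * m * ((2 * (1 + m) + 1) * (2 * (1 + m) + 1)) * (1 + m + 1) * (a * a * (c * c) * d)
  eq₁ = solve-∀
  eq₂ : ∀ m → m * m * ((2 * (1 + m) + 1) * (2 * (1 + m) + 1)) * (1 + m + 1) + (7 * (m * m * m) + 22 * (m * m) + 20 * m + 4) ≡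
    2 * (1 + m) * (2 * (1 + m)) * ((1 + m) * (1 + m) * (1 + m))
  eq₂ = solve-∀
  eq₃ : ∀ q b T → 2 * q * (2 * q) * (q * q * q) * (b * b * (T * T * T)) ≡ 2 * q * b * (2 * q * b) * (q * T * (q * T) * (q * T))
  eq₃ = solve-∀

product₂>0 : ∀ {qs} → All (1 ≤_) qs → 1 ≤ product₂ qs
product₂>0 []       = ≤-refl
product₂>0 (h ∷ hs) = *-mono-≤ (*-mono-≤ {1} {2} (s≤s z≤n) h) (product₂>0 hs)

square-cancel : ∀ a b → a * a ≤ b * b → a ≤ b
square-cancel a b h = ≮⇒≥ λ b<a → <⇒≱ (*-mono-< b<a b<a) h

-- `qs` takes all odd primes in (M₀, D]. By `product-tradeoff` the square of ∏ (1 - 1/q)(1 + 1/(2q))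
-- is at most the inverse of ∏ (1 + 1/q), and the latter product is at least Λ²; therefore squares
-- are compared.
sparse-cover : ∀ c₀ M₀ → 1 ≤ M₀ → ∀ Λ → Σ (List ℕ) λ qs → Σ (Cover c₀ M₀ qs) λ 𝒞 → let open Cover 𝒞 in
  1 ≤ product qs × ∑ (product qs) v * product₊ Ps * Λ ≤ product qs * product Ps
sparse-cover c₀ M₀ M₀≥1 Λ = qs , 𝒞 , T≥1 , square-cancel (A * Λ) (T * π)
  (*-cancelʳ-≤ _ _ T {{>-nonZero T≥1}} (begin
    A * Λ * (A * Λ) * T  ≡⟨ eq₁ A Λ T ⟩
    A * A * (Λ * Λ * T)  ≤⟨ *-monoʳ-≤ (A * A) Λ²T≤d ⟩
    A * A * d  ≤⟨ *-cancelʳ-≤ _ _ (b * b) {{>-nonZero (*-mono-≤ b≥1 b≥1)}} (begin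
        A * A * d * (b * b)  ≡⟨ eq₂ V P₊ d b ⟩
        V * V * (P₊ * b * (P₊ * b)) * d  ≤⟨ *-monoˡ-≤ d (*-mono-≤ (*-mono-≤ v-count v-count) (*-mono-≤ Ps-weight Ps-weight)) ⟩
        a * a * (π * c′ * (π * c′)) * d  ≡⟨ eq₃ a π c′ d ⟩
        π * π * (a * a * (c′ * c′) * d)  ≤⟨ *-monoʳ-≤ (π * π) (product-tradeoff qs≥1) ⟩
        π * π * (b * b * (T * T * T))  ≡⟨ eq₄ π b T ⟩
        T * π * (T * π) * T * (b * b)  ∎) ⟩
    T * π * (T * π) * T  ∎))
  where
  -- `G-lower` gives ∏ (1 + 1/p) ≥ n / 8 over the odd primes up to D, and those up to `M₀` account
  -- for at most M₀ + 1; what remains is Λ².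
  n = 8 * suc M₀ * (Λ * Λ)
  D = 2 ^ n
  ps = oddPrimes D
  Q = product ps
  qs = filter (¬? ∘ (_≤? M₀)) ps
  qs-odd : All OddPrime qs
  qs-odd = All.filter⁺ (¬? ∘ (_≤? M₀)) (select-All oddPrime? D)
  qs≥1 : All (1 ≤_) qs
  qs≥1 = All.map (λ {q} oq → <⇒≤ (oddPrime≥2 q oq)) qs-odd
  𝒞 = cover c₀ M₀ M₀≥1 qs (AllPairs.filter⁺ (¬? ∘ (_≤? M₀)) (select-desc oddPrime? D)) qs-odd
        (All.map ≰⇒> (All.all-filter (¬? ∘ (_≤? M₀)) ps))
  open Cover 𝒞
  T = product qs
  T≥1 = product>0 qs≥1
  V = ∑ T v
  P₊ = product₊ Ps
  π = product Ps
  A = V * P₊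
  a = product₋ qs
  b = product₂ qs
  b≥1 = product₂>0 qs≥1
  c′ = product₂₊ qs
  d = product₊ qs
  eq₁ : ∀ A Λ T → A * Λ * (A * Λ) * T ≡ A * A * (Λ * Λ * T)
  eq₁ = solve-∀
  eq₂ : ∀ V P d b → V * P * (V * P) * d * (b * b) ≡ V * V * (P * b * (P * b)) * d
  eq₂ = solve-∀
  eq₃ : ∀ a π c d → a * a * (π * c * (π * c)) * d ≡ π * π * (a * a * (c * c) * d)
  eq₃ = solve-∀
  eq₄ : ∀ π b T → π * π * (b * b * (T * T * T)) ≡ T * π * (T * π) * T * (b * b)
  eq₄ = solve-∀
  Λ²T≤d : Λ * Λ * T ≤ d
  Λ²T≤d = *-cancelˡ-≤ (8 * suc M₀) (*-cancelʳ-≤ _ _ Q {{>-nonZero (product>0 (select-≥1 oddPrime? D))}} (begin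
    8 * suc M₀ * (Λ * Λ * T) * Q  ≡⟨ eq₅ (8 * suc M₀) (Λ * Λ) T Q ⟩
    n * Q * T  ≤⟨ *-monoˡ-≤ T (≤-trans (G-lower n D ≤-refl) (*-monoʳ-≤ 8 (G≤product₊ ps (2 ^ n)))) ⟩
    8 * product₊ ps * T  ≡⟨ *-assoc 8 (product₊ ps) T ⟩
    8 * (product₊ ps * T)  ≤⟨ *-monoʳ-≤ 8 (product₊-split (_≤? M₀) ps) ⟩
    8 * (weight (_≤? M₀) ps * d)  ≤⟨ *-monoʳ-≤ 8 (*-monoˡ-≤ d (≤-trans (weight-≤ oddPrime? M₀ D) (*-monoˡ-≤ Q (s≤s (m⊓n≤n D M₀))))) ⟩
    8 * (suc M₀ * Q * d)  ≡⟨ eq₆ (suc M₀) Q d ⟩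
    8 * suc M₀ * d * Q  ∎))
    where
    eq₅ : ∀ m L T Q → m * (L * T) * Q ≡ m * L * Q * T
    eq₅ = solve-∀
    eq₆ : ∀ m Q d → 8 * (m * Q * d) ≡ 8 * m * d * Q
    eq₆ = solve-∀

-- Only the factor of x can grow, by at most 1 + 1/x, and a descending list contains x at most once.
weight-∷ : ∀ {E F : ℕ → Set} (E? : ∀ p → Dec (E p)) (F? : ∀ p → Dec (F p)) x → (∀ p → p ≢ x → F p → E p) →
  ∀ {ps} → Descending ps → weight F? ps * x ≤ weight E? ps * (x + 1)
weight-∷ E? F? x h []            = *-monoʳ-≤ 1 (m≤m+n x 1)
weight-∷ E? F? x h {p ∷ ps} (<p ∷ desc) with p ≟ x
... | yes refl = begin
  (p + ⟦ F? p ⟧) * weight F? ps * p  ≤⟨ *-monoˡ-≤ p (*-mono-≤ (+-monoʳ-≤ p (⟦⟧≤1 (F? p))) (rest ps <p)) ⟩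
  (p + 1) * weight E? ps * p  ≡⟨ eq p (weight E? ps) ⟩
  p * weight E? ps * (p + 1)  ≤⟨ *-monoˡ-≤ (p + 1) (*-monoˡ-≤ (weight E? ps) (m≤m+n p ⟦ E? p ⟧)) ⟩
  (p + ⟦ E? p ⟧) * weight E? ps * (p + 1)  ∎
  where
  eq : ∀ p w → (p + 1) * w * p ≡ p * w * (p + 1)
  eq = solve-∀
  rest : ∀ qs → All (_< p) qs → weight F? qs ≤ weight E? qs
  rest []       []         = ≤-refl
  rest (q ∷ qs) (q<p ∷ <p) = *-mono-≤ (+-monoʳ-≤ q (⟦⟧-mono (F? q) (E? q) (h q (<⇒≢ q<p)))) (rest qs <p)
... | no p≢x   = begin
  (p + ⟦ F? p ⟧) * weight F? ps * x  ≡⟨ *-assoc (p + ⟦ F? p ⟧) (weight F? ps) x ⟩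
  (p + ⟦ F? p ⟧) * (weight F? ps * x)  ≤⟨ *-mono-≤ (+-monoʳ-≤ p (⟦⟧-mono (F? p) (E? p) (h p p≢x))) (weight-∷ E? F? x h desc) ⟩
  (p + ⟦ E? p ⟧) * (weight E? ps * (x + 1))  ≡⟨ *-assoc (p + ⟦ E? p ⟧) (weight E? ps) (x + 1) ⟨
  (p + ⟦ E? p ⟧) * weight E? ps * (x + 1)  ∎

Excluded : ℕ → List ℕ → ℕ → Set
Excluded M X p = p ≤ M ⊎ Any (p ≡_) X

excluded? : ∀ M X p → Dec (Excluded M X p)
excluded? M X p = (p ≤? M) ⊎-dec Any.any? (p ≟_) X

weight-excluded : ∀ M X D → weight (excluded? M X) (oddPrimes D) * product X ≤ suc M * product (oddPrimes D) * product₊ X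
weight-excluded M []      D = *-monoˡ-≤ 1 (≤-trans (weight-mono (oddPrimes D))
    (≤-trans (weight-≤ oddPrime? M D) (*-monoˡ-≤ (product (oddPrimes D)) (s≤s (m⊓n≤n D M)))))
  where
  weight-mono : ∀ ps → weight (excluded? M []) ps ≤ weight (_≤? M) ps
  weight-mono []       = ≤-refl
  weight-mono (p ∷ ps) = *-mono-≤ (+-monoʳ-≤ p (⟦⟧-mono (excluded? M [] p) (p ≤? M) λ { (inj₁ p≤M) → p≤M })) (weight-mono ps)
weight-excluded M (x ∷ X) D = begin
  weight (excluded? M (x ∷ X)) ps * (x * product X)  ≡⟨ *-assoc (weight (excluded? M (x ∷ X)) ps) x (product X) ⟨
  weight (excluded? M (x ∷ X)) ps * x * product X  ≤⟨ *-monoˡ-≤ (product X) (weight-∷ (excluded? M X) (excluded? M (x ∷ X)) x other (select-desc oddPrime? D)) ⟩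
  weight (excluded? M X) ps * (x + 1) * product X  ≡⟨ eq₁ (weight (excluded? M X) ps) (x + 1) (product X) ⟩
  (x + 1) * (weight (excluded? M X) ps * product X)  ≤⟨ *-monoʳ-≤ (x + 1) (weight-excluded M X D) ⟩
  (x + 1) * (suc M * product ps * product₊ X)  ≡⟨ eq₂ (x + 1) (suc M * product ps) (product₊ X) ⟩
  suc M * product ps * ((x + 1) * product₊ X)  ∎
  where
  ps = oddPrimes D
  eq₁ : ∀ w x y → w * x * y ≡ x * (w * y)
  eq₁ = solve-∀
  eq₂ : ∀ x y z → x * (y * z) ≡ y * (x * z)
  eq₂ = solve-∀
  other : ∀ p → p ≢ x → Excluded M (x ∷ X) p → Excluded M X p
  other p p≢x (inj₁ p≤M)         = inj₁ p≤M
  other p p≢x (inj₂ (here p≡x))  = contradiction p≡x p≢x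
  other p p≢x (inj₂ (there p∈X)) = inj₂ p∈X

-- Primes in a class

∑-progression : ∀ {M} → 1 ≤ M → ∀ c (h : ℕ → ℕ) N → ∑ N (λ t → h (c + M * t)) ≤ ∑ (c + M * N) h
∑-progression         M≥1 c h zero    = z≤n
∑-progression {M} M≥1 c h (suc N) = begin
  ∑ N (λ t → h (c + M * t)) + h (c + M * N)  ≤⟨ +-monoˡ-≤ (h (c + M * N)) (∑-progression M≥1 c h N) ⟩
  ∑ (suc (c + M * N)) h  ≤⟨ ∑-monoˡ h (≤-trans (+-monoˡ-≤ (c + M * N) M≥1) (≤-reflexive (eq M c N))) ⟩
  ∑ (c + M * suc N) h  ∎
  where
  eq : ∀ M c N → M + (c + M * N) ≡ c + M * (1 + N)
  eq = solve-∀

-- One class of t is removed modulo each odd prime p ≤ D that is not `Excluded`. Giving up the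
-- excluded primes costs at most (M₀ + 1) ∏ (1 + 1/x) over X, by `G-thin` and `weight-excluded`. The
-- bound does not depend on k and can be summed over the surviving exponents.
primes-in-class : ∀ {c M M₀ X} → 1 ≤ M → (∀ r → Prime r → r ∣ M → Excluded M₀ X r) → ∀ s N k → let D = 2 ^ s in
  1 ≤ product X →
  ∑ N (λ t → ⟦ oddPrime? ((c + M * t) ∸ 2 ^ k) ⟧) * (s * product X) ≤ (D + D * D * (D * D)) * (s * product X) + 8 * N * (suc M₀ * product₊ X)
primes-in-class {c} {M} {M₀} {X} M≥1 factors s N k X≥1 = begin
  ∑ N (λ t → ⟦ oddPrime? (n t ∸ α) ⟧) * τ
    ≤⟨ *-monoˡ-≤ τ (≤-trans (∑-mono N λ t _ → oddPrime-split D (n t) α)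
         (≤-trans (≤-reflexive (∑-+ N _ _)) (+-mono-≤ (≤-trans (∑-progression M≥1 c _ N) (∑-window (c + M * N) α D)) (m≤n+m∸n sifted (D * D * (D * D)))))) ⟩
  (D + (D * D * (D * D) + a′)) * τ
    ≡⟨ eq₁ D (D * D * (D * D)) a′ τ ⟩
  (D + D * D * (D * D)) * τ + a′ * τ
    ≤⟨ +-monoʳ-≤ ((D + D * D * (D * D)) * τ) sifted-bound ⟩
  (D + D * D * (D * D)) * τ + 8 * N * (suc M₀ * product₊ X) ∎
  where
  D = 2 ^ s
  ps = oddPrimes D
  Q = product ps
  Q≥1 = product>0 (select-≥1 oddPrime? D)
  α = 2 ^ k
  τ = s * product X
  f = weight (excluded? M₀ X) ps
  n : ℕ → ℕ
  n t = c + M * t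
  eq₁ : ∀ x y a t → (x + (y + a)) * t ≡ (x + y) * t + a * t
  eq₁ = solve-∀
  e u : ℕ → ℕ
  e p = ⟦ excluded? M₀ X p ⟧
  u p = 1 ∸ e p
  δ : ℕ → ℕ → ℕ
  δ p t = u p * residue c M α p t
  local : ∀ {p} → OddPrime p → Local p (u p) (δ p)
  local {p} op = by-cases (excluded? M₀ X p)
    where
    by-cases : (d : Dec (Excluded M₀ X p)) → Local p (1 ∸ ⟦ d ⟧) (λ t → (1 ∸ ⟦ d ⟧) * residue c M α p t)
    by-cases (yes _) = record
      { δ-periodic = λ _ → refl
      ; δ≤1        = λ _ → z≤n
      ; δ≤w        = λ _ → z≤n
      ; δ-mean     = λ _ _ _ → ∑-zero p λ _ _ → refl
      }
    by-cases (no included) = record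
      { δ-periodic = λ t → cong (1 *_) (δ-periodic t)
      ; δ≤1        = λ t → ≤-trans (≤-reflexive (*-identityˡ _)) (δ≤1 t)
      ; δ≤w        = λ t → ≤-trans (≤-reflexive (*-identityˡ _)) (δ≤w t)
      ; δ-mean     = λ m m⊥p j → trans (∑-cong p λ _ _ → *-identityˡ _) (δ-mean m m⊥p j)
      }
      where open Local (residue-local c M α p (<⇒≤ (oddPrime≥2 p op)) (coprime-sym (prime-coprime (proj₁ op) λ p∣M → included (factors p (proj₁ op) p∣M))))
  open Sieve u δ using (Admissible; sieve-bound)
  admissible : All Admissible ps
  admissible = All.map (λ {p} op → <⇒≤ (oddPrime≥2 p op) , local op) (select-All oddPrime? D)
  g = G u ps D
  sifted = ∑ N (λ t → ⟦ oddPrime>? D (n t ∸ α) ⟧)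
  a′ = sifted ∸ D * D * (D * D)
  ag≤ : a′ * g ≤ N * Q
  ag≤ = begin
    (sifted ∸ D * D * (D * D)) * g  ≡⟨ *-distribʳ-∸ g sifted (D * D * (D * D)) ⟩
    sifted * g ∸ D * D * (D * D) * g  ≤⟨ ∸-monoˡ-≤ (D * D * (D * D) * g)
      (sieve-bound (oddPrimes-coprime D) admissible N (m^n>0 2 s) (λ t → oddPrime>? D (n t ∸ α)) λ t x → All.zipWith (λ {p} (op , p≤D) →
        trans (cong (u p *_) (prime-unsifted {c = c} {M = M} x (proj₁ op) p≤D)) (*-zeroʳ (u p)))
        (select-All oddPrime? D , select-≤ oddPrime? D)) ⟩
    N * Q + D * D * (D * D) * g ∸ D * D * (D * D) * g  ≡⟨ m+n∸n≡m (N * Q) (D * D * (D * D) * g) ⟩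
    N * Q  ∎
  sifted-bound : a′ * τ ≤ 8 * N * (suc M₀ * product₊ X)
  sifted-bound = *-cancelʳ-≤ _ _ (Q * Q) {{>-nonZero (*-mono-≤ Q≥1 Q≥1)}} (begin
    a′ * (s * x) * (Q * Q)  ≡⟨ e₁ a′ s x Q ⟩
    a′ * x * (s * Q) * Q  ≤⟨ *-monoˡ-≤ Q (*-monoʳ-≤ (a′ * x) (G-lower s D ≤-refl)) ⟩
    a′ * x * (8 * A) * Q  ≡⟨ e₂ a′ x A Q ⟩
    8 * x * a′ * (A * Q)  ≤⟨ *-monoʳ-≤ (8 * x * a′) (G-thin (λ p → m∸n+n≡m (⟦⟧≤1 (excluded? M₀ X p))) ps D) ⟩
    8 * x * a′ * (g * f)  ≡⟨ e₃ x a′ g f ⟩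
    8 * (a′ * g) * (f * x)  ≤⟨ *-mono-≤ (*-monoʳ-≤ 8 ag≤) (weight-excluded M₀ X D) ⟩
    8 * (N * Q) * (suc M₀ * Q * product₊ X)  ≡⟨ e₄ N Q (suc M₀) (product₊ X) ⟩
    8 * N * (suc M₀ * product₊ X) * (Q * Q)  ∎)
    where
    x = product X
    A = G one ps D
    e₁ : ∀ a s x Q → a * (s * x) * (Q * Q) ≡ a * x * (s * Q) * Q
    e₁ = solve-∀
    e₂ : ∀ a x A Q → a * x * (8 * A) * Q ≡ 8 * x * a * (A * Q)
    e₂ = solve-∀
    e₃ : ∀ x a g f → 8 * x * a * (g * f) ≡ 8 * (a * g) * (f * x)
    e₃ = solve-∀
    e₄ : ∀ N Q m p → 8 * (N * Q) * (m * Q * p) ≡ 8 * N * (m * p) * (Q * Q)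
    e₄ = solve-∀

-- A class at most half of whose members are representable

module ThinClass {c₀ M₀ qs} (𝒞 : Cover c₀ M₀ qs) (T≥1 : 1 ≤ product qs)
  (sparse : ∑ (product qs) (Cover.v 𝒞) * product₊ (Cover.Ps 𝒞) * (512 * suc M₀) ≤ product qs * product (Cover.Ps 𝒞)) where
  open Cover 𝒞

  T = product qs
  V = ∑ T v
  -- For s ≥ s₀ the exponents fill a period (T ≤ s), 2^s is at least 160 (8 ≤ s), and the number of
  -- exponents is below 8 s (c + M ≤ s).
  s₀ = T + 8 + (c + M)

  Ps≥1 : 1 ≤ product Ps
  Ps≥1 = product>0 (All.map (λ {p} (op , _) → <⇒≤ (oddPrime≥2 p op)) orders)

  instance
    T≢0 : NonZero T
    T≢0 = >-nonZero T≥1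

  count : ℕ → ℕ → ℕ
  count N k = ∑ N (λ t → ⟦ oddPrime? ((c + M * t) ∸ 2 ^ k) ⟧)

  -- The prime represented by a covered exponent is the fixed divisor of M.
  count-covered : ∀ N k → v k ≡ 0 → count N k ≤ 1
  count-covered N k v≡0 with covered k v≡0
  ... | p , pp , p∣M , h = ∑-unique N (λ t → oddPrime? ((c + M * t) ∸ 2 ^ k)) λ i j _ _ oi oj →
    *-cancelˡ-≡ i j M {{>-nonZero M≥1}} (+-cancelˡ-≡ c _ _ (trans (determined i oi) (sym (determined j oj))))
    where
    determined : ∀ t → OddPrime ((c + M * t) ∸ 2 ^ k) → c + M * t ≡ p + 2 ^ k
    determined t (pr , _) = trans (sym (m∸n+n≡m 2^k≤)) (cong (_+ 2 ^ k) (sym (prime-∣-prime pp pr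
      (cong-∸ 2^k≤ (cong-trans (cong-∣ p∣M (cong-p* c t)) h)))))
      where
      2^k≤ : 2 ^ k ≤ c + M * t
      2^k≤ = <⇒≤ (m∸n≢0⇒n<m λ ≡0 → ¬prime[0] (subst Prime ≡0 pr))

  -- Completing the range of exponents to full periods at most doubles it, since T ≤ L + 1.
  uncovered-count : ∀ L → T ≤ suc L → T * ∑ L (λ i → v (suc i)) ≤ 2 * suc L * V
  uncovered-count L T≤ = begin
    T * ∑ L (λ i → v (suc i))  ≤⟨ *-monoʳ-≤ T (≤-trans (m≤n+m _ (v 0)) (≤-reflexive (sym (∑-split 1 L v)))) ⟩
    T * ∑ (suc L) v  ≤⟨ *-monoʳ-≤ T (∑-monoˡ v 1+L≤) ⟩
    T * ∑ (suc q * T) v  ≡⟨ cong (T *_) (periodic-*ℕ v-period (suc q)) ⟩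
    T * (suc q * V)  ≡⟨ eq T q V ⟩
    (T + q * T) * V  ≤⟨ *-monoˡ-≤ V (+-mono-≤ T≤ (≤-trans (m/n*n≤m (suc L) T) (≤-reflexive (sym (+-identityʳ (suc L)))))) ⟩
    2 * suc L * V  ∎
    where
    q = suc L / T
    eq : ∀ T q V → T * ((1 + q) * V) ≡ (T + q * T) * V
    eq = solve-∀
    1+L≤ : suc L ≤ suc q * T
    1+L≤ = ≤-trans (≤-reflexive (m≡m%n+[m/n]*n (suc L) T)) (+-monoˡ-≤ (q * T) (m%n≤n (suc L) T))

  -- A covered exponent contributes at most 1, any other the bound of `primes-in-class`. With D =
  -- 2^s the errors are about D⁴ for each of O(s) exponents, which N = D⁶ dominates. The summand c +
  -- M in L lets 2^L exceed all members considered, so that no exponent is missed.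
  represented-bound : ∀ s → s₀ ≤ s → 2 * ∑ (2 ^ (6 * s)) (λ t → ⟦ rep? (6 * s + (c + M)) (c + M * t) ⟧) ≤ 2 ^ (6 * s)
  represented-bound s s₀≤s = *-cancelˡ-≤ 2 (begin
    2 * (2 * R)  ≡⟨ *-assoc 2 2 R ⟨
    4 * R  ≤⟨ *-cancelʳ-≤ _ _ (τ * T * Λ) {{>-nonZero (*-mono-≤ (*-mono-≤ τ≥1 T≥1) Λ≥1)}} scaled ⟩
    N + N  ≡⟨ cong (N +_) (+-identityʳ N) ⟨
    2 * N  ∎)
    where
    D = 2 ^ s
    D⁴ = D * D * (D * D)
    N = 2 ^ (6 * s)
    L = 6 * s + (c + M)
    R = ∑ N (λ t → ⟦ rep? L (c + M * t) ⟧)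
    -- 512 = 4 · 2 · 8 · 8: the factor 4 on R, the 2 of `uncovered-count`, the 8 of
    -- `primes-in-class`, and L + 1 ≤ 8 s. Main terms and errors then amount to at most N each.
    Λ = 512 * suc M₀
    Λ≥1 : 1 ≤ Λ
    Λ≥1 = *-mono-≤ {1} {512} (s≤s z≤n) (s≤s z≤n)
    π = product Ps
    P₊ = product₊ Ps
    τ = s * π
    T≤s : T ≤ s
    T≤s = ≤-trans (≤-trans (m≤m+n T 8) (m≤m+n (T + 8) (c + M))) s₀≤s
    8≤s : 8 ≤ s
    8≤s = ≤-trans (≤-trans (m≤n+m 8 T) (m≤m+n (T + 8) (c + M))) s₀≤s
    s≥1 : 1 ≤ s
    s≥1 = ≤-trans (s≤s z≤n) 8≤s
    τ≥1 : 1 ≤ τ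
    τ≥1 = *-mono-≤ s≥1 Ps≥1
    T≤1+L : T ≤ suc L
    T≤1+L = ≤-trans T≤s (≤-trans (m≤m+n s (5 * s)) (≤-trans (m≤m+n (6 * s) (c + M)) (n≤1+n L)))
    1+L≤ : suc L ≤ 8 * s
    1+L≤ = ≤-trans (s≤s (+-monoʳ-≤ (6 * s) (≤-trans (m≤n+m (c + M) (T + 8)) s₀≤s))) (≤-trans (+-monoˡ-≤ (6 * s + s) s≥1) (≤-reflexive (eq s)))
      where
      eq : ∀ s → s + (6 * s + s) ≡ 8 * s
      eq = solve-∀
    γ = (D + D⁴) * τ + 8 * N * (suc M₀ * P₊)
    V≤T : V ≤ T
    V≤T = ≤-trans (∑-≤const T 1 λ k _ → v≤1 k) (≤-reflexive (*-identityʳ T))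
    term : ∀ i → count N (suc i) * τ ≤ τ + v (suc i) * γ
    term i with v (suc i) in eq | v≤1 (suc i)
    ... | zero        | _ = ≤-trans (*-monoˡ-≤ τ (count-covered N (suc i) eq)) (≤-reflexive (trans (*-identityˡ τ) (sym (+-identityʳ τ))))
    ... | suc zero    | _ = ≤-trans (primes-in-class {c = c} {M₀ = M₀} {X = Ps} M≥1 factors s N (suc i) Ps≥1) (≤-trans (≤-reflexive (sym (*-identityˡ γ))) (m≤n+m (1 * γ) τ))
    ... | suc (suc _) | s≤s ()
    R≤ : R ≤ ∑ L (λ i → count N (suc i))
    R≤ = ≤-trans (∑-mono N λ t _ → ⟦⟧-bound (rep? L (c + M * t)) λ (i , i<L , op) →
        ≤-trans (≤-reflexive (sym (⟦⟧-yes (oddPrime? ((c + M * t) ∸ 2 ^ suc i)) op))) (term≤∑ L (λ i → ⟦ oddPrime? ((c + M * t) ∸ 2 ^ suc i) ⟧) i i<L))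
      (≤-reflexive (∑-swap N L _))
    RτT≤ : R * τ * T ≤ L * τ * T + 2 * suc L * V * γ
    RτT≤ = begin
      R * τ * T  ≤⟨ *-monoˡ-≤ T (*-monoˡ-≤ τ R≤) ⟩
      ∑ L (λ i → count N (suc i)) * τ * T  ≤⟨ *-monoˡ-≤ T (≤-trans (≤-reflexive (sym (∑-*ʳ L τ _))) (∑-mono L λ i _ → term i)) ⟩
      ∑ L (λ i → τ + v (suc i) * γ) * T  ≡⟨ cong (_* T) (trans (∑-+ L _ _) (cong₂ _+_ (∑-const L τ) (∑-*ʳ L γ _))) ⟩
      (L * τ + ∑ L (λ i → v (suc i)) * γ) * T  ≡⟨ eq (L * τ) (∑ L (λ i → v (suc i))) γ T ⟩
      L * τ * T + T * ∑ L (λ i → v (suc i)) * γ  ≤⟨ +-monoʳ-≤ (L * τ * T) (*-monoˡ-≤ γ (uncovered-count L T≤1+L)) ⟩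
      L * τ * T + 2 * suc L * V * γ  ∎
      where
      eq : ∀ a S γ T → (a + S * γ) * T ≡ a * T + T * S * γ
      eq = solve-∀
    small : 4 * (suc L + 2 * suc L * (D + D⁴)) ≤ N
    small = begin
      4 * (suc L + 2 * suc L * (D + D⁴))  ≤⟨ *-monoʳ-≤ 4 (+-mono-≤ (≤-trans 1+L≤ (m≤m*n (8 * s) D⁴ {{>-nonZero D⁴≥1}})) (*-mono-≤ (*-monoʳ-≤ 2 1+L≤) (+-monoˡ-≤ D⁴ D≤D⁴))) ⟩
      4 * (8 * s * D⁴ + 2 * (8 * s) * (D⁴ + D⁴))  ≡⟨ eq s D⁴ ⟩
      160 * s * D⁴  ≤⟨ *-monoˡ-≤ D⁴ (*-mono-≤ 160≤D (<⇒≤ (n<2^n s))) ⟩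
      D * D * D⁴  ≡⟨ trans (eq₂ D) (trans (^-*-assoc 2 s 6) (cong (2 ^_) (*-comm s 6))) ⟩
      N  ∎
      where
      D≥1 : 1 ≤ D
      D≥1 = m^n>0 2 s
      D⁴≥1 : 1 ≤ D⁴
      D⁴≥1 = *-mono-≤ (*-mono-≤ D≥1 D≥1) (*-mono-≤ D≥1 D≥1)
      D≤D⁴ : D ≤ D⁴
      D≤D⁴ = ≤-trans (m≤m*n D (D * (D * D)) {{>-nonZero (*-mono-≤ D≥1 (*-mono-≤ D≥1 D≥1))}}) (≤-reflexive (sym (*-assoc D D (D * D))))
      160≤D : 160 ≤ D
      160≤D = ≤-trans (m≤m+n 160 96) (^-monoʳ-≤ 2 8≤s)
      eq : ∀ s d → 4 * (8 * s * d + 2 * (8 * s) * (d + d)) ≡ 160 * s * d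
      eq = solve-∀
      eq₂ : ∀ D → D * D * (D * D * (D * D)) ≡ D * (D * (D * (D * (D * (D * 1)))))
      eq₂ = solve-∀
    scaled : 4 * R * (τ * T * Λ) ≤ (N + N) * (τ * T * Λ)
    scaled = begin
      4 * R * (τ * T * Λ)
        ≡⟨ eq₁ R τ T Λ ⟩
      4 * (R * τ * T) * Λ
        ≤⟨ *-monoˡ-≤ Λ (*-monoʳ-≤ 4 RτT≤) ⟩
      4 * (L * τ * T + 2 * suc L * V * γ) * Λ
        ≡⟨ eq₂ (L * τ * T) (suc L) V ((D + D⁴) * τ) N (suc M₀) P₊ Λ ⟩
      4 * (L * τ * T + 2 * suc L * (V * ((D + D⁴) * τ))) * Λ + 64 * suc L * N * suc M₀ * (V * P₊ * Λ)
        ≤⟨ +-mono-≤ (*-monoˡ-≤ Λ (*-monoʳ-≤ 4 (+-mono-≤ (*-monoˡ-≤ T (*-monoˡ-≤ τ (n≤1+n L))) (*-monoʳ-≤ (2 * suc L) (*-monoˡ-≤ ((D + D⁴) * τ) V≤T)))))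
             (*-mono-≤ (*-monoˡ-≤ (suc M₀) (*-monoˡ-≤ N (*-monoʳ-≤ 64 1+L≤))) sparse) ⟩
      4 * (suc L * τ * T + 2 * suc L * (T * ((D + D⁴) * τ))) * Λ + 64 * (8 * s) * N * suc M₀ * (T * π)
        ≡⟨ eq₃ (suc L) τ T (D + D⁴) Λ s N (suc M₀) π ⟩
      4 * (suc L + 2 * suc L * (D + D⁴)) * (τ * T * Λ) + N * (s * π * T * (512 * suc M₀))
        ≤⟨ +-monoˡ-≤ (N * (τ * T * Λ)) (*-monoˡ-≤ (τ * T * Λ) small) ⟩
      N * (τ * T * Λ) + N * (τ * T * Λ)
        ≡⟨ *-distribʳ-+ (τ * T * Λ) N N ⟨
      (N + N) * (τ * T * Λ) ∎
      where
      eq₁ : ∀ R τ T Λ → 4 * R * (τ * T * Λ) ≡ 4 * (R * τ * T) * Λ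
      eq₁ = solve-∀
      eq₂ : ∀ a l V d N m P Λ → 4 * (a + 2 * l * V * (d + 8 * N * (m * P))) * Λ ≡ 4 * (a + 2 * l * (V * d)) * Λ + 64 * l * N * m * (V * P * Λ)
      eq₂ = solve-∀
      eq₃ : ∀ l τ T d Λ s N m π → 4 * (l * τ * T + 2 * l * (T * (d * τ))) * Λ + 64 * (8 * s) * N * m * (T * π) ≡
        4 * (l + 2 * l * d) * (τ * T * Λ) + N * (s * π * T * (512 * m))
      eq₃ = solve-∀

-- Progressions and sets of density zero

-- `DensityZero` speaks of duplicate-free lists, so a count over t < N has to be realised as a list
-- of members c + M t.
module Progression (c M : ℕ) (M≥1 : 1 ≤ M) {P : ℕ → Set} (P? : ∀ t → Dec (P t)) where

  members : ℕ → List ℕ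
  members zero    = []
  members (suc N) = consWhen (P? N) (c + M * N) (members N)

  members-length : ∀ N → length (members N) ≡ ∑ N (λ t → ⟦ P? t ⟧)
  members-length zero    = refl
  members-length (suc N) with P? N
  ... | yes _ = trans (cong suc (members-length N)) (+-comm 1 _)
  ... | no _  = trans (members-length N) (sym (+-identityʳ _))

  members-All : ∀ {Q : ℕ → Set} N → (∀ t → t < N → P t → Q (c + M * t)) → All Q (members N)
  members-All zero    h = []
  members-All (suc N) h with P? N
  ... | yes p = h N ≤-refl p ∷ members-All N λ t t<N → h t (m<n⇒m<1+n t<N)
  ... | no _  = members-All N λ t t<N → h t (m<n⇒m<1+n t<N)

  members-unique : ∀ N → Unique (members N)
  members-unique zero    = []
  members-unique (suc N) with P? N
  ... | yes p = members-All N (λ t t<N _ e → <⇒≢ t<N (*-cancelˡ-≡ t N M {{>-nonZero M≥1}} (+-cancelˡ-≡ c _ _ (sym e)))) ∷ members-unique N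
  ... | no _  = members-unique N

  density-zero-count : ∀ {A : ℕ → Set} {k X} →
    (∀ x → X ≤ x → ∀ l → Unique l → All (λ n → 1 ≤ n × n ≤ x × A n) l → k * length l ≤ x) →
    ∀ x → X ≤ x → ∀ N → (∀ t → t < N → P t → 1 ≤ c + M * t × c + M * t ≤ x × A (c + M * t)) →
    k * ∑ N (λ t → ⟦ P? t ⟧) ≤ x
  density-zero-count {k = k} bound x X≤x N h = subst (λ z → k * z ≤ x) (members-length N)
    (bound x X≤x (members N) (members-unique N) (members-All N h))

-- The periodic and decidable counterpart of `InAP`, with the starting points forgotten; both agree
-- from `offset ps` on.
InClass : List (ℕ × ℕ) → ℕ → Set
InClass ps n = Any (λ (m , a) → Cong m n a) ps

inClass? : ∀ ps n → Dec (InClass ps n)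
inClass? ps n = Any.any? (λ (m , a) → cong? m n a) ps

inAP⇒inClass : ∀ {ps n} → Any (λ mp → InAP mp n) ps → InClass ps n
inAP⇒inClass = Any.map λ { {m , a} (h , refl) → cong-trans (cong-reflexive (+-comm (m * h) a)) (cong-p* a h) }

offset : List (ℕ × ℕ) → ℕ
offset []             = 0
offset ((_ , a) ∷ ps) = a + offset ps

inClass⇒inAP : ∀ {ps n} → offset ps ≤ n → InClass ps n → Any (λ mp → InAP mp n) ps
inClass⇒inAP {(m , a) ∷ ps} {n} off≤n (here h)  = here (inAP (cong-∸ a≤n h))
  where
  a≤n : a ≤ n
  a≤n = m+n≤o⇒m≤o a off≤n
  inAP : m ∣ n ∸ a → InAP (m , a) n
  inAP m∣ = quotient m∣ , trans (sym (m∸n+n≡m a≤n)) (cong (_+ a) (m∣n⇒n≡m*quotient m∣))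
inClass⇒inAP {(m , a) ∷ ps} off≤n (there h) = there (inClass⇒inAP (≤-trans (m≤n+m (offset ps) a) off≤n) h)

-- The base value 2 makes the modulus even, so a class with one odd member has only odd members.
modulus : List (ℕ × ℕ) → ℕ
modulus []             = 2
modulus ((m , _) ∷ ps) = m * modulus ps

modulus≥1 : ∀ {ps} → All ValidAP ps → 1 ≤ modulus ps
modulus≥1 []              = s≤s z≤n
modulus≥1 ((m≥1 , _) ∷ v) = *-mono-≤ m≥1 (modulus≥1 v)

2∣modulus : ∀ ps → 2 ∣ modulus ps
2∣modulus []             = ∣-refl
2∣modulus ((m , _) ∷ ps) = ∣n⇒∣m*n m (2∣modulus ps)

inClass-cong : ∀ {ps n n′} → Cong (modulus ps) n n′ → InClass ps n → InClass ps n′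
inClass-cong {(m , a) ∷ ps} h (here x)  = here (cong-trans (cong-sym (cong-∣ (m∣m*n (modulus ps)) h)) x)
inClass-cong {(m , a) ∷ ps} h (there x) = there (inClass-cong (cong-∣ (n∣m*n m) h) x)

rep⇒∉𝒰 : ∀ {L n} → Rep L n → ¬ 𝒰 n
rep⇒∉𝒰 {L} {n} (i , _ , pp , _) (_ , _ , none) = none (n ∸ 2 ^ suc i , suc i , pp , s≤s z≤n ,
  sym (m∸n+n≡m (<⇒≤ (m∸n≢0⇒n<m {n} {2 ^ suc i} λ ≡0 → ¬prime[0] (subst Prime ≡0 pp)))))

rep⇒odd : ∀ {L n} → Rep L n → ¬ 2 ∣ n
rep⇒odd {L} {n} (i , _ , op@(pp , _)) 2∣n = odd-prime-odd op (∣m+n∣m⇒∣n {2} {2 ^ suc i}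
  (subst (2 ∣_) (sym (m+[n∸m]≡n (<⇒≤ (m∸n≢0⇒n<m {n} {2 ^ suc i} λ ≡0 → ¬prime[0] (subst Prime ≡0 pp))))) 2∣n) (m∣m*n (2 ^ i)))

-- The restrictions built into `Rep` lose nothing here: n ≤ 2^L bounds every possible exponent by L,
-- and an odd n excludes p = 2.
¬rep⇒𝒰 : ∀ {L n} → ¬ 2 ∣ n → n ≤ 2 ^ L → ¬ Rep L n → 𝒰 n
¬rep⇒𝒰 {L} {n} odd n≤2^L ¬rep = positive n odd , odd-% , λ { (p , suc i , pp , _ , n≡) → ¬rep (i , i<L p i pp n≡ , oddPrime p i pp n≡) }
  where
  positive : ∀ n → ¬ 2 ∣ n → 1 ≤ n
  positive zero    odd = contradiction (2 ∣0) odd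
  positive (suc n) _   = s≤s z≤n
  odd-% : n % 2 ≡ 1
  odd-% with n % 2 in eq | m%n<n n 2
  ... | 0           | _ = contradiction (m%n≡0⇒n∣m n 2 eq) odd
  ... | 1           | _ = refl
  ... | suc (suc _) | s≤s (s≤s ())
  i<L : ∀ p i → Prime p → n ≡ p + 2 ^ suc i → i < L
  i<L p i pp n≡ = ≮⇒≥ λ L<1+i → <⇒≱ (^-monoʳ-< 2 (s≤s (s≤s z≤n)) L<1+i) (≤-trans (≤-trans (m≤n+m (2 ^ suc i) p) (≤-reflexive (sym n≡))) n≤2^L)
  oddPrime : ∀ p i → Prime p → n ≡ p + 2 ^ suc i → OddPrime (n ∸ 2 ^ suc i)
  oddPrime p i pp n≡ = subst OddPrime (sym (trans (cong (_∸ 2 ^ suc i) n≡) (m+n∸n≡m p (2 ^ suc i))))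
    (pp , λ p≡2 → odd (subst (2 ∣_) (sym n≡) (∣m∣n⇒∣m+n (subst (2 ∣_) (sym p≡2) ∣-refl) (m∣m*n (2 ^ i)))))

n<2^cn : ∀ c n → 1 ≤ c → n < 2 ^ (c * n)
n<2^cn c n c≥1 = <-≤-trans (n<2^n n) (^-monoʳ-≤ 2 (m≤n*m n c {{>-nonZero c≥1}}))

module _ (S : Pred ℕ 0ℓ) (dS : DensityZero S) (ps : List (ℕ × ℕ)) (Z : Pred ℕ 0ℓ)
  (valid : All ValidAP ps) (dZ : DensityZero Z) (union : IsAPUnionPlus (𝒰 ∪ₚ S) ps Z) where

  -- Otherwise every representable n ≥ `offset ps` would lie in a progression, hence in 𝒰 ∪ S, hence
  -- in S. Romanoff's bound makes these about N / κ in number, while S has at most N / (2κ + 1)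
  -- elements up to N.
  avoided-representable : ∀ κ → (∀ s → 1 ≤ s → 2 ^ (10 * s) ≤ κ * ∑ (suc (2 ^ (10 * s))) (λ n → ⟦ rep? (10 * s ∸ 1) n ⟧)) →
    ∀ s → 1 ≤ s → proj₁ (dS (2 * κ + 1) (m≤n+m 1 (2 * κ))) + 2 * κ * offset ps ≤ s → ∃ λ L → ∃ λ n → Rep L n × ¬ InClass ps n
  avoided-representable κ bound s s≥1 large = search (anyUpTo? (λ n → rep? ℓ n ×-dec ((offset ps ≤? n) ×-dec ¬? (inClass? ps n))) (suc N))
    where
    -- The summand 1 keeps the parameter positive for every κ; the bound is then used with 2 κ.
    density = dS (2 * κ + 1) (m≤n+m 1 (2 * κ))
    X = proj₁ density
    N = 2 ^ (10 * s)
    ℓ = 10 * s ∸ 1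
    A = offset ps
    P? : ∀ n → Dec (Rep ℓ n × A ≤ n)
    P? n = rep? ℓ n ×-dec (A ≤? n)
    R = ∑ (suc N) (λ n → ⟦ rep? ℓ n ⟧)
    R′ = ∑ (suc N) (λ n → ⟦ P? n ⟧)
    s<N : s < N
    s<N = n<2^cn 10 s (s≤s z≤n)
    None : Set
    None = ¬ ∃ λ n → n < suc N × Rep ℓ n × A ≤ n × ¬ InClass ps n
    in-S : None → ∀ n → n < suc N → Rep ℓ n × A ≤ n → S n
    in-S none n n≤N (rep , A≤n) with inClass? ps n
    ... | no ∉  = contradiction (n , n≤N , rep , A≤n , ∉) none
    ... | yes ∈ with proj₂ (union n) (inj₁ (inClass⇒inAP A≤n ∈))
    ...   | inj₁ n∈𝒰 = contradiction n∈𝒰 (rep⇒∉𝒰 rep)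
    ...   | inj₂ n∈S = n∈S
    [2κ+1]R′≤ : None → (2 * κ + 1) * R′ ≤ N
    [2κ+1]R′≤ none = Progression.density-zero-count 0 1 ≤-refl P? {A = S} {k = 2 * κ + 1} (proj₂ density) N (≤-trans (≤-trans (m≤m+n X (2 * κ * A)) large) (<⇒≤ s<N)) (suc N)
      λ n n≤N x → subst (λ z → 1 ≤ z × z ≤ N × S z) (sym (*-identityˡ n)) (positive n (proj₁ x) , s≤s⁻¹ n≤N , in-S none n n≤N x)
      where
      positive : ∀ n → Rep ℓ n → 1 ≤ n
      positive zero    rep = contradiction (2 ∣0) (rep⇒odd {ℓ} rep)
      positive (suc n) _   = s≤s z≤n
    R≤ : R ≤ A + R′
    R≤ = begin
      R  ≤⟨ ∑-mono (suc N) (λ n _ → split n) ⟩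
      ∑ (suc N) (λ n → ⟦ n <? A ⟧ + ⟦ P? n ⟧)  ≡⟨ ∑-+ (suc N) _ _ ⟩
      ∑ (suc N) (λ n → ⟦ n <? A ⟧) + R′  ≤⟨ +-monoˡ-≤ R′ below-A ⟩
      A + R′  ∎
      where
      split : ∀ n → ⟦ rep? ℓ n ⟧ ≤ ⟦ n <? A ⟧ + ⟦ P? n ⟧
      split n = ⟦⟧-bound (rep? ℓ n) λ rep → lemma rep (n <? A)
        where
        lemma : Rep ℓ n → (d : Dec (n < A)) → 1 ≤ ⟦ d ⟧ + ⟦ P? n ⟧
        lemma rep (yes _)  = s≤s z≤n
        lemma rep (no n≮A) = ≤-reflexive (sym (⟦⟧-yes (P? n) (rep , ≮⇒≥ n≮A)))
      below-A : ∑ (suc N) (λ n → ⟦ n <? A ⟧) ≤ A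
      below-A = begin
        ∑ (suc N) (λ n → ⟦ n <? A ⟧)  ≤⟨ ∑-monoˡ _ (m≤n+m (suc N) A) ⟩
        ∑ (A + suc N) (λ n → ⟦ n <? A ⟧)  ≡⟨ ∑-split A (suc N) _ ⟩
        ∑ A (λ n → ⟦ n <? A ⟧) + ∑ (suc N) (λ n → ⟦ A + n <? A ⟧)  ≤⟨ +-mono-≤ (∑-≤const A 1 λ n _ → ⟦⟧≤1 (n <? A)) (≤-reflexive (∑-zero (suc N) λ n _ → ⟦⟧-no (A + n <? A) (m+n≮m A n))) ⟩
        A * 1 + 0  ≡⟨ trans (+-identityʳ _) (*-identityʳ A) ⟩
        A  ∎
    N≤ : None → N ≤ s
    N≤ none = +-cancelʳ-≤ N N s (begin
      N + N  ≤⟨ +-mono-≤ N≤κR N≤κR ⟩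
      κ * R + κ * R  ≤⟨ +-mono-≤ (*-monoʳ-≤ κ R≤) (*-monoʳ-≤ κ R≤) ⟩
      κ * (A + R′) + κ * (A + R′)  ≡⟨ eq κ A R′ ⟩
      2 * κ * A + 2 * κ * R′  ≤⟨ +-mono-≤ (≤-trans (m≤n+m (2 * κ * A) X) large) (≤-trans (*-monoˡ-≤ R′ (m≤m+n (2 * κ) 1)) ([2κ+1]R′≤ none)) ⟩
      s + N  ∎)
      where
      N≤κR : N ≤ κ * R
      N≤κR = bound s s≥1
      eq : ∀ κ A R → κ * (A + R) + κ * (A + R) ≡ 2 * κ * A + 2 * κ * R
      eq = solve-∀
    search : Dec (∃ λ n → n < suc N × Rep ℓ n × A ≤ n × ¬ InClass ps n) → ∃ λ L → ∃ λ n → Rep L n × ¬ InClass ps n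
    search (yes (n , _ , rep , _ , ∉)) = ℓ , n , rep , ∉
    search (no none)                   = contradiction (N≤ none) (<⇒≱ s<N)

  -- Of the members with t < N at least half are not representable; these are in 𝒰 and avoid the
  -- progressions, so they are in Z. The density parameter 4 M gives 4 M U ≤ c + M N, and with 2 U ≥
  -- N this forces M N ≤ c, which fails for large s.
  no-density-zero-class : ∀ {c₀} → ¬ 2 ∣ c₀ → ¬ InClass ps c₀ → (𝒞 : ∃ (Cover c₀ (modulus ps))) → let open Cover (proj₂ 𝒞) in
    ∀ s₀ → (∀ s → s₀ ≤ s → 2 * ∑ (2 ^ (6 * s)) (λ t → ⟦ rep? (6 * s + (c + M)) (c + M * t) ⟧) ≤ 2 ^ (6 * s)) →
    ∀ s → s₀ ≤ s → c ≤ s → proj₁ (dZ (4 * M) (*-mono-≤ {1} {4} (s≤s z≤n) M≥1)) ≤ s → ⊥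
  no-density-zero-class {c₀} odd ∉ (_ , 𝒞) s₀ represented-bound s s₀≤s c≤s X≤s = contradiction N≤c (<⇒≱ (≤-<-trans c≤s s<N))
    where
    open Cover 𝒞
    density = dZ (4 * M) (*-mono-≤ {1} {4} (s≤s z≤n) M≥1)
    N = 2 ^ (6 * s)
    L = 6 * s + (c + M)
    n : ℕ → ℕ
    n t = c + M * t
    s<N : s < N
    s<N = n<2^cn 6 s (s≤s z≤n)
    N≥1 : 1 ≤ N
    N≥1 = m^n>0 2 (6 * s)
    n≡c₀ : ∀ t → Cong (modulus ps) (n t) c₀
    n≡c₀ t = cong-trans (cong-∣ M₀∣M (cong-p* c t)) c≡c₀
    n-odd : ∀ t → ¬ 2 ∣ n t
    n-odd t 2∣n = odd (cong0⇒∣ (cong-trans (cong-sym (cong-∣ (2∣modulus ps) (n≡c₀ t))) (∣⇒cong0 2∣n)))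
    n≤x : ∀ t → t < N → n t ≤ c + M * N
    n≤x t t<N = +-monoʳ-≤ c (*-monoʳ-≤ M (<⇒≤ t<N))
    n≤2^L : ∀ t → t < N → n t ≤ 2 ^ L
    n≤2^L t t<N = begin
      n t  ≤⟨ n≤x t t<N ⟩
      c + M * N  ≤⟨ +-monoˡ-≤ (M * N) (m≤m*n c N {{>-nonZero N≥1}}) ⟩
      c * N + M * N  ≡⟨ trans (sym (*-distribʳ-+ N c M)) (*-comm (c + M) N) ⟩
      N * (c + M)  ≤⟨ *-monoʳ-≤ N (<⇒≤ (n<2^n (c + M))) ⟩
      N * 2 ^ (c + M)  ≡⟨ ^-distribˡ-+-* 2 (6 * s) (c + M) ⟨
      2 ^ L  ∎
    in-Z : ∀ t → t < N → ¬ Rep L (n t) → Z (n t)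
    in-Z t t<N ¬rep = [ (λ ∈AP → contradiction (inClass-cong (n≡c₀ t) (inAP⇒inClass ∈AP)) ∉) , id ]′
      (proj₁ (union (n t)) (inj₁ (¬rep⇒𝒰 {L} (n-odd t) (n≤2^L t t<N) ¬rep)))
    U = ∑ N (λ t → ⟦ ¬? (rep? L (n t)) ⟧)
    R = ∑ N (λ t → ⟦ rep? L (n t) ⟧)
    4MU≤ : 4 * M * U ≤ c + M * N
    4MU≤ = Progression.density-zero-count c M M≥1 (λ t → ¬? (rep? L (n t))) {A = Z} {k = 4 * M} (proj₂ density) (c + M * N)
      (≤-trans X≤s (≤-trans (<⇒≤ s<N) (≤-trans (m≤n*m N M {{>-nonZero M≥1}}) (m≤n+m (M * N) c)))) N
      λ t t<N ¬rep → positive (n t) (n-odd t) , n≤x t t<N , in-Z t t<N ¬rep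
      where
      positive : ∀ n → ¬ 2 ∣ n → 1 ≤ n
      positive zero    odd = contradiction (2 ∣0) odd
      positive (suc n) _   = s≤s z≤n
    N≤2U : N ≤ 2 * U
    N≤2U = +-cancelʳ-≤ N N (2 * U) (begin
      N + N  ≡⟨ cong (N +_) (+-identityʳ N) ⟨
      2 * N  ≡⟨ cong (2 *_) (trans (sym (trans (∑-const N 1) (*-identityʳ N))) (trans (∑-cong N λ t _ → complement (rep? L (n t))) (∑-+ N _ _))) ⟩
      2 * (U + R)  ≡⟨ *-distribˡ-+ 2 U R ⟩
      2 * U + 2 * R  ≤⟨ +-monoʳ-≤ (2 * U) (represented-bound s s₀≤s) ⟩
      2 * U + N  ∎)
      where
      complement : ∀ {P : Set} (d : Dec P) → 1 ≡ ⟦ ¬? d ⟧ + ⟦ d ⟧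
      complement (yes _) = refl
      complement (no _)  = refl
    N≤c : N ≤ c
    N≤c = ≤-trans (m≤n*m N M {{>-nonZero M≥1}}) (+-cancelʳ-≤ (M * N) (M * N) c (begin
      M * N + M * N  ≡⟨ cong (M * N +_) (+-identityʳ (M * N)) ⟨
      2 * (M * N)  ≤⟨ *-monoʳ-≤ 2 (*-monoʳ-≤ M N≤2U) ⟩
      2 * (M * (2 * U))  ≡⟨ eq M U ⟩
      4 * M * U  ≤⟨ 4MU≤ ⟩
      c + M * N  ∎))
      where
      eq : ∀ M U → 2 * (M * (2 * U)) ≡ 4 * M * U
      eq = solve-∀

theorem1 : (S : Pred ℕ 0ℓ) → (∀ n → S n → 1 ≤ n) → DensityZero S →
    ¬ (Σ (List (ℕ × ℕ)) λ ps → Σ (Pred ℕ 0ℓ) λ Z →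
    All ValidAP ps × DensityZero Z × IsAPUnionPlus (𝒰 ∪ₚ S) ps Z)
theorem1 S _ dS (ps , Z , valid , dZ , union) = conclude (proj₁ romanoff) (proj₂ romanoff)
  where
  M₀ = modulus ps
  odd-class : ∀ n → ¬ 2 ∣ n → ¬ InClass ps n → ⊥
  odd-class n odd ∉ = thin (sparse-cover n M₀ (modulus≥1 valid) (512 * suc M₀))
    where
    thin : (Σ (List ℕ) λ qs → Σ (Cover n M₀ qs) λ 𝒞 → let open Cover 𝒞 in
      1 ≤ product qs × ∑ (product qs) v * product₊ Ps * (512 * suc M₀) ≤ product qs * product Ps) → ⊥
    thin (qs , 𝒞 , T≥1 , sparse) = no-density-zero-class S dS ps Z valid dZ union odd ∉ (qs , 𝒞) s₀ represented-bound
      (s₀ + X) (m≤m+n s₀ X) (≤-trans (≤-trans (m≤m+n c M) (m≤n+m (c + M) (product qs + 8))) (m≤m+n s₀ X)) (m≤n+m X s₀)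
      where
      open Cover 𝒞
      open ThinClass 𝒞 T≥1 sparse using (s₀; represented-bound)
      X = proj₁ (dZ (4 * M) (*-mono-≤ {1} {4} (s≤s z≤n) M≥1))
  conclude : ∀ κ → (∀ s → 1 ≤ s → 2 ^ (10 * s) ≤ κ * ∑ (suc (2 ^ (10 * s))) (λ n → ⟦ rep? (10 * s ∸ 1) n ⟧)) → ⊥
  conclude κ bound with avoided-representable S dS ps Z valid dZ union κ bound (suc _) (s≤s z≤n) (n≤1+n _)
  ... | L , n , rep , ∉ = odd-class n (rep⇒odd {L} rep) ∉
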